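{- The edge generating series of the Grand Motzkin lattices is $$\sum_{n\ge0}\ell(\mathcal{GM}_n)x^n=\frac{2x^2}{(1-3x)\sqrt{1-2x-3x^2}}.$$ Moreover, for every $n\ge0$: $$\ell(\mathcal{GM}_{n+2})=2\sum_{k=0}^nT_k\,3^{n-k}=\frac{2}{4^n}\sum_{k=0}^n\binom{2k}{k}\binom{2n-2k}{n-k}(2k+1)3^k(-1)^{n-k}=2\sum_{k=0}^n\binom{n+1}{k+1}\binom{2k}{k}(-1)^k3^{n-k}.$$ Finally, $\ell(\mathcal{GM}_n)\sim 2\cdot3^{n-2}\sqrt{3n/\pi}$ and $i(\mathcal{GM}_n)\sim\frac49 n$.
   Context: Steps: $U=(1,1)$, $D=(1,-1)$, $H=(1,0)$. $\mathcal{GM}_n$ is the set of all lattice paths from $(0,0)$ to $(n,0)$ with steps $U,D,H$, partially ordered by $\gamma_1\le\gamma_2$ iff $\gamma_1$ lies weakly below $\gamma_2$. $\ell(P)$ is the number of edges (covering pairs) of the Hasse diagram of a finite poset $P$ and $i(P)=\ell(P)/|P|$. $T_k=[x^k](1+x+x^2)^k$ is the central trinomial coefficient (so $|\mathcal{GM}_n|=T_n$). $a_n\sim b_n$ means $a_n/b_n\to1$. -}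

module Defs where

open import Axiom.UniquenessOfIdentityProofs using (module Decidable⇒UIP)
open import Data.Empty using (⊥-elim)
open import Data.Fin.Base using (Fin; zero; suc; toℕ; fromℕ)
import Data.Fin.Properties as Fin
open import Data.Integer.Base as ℤ using (ℤ; +_; -[1+_]; 0ℤ)
import Data.Integer.Properties as ℤ
import Data.Integer.Solver as ℤSolver
import Algebra.Properties.AbelianGroup ℤ.+-0-abelianGroup as ℤ-Group
open import Data.List.Base using (List; []; _∷_; length; filter; cartesianProduct; cartesianProductWith)
open import Data.List.Membership.Propositional using (_∈_)
open import Data.List.Membership.Propositional.Properties using (∈-cartesianProductWith⁺)
open import Data.List.Relation.Unary.All as All using (All; []; _∷_)
open import Data.List.Relation.Unary.AllPairs using ([]; _∷_)
open import Data.List.Relation.Unary.Any using (here; there)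
open import Data.List.Relation.Unary.Enumerates.Setoid using (IsEnumeration)
open import Data.List.Relation.Unary.Unique.Setoid using (Unique)
import Data.List.Relation.Unary.Unique.Propositional as UniqueP
import Data.List.Relation.Unary.Unique.Propositional.Properties as UniqueP
open import Data.Nat.Base as ℕ using (ℕ; zero; suc; z≤n; s≤s)
import Data.Nat.DivMod as ℕ
import Data.Nat.Properties as ℕ
open import Data.Product.Base using (Σ-syntax; ∃-syntax; _×_; _,_; proj₁; proj₂; uncurry)
open import Data.Rational.Base as ℚ using (ℚ; 0ℚ; 1ℚ; ½; mkℚ; _/_)
import Data.Rational.Properties as ℚ
import Data.Rational.Unnormalised.Base as ℚᵘ
import Data.Rational.Unnormalised.Properties as ℚᵘ
import Data.Rational.Solver as ℚSolver
open import Data.Sum.Base using (inj₁; inj₂)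
open import Data.Vec.Base as Vec using (Vec; []; _∷_)
open import Function.Base using (_∘_; _$_)
open import Level using (0ℓ)
open import Relation.Binary.Bundles using (DecPoset)
open import Relation.Binary.Construct.NonStrictToStrict using (<-decidable)
import Relation.Binary.Properties.Poset as Poset
open import Relation.Binary.PropositionalEquality
  using (_≡_; refl; sym; trans; cong; cong₂; subst; subst₂; isEquivalence; module ≡-Reasoning)
open import Relation.Nullary using (¬_; Dec; yes; no; contradiction)
open import Relation.Nullary.Decidable using (map′; toWitness; _×-dec_; ¬?)

open import Algebra.Definitions.RawSemiring ℚ.+-*-rawSemiring public
  using () renaming (_^_ to _^ℚ_)

record FinitePoset : Set₁ where
  field
    decPoset : DecPoset 0ℓ 0ℓ 0ℓ

  open DecPoset decPoset public

  field
    elements : List Carrier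
    complete : IsEnumeration Eq.setoid elements
    distinct : Unique Eq.setoid elements

  open Poset poset public using (_<_; <-respˡ-≈; <-respʳ-≈)

  infix 4 _<?_ _⋖_ _⋖?_

  _<?_ : ∀ x y → Dec (x < y)
  _<?_ = <-decidable _≈_ _≤_ _≟_ _≤?_

  _⋖_ : Carrier → Carrier → Set
  x ⋖ y = x < y × (∀ z → ¬ (x < z × z < y))

  _⋖?_ : ∀ x y → Dec (x ⋖ y)
  x ⋖? y = x <? y ×-dec
    map′ (λ none z → All.lookupₛ Eq.setoid resp none (complete z))
         (λ none → All.universal none elements)
         (All.all? (λ z → ¬? (x <? z ×-dec z <? y)) elements)
    where
    resp : ∀ {z w} → z ≈ w → ¬ (x < z × z < y) → ¬ (x < w × w < y)
    resp z≈w ¬z (x<w , w<y) =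
      ¬z (<-respʳ-≈ (Eq.sym z≈w) x<w , <-respˡ-≈ (Eq.sym z≈w) w<y)

  size : ℕ
  size = length elements

  coverings : List (Carrier × Carrier)
  coverings = filter (uncurry _⋖?_) (cartesianProduct elements elements)

ℓ : FinitePoset → ℕ
ℓ P = length (FinitePoset.coverings P)

i : (P : FinitePoset) → .{{ℕ.NonZero (FinitePoset.size P)}} → ℚ
i P = + ℓ P / FinitePoset.size P

data Step : Set where
  U D H : Step

rise : Step → ℤ
rise U = + 1
rise D = ℤ.- + 1
rise H = + 0

-- Every step advances the abscissa by one, so a path from (0,0) to a point
-- of abscissa n has n steps; height γ k is its ordinate at abscissa k.
height : ∀ {n} → Vec Step n → Fin (suc n) → ℤ
height γ       zero    = 0ℤ
height (s ∷ γ) (suc k) = rise s ℤ.+ height γ k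

GrandMotzkin : ℕ → Set
GrandMotzkin n = Σ[ γ ∈ Vec Step n ] height γ (fromℕ n) ≡ 0ℤ

-- A path is linear between consecutive integer abscissas, so lying weakly
-- below can be tested at the integer abscissas.
_≤ᴳ_ : ∀ {n} → GrandMotzkin n → GrandMotzkin n → Set
(γ₁ , _) ≤ᴳ (γ₂ , _) = ∀ k → height γ₁ k ℤ.≤ height γ₂ k

rise-injective : ∀ s t → rise s ≡ rise t → s ≡ t
rise-injective U U _ = refl
rise-injective D D _ = refl
rise-injective H H _ = refl

rise-+0 : ∀ {n} s (γ : Vec Step n) → height (s ∷ γ) (suc zero) ≡ rise s
rise-+0 s γ = ℤ.+-identityʳ (rise s)

height-injective : ∀ {n} (γ δ : Vec Step n) →
                   (∀ k → height γ k ≡ height δ k) → γ ≡ δ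
height-injective []      []      eq = refl
height-injective (s ∷ γ) (t ∷ δ) eq
  with refl ← rise-injective s t
                (trans (sym (rise-+0 s γ)) (trans (eq (suc zero)) (rise-+0 t δ)))
  = cong (s ∷_) (height-injective γ δ λ k → ℤ-Group.∙-cancelˡ (rise s) _ _ (eq (suc k)))

GM-≡ : ∀ {n} {γ δ : GrandMotzkin n} → proj₁ γ ≡ proj₁ δ → γ ≡ δ
GM-≡ {γ = γ , p} {δ = _ , q} refl = cong (γ ,_) (Decidable⇒UIP.≡-irrelevant ℤ._≟_ p q)

allSteps : List Step
allSteps = U ∷ D ∷ H ∷ []

allPaths : ∀ n → List (Vec Step n)
allPaths zero    = [] ∷ []
allPaths (suc n) = cartesianProductWith _∷_ allSteps (allPaths n)

allPaths-complete : ∀ {n} (γ : Vec Step n) → γ ∈ allPaths n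
allPaths-complete []      = here refl
allPaths-complete (s ∷ γ) = ∈-cartesianProductWith⁺ _∷_ (∈-allSteps s) (allPaths-complete γ)
  where
  ∈-allSteps : ∀ s → s ∈ allSteps
  ∈-allSteps U = here refl
  ∈-allSteps D = there (here refl)
  ∈-allSteps H = there (there (here refl))

allPaths-distinct : ∀ n → UniqueP.Unique (allPaths n)
allPaths-distinct zero    = [] ∷ []
allPaths-distinct (suc n) =
  UniqueP.cartesianProductWith⁺ _∷_ (λ { refl → refl , refl }) steps (allPaths-distinct n)
  where
  steps : UniqueP.Unique allSteps
  steps = ((λ ()) ∷ (λ ()) ∷ []) ∷ ((λ ()) ∷ []) ∷ [] ∷ []

closed : ∀ {n} → List (Vec Step n) → List (GrandMotzkin n)
closed []       = []
closed {n} (γ ∷ γs) with height γ (fromℕ n) ℤ.≟ 0ℤ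
... | yes p = (γ , p) ∷ closed γs
... | no  _ = closed γs

closed-complete : ∀ {n} {γs : List (Vec Step n)} (γ : GrandMotzkin n) →
                  proj₁ γ ∈ γs → γ ∈ closed γs
closed-complete {n} {δ ∷ γs} γ γ∈ with height δ (fromℕ n) ℤ.≟ 0ℤ | γ∈
... | yes _ | here eq   = here (GM-≡ eq)
... | yes _ | there γ∈′ = there (closed-complete γ γ∈′)
... | no ¬p | here refl = contradiction (proj₂ γ) ¬p
... | no _  | there γ∈′ = closed-complete γ γ∈′

closed-All : ∀ {n} {P : Vec Step n → Set} {γs} → All P γs → All (P ∘ proj₁) (closed γs)
closed-All [] = []
closed-All {n} {γs = δ ∷ _} (px ∷ pxs) with height δ (fromℕ n) ℤ.≟ 0ℤ
... | yes _ = px ∷ closed-All pxs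
... | no  _ = closed-All pxs

closed-distinct : ∀ {n} {γs : List (Vec Step n)} → UniqueP.Unique γs →
                  UniqueP.Unique (closed γs)
closed-distinct [] = []
closed-distinct {n} {δ ∷ _} (δ∉ ∷ u) with height δ (fromℕ n) ℤ.≟ 0ℤ
... | yes _ = All.map (_∘ cong proj₁) (closed-All δ∉) ∷ closed-distinct u
... | no  _ = closed-distinct u

GM : ℕ → FinitePoset
GM n = record
  { decPoset = record
    { Carrier = GrandMotzkin n
    ; _≈_     = _≡_
    ; _≤_     = _≤ᴳ_
    ; isDecPartialOrder = record
      { isPartialOrder = record
        { isPreorder = record
          { isEquivalence = isEquivalence
          ; reflexive     = λ { refl k → ℤ.≤-refl }
          ; trans         = λ γ≤δ δ≤ε k → ℤ.≤-trans (γ≤δ k) (δ≤ε k)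
          }
        ; antisym = λ {γ} {δ} γ≤δ δ≤γ →
            GM-≡ (height-injective (proj₁ γ) (proj₁ δ) λ k → ℤ.≤-antisym (γ≤δ k) (δ≤γ k))
        }
      ; _≟_  = λ γ δ → map′ GM-≡ (cong proj₁)
                 (map′ (height-injective (proj₁ γ) (proj₁ δ)) (λ { refl k → refl })
                   (Fin.all? λ k → height (proj₁ γ) k ℤ.≟ height (proj₁ δ) k))
      ; _≤?_ = λ γ δ → Fin.all? λ k → height (proj₁ γ) k ℤ.≤? height (proj₁ δ) k
      }
    }
  ; elements = closed (allPaths n)
  ; complete = λ γ → closed-complete γ (allPaths-complete (proj₁ γ))
  ; distinct = closed-distinct (allPaths-distinct n)
  }

flat : ∀ n → GrandMotzkin n
flat n = Vec.replicate n H , flat-height n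
  where
  flat-height : ∀ n → height (Vec.replicate n H) (fromℕ n) ≡ 0ℤ
  flat-height zero    = refl
  flat-height (suc n) = trans (ℤ.+-identityˡ _) (flat-height n)

GM-nonEmpty : ∀ n → ℕ.NonZero (FinitePoset.size (GM n))
GM-nonEmpty n with FinitePoset.elements (GM n) | FinitePoset.complete (GM n) (flat n)
... | _ ∷ _ | _ = _

fromℤ : ℤ → ℚ
fromℤ k = k / 1

fromℕℚ : ℕ → ℚ
fromℕℚ n = fromℤ (+ n)

infixr 6 Σ≤

Σ≤ : ℕ → (ℕ → ℚ) → ℚ
Σ≤ zero    f = f 0
Σ≤ (suc n) f = Σ≤ n f ℚ.+ f (suc n)

syntax Σ≤ n (λ k → e) = Σ[ k ≤ n ] e

-- The series Σₙ f n xⁿ.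
Series : Set
Series = ℕ → ℚ

poly : List ℤ → Series
poly []       n       = 0ℚ
poly (a ∷ as) zero    = fromℤ a
poly (a ∷ as) (suc n) = poly as n

infixl 7 _*ₛ_ _÷ₛ_
infixr 8 _^ₛ_
infix  8 1/ₛ_ √ₛ_

_*ₛ_ : Series → Series → Series
(f *ₛ g) n = Σ[ k ≤ n ] f k ℚ.* g (n ℕ.∸ k)

_^ₛ_ : Series → ℕ → Series
f ^ₛ zero  = poly (+ 1 ∷ [])
f ^ₛ suc n = f *ₛ (f ^ₛ n)

dot : ∀ {n} → Vec ℚ n → Vec ℚ n → ℚ
dot []       []       = 0ℚ
dot (a ∷ as) (b ∷ bs) = a ℚ.* b ℚ.+ dot as bs

-- 1/ₛ-coeffs f n and √ₛ-coeffs f n list the coefficients gₙ, …, g₀ of the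
-- series g being constructed, in this order.

-- From f g = 1:  g₀ = 1/f₀  and  gₙ₊₁ = - (f₁ gₙ + ⋯ + fₙ₊₁ g₀) / f₀.
1/ₛ-coeffs : (f : Series) .{{_ : ℚ.NonZero (f 0)}} → ∀ n → Vec ℚ (suc n)
1/ₛ-coeffs f zero    = ℚ.1/ f 0 ∷ []
1/ₛ-coeffs f (suc n) = ℚ.- (dot (Vec.tabulate (f ∘ suc ∘ toℕ)) gs) ℚ.* ℚ.1/ f 0 ∷ gs
  where gs = 1/ₛ-coeffs f n

1/ₛ_ : (f : Series) .{{_ : ℚ.NonZero (f 0)}} → Series
(1/ₛ f) n = Vec.head (1/ₛ-coeffs f n)

_÷ₛ_ : (f g : Series) .{{_ : ℚ.NonZero (g 0)}} → Series
f ÷ₛ g = f *ₛ (1/ₛ g)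

-- From g² = f and g₀ = 1:  gₙ₊₁ = (fₙ₊₁ - (g₁ gₙ + ⋯ + gₙ g₁)) / 2.
√ₛ-coeffs : Series → ∀ n → Vec ℚ (suc n)
√ₛ-coeffs f zero    = 1ℚ ∷ []
√ₛ-coeffs f (suc n) = ½ ℚ.* (f (suc n) ℚ.- dot (Vec.init gs) (Vec.reverse (Vec.init gs))) ∷ gs
  where gs = √ₛ-coeffs f n

-- The square root with constant term 1 of a series with constant term 1.
√ₛ_ : Series → Series
(√ₛ f) n = Vec.head (√ₛ-coeffs f n)

T : ℕ → ℚ
T k = (poly (+ 1 ∷ + 1 ∷ + 1 ∷ []) ^ₛ k) k

edgeSeries : Series
edgeSeries n = fromℕℚ (ℓ (GM n))

/-mono-≤ : ∀ a b c d .{{_ : ℕ.NonZero b}} .{{_ : ℕ.NonZero d}} →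
           a ℕ.* d ℕ.≤ c ℕ.* b → + a / b ℚ.≤ + c / d
/-mono-≤ a (suc b) c (suc d) le = ℚ.toℚᵘ-cancel-≤ $
  ℚᵘ.≤-respˡ-≃ (ℚᵘ.≃-sym (ℚ.toℚᵘ-fromℚᵘ (ℚᵘ.mkℚᵘ (+ a) b))) $
  ℚᵘ.≤-respʳ-≃ (ℚᵘ.≃-sym (ℚ.toℚᵘ-fromℚᵘ (ℚᵘ.mkℚᵘ (+ c) d))) $
  ℚᵘ.*≤* (subst₂ ℤ._≤_ (ℤ.pos-* a (suc d)) (ℤ.pos-* c (suc b)) (ℤ.+≤+ le))

/-mono-< : ∀ a b c d .{{_ : ℕ.NonZero b}} .{{_ : ℕ.NonZero d}} →
           a ℕ.* d ℕ.< c ℕ.* b → + a / b ℚ.< + c / d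
/-mono-< a (suc b) c (suc d) lt = ℚ.toℚᵘ-cancel-< $
  ℚᵘ.<-respˡ-≃ (ℚᵘ.≃-sym (ℚ.toℚᵘ-fromℚᵘ (ℚᵘ.mkℚᵘ (+ a) b))) $
  ℚᵘ.<-respʳ-≃ (ℚᵘ.≃-sym (ℚ.toℚᵘ-fromℚᵘ (ℚᵘ.mkℚᵘ (+ c) d))) $
  ℚᵘ.*<* (subst₂ ℤ._<_ (ℤ.pos-* a (suc d)) (ℤ.pos-* c (suc b)) (ℤ.+<+ lt))

/-*-/ : ∀ a b c d .{{_ : ℕ.NonZero b}} .{{_ : ℕ.NonZero d}} .{{_ : ℕ.NonZero (b ℕ.* d)}} →
        (+ a / b) ℚ.* (+ c / d) ≡ + (a ℕ.* c) / (b ℕ.* d)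
/-*-/ a (suc b) c (suc d) = ℚ.toℚᵘ-injective $
  ℚᵘ.≃-trans (ℚ.toℚᵘ-homo-* (+ a / suc b) (+ c / suc d)) $
  ℚᵘ.≃-trans (ℚᵘ.*-cong (ℚ.toℚᵘ-fromℚᵘ (ℚᵘ.mkℚᵘ (+ a) b)) (ℚ.toℚᵘ-fromℚᵘ (ℚᵘ.mkℚᵘ (+ c) d))) $
  ℚᵘ.≃-sym $ ℚᵘ.≃-trans (ℚ.toℚᵘ-fromℚᵘ (ℚᵘ.mkℚᵘ (+ (a ℕ.* c)) _)) $
  ℚᵘ.*≡* (cong (ℤ._* + (suc b ℕ.* suc d)) (ℤ.pos-* a c))

/-suc : ∀ k n → + suc k / suc n ≡ + k / suc n ℚ.+ + 1 / suc n
/-suc k n = ℚ.toℚᵘ-injective $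
  ℚᵘ.≃-trans (ℚ.toℚᵘ-fromℚᵘ (ℚᵘ.mkℚᵘ (+ suc k) n)) $ ℚᵘ.≃-sym $
  ℚᵘ.≃-trans (ℚ.toℚᵘ-homo-+ (+ k / suc n) (+ 1 / suc n)) $
  ℚᵘ.≃-trans (ℚᵘ.+-cong (ℚ.toℚᵘ-fromℚᵘ (ℚᵘ.mkℚᵘ (+ k) n)) (ℚ.toℚᵘ-fromℚᵘ (ℚᵘ.mkℚᵘ (+ 1) n))) $
  ℚᵘ.*≡* (solve 2 (λ K N → (K :* N :+ con (+ 1) :* N) :* N := (con (+ 1) :+ K) :* (N :* N))
            refl (+ k) (+ suc n))
  where open ℤSolver.+-*-Solver

0≤/ : ∀ a b .{{_ : ℕ.NonZero b}} → 0ℚ ℚ.≤ + a / b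
0≤/ a b = /-mono-≤ 0 1 a b z≤n

/<ε : ∀ c ε → 0ℚ ℚ.< ε → ∃[ N ] ∀ n → N ℕ.≤ n → + c / suc n ℚ.< ε
/<ε c ε@(mkℚ (+ suc a) b _) 0<ε = c ℕ.* suc b , λ n N≤n →
  subst (+ c / suc n ℚ.<_) (ℚ.↥p/↧p≡p ε) $ /-mono-< c (suc n) (suc a) (suc b) $
  ℕ.<-≤-trans (s≤s N≤n) (ℕ.m≤m+n (suc n) (a ℕ.* suc n))
/<ε c (mkℚ (+ zero) b _) (ℚ.*<* (ℤ.+<+ ()))
/<ε c (mkℚ (-[1+ a ]) b _) (ℚ.*<* ())

0<1 : 0ℚ ℚ.< 1ℚ
0<1 = /-mono-< 0 1 1 1 (s≤s z≤n)

0<½* : ∀ {ε} → 0ℚ ℚ.< ε → 0ℚ ℚ.< ½ ℚ.* ε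
0<½* {ε} 0<ε = subst (ℚ._< ½ ℚ.* ε) (ℚ.*-zeroʳ ½) (ℚ.*-monoʳ-<-pos ½ 0<ε)

½+½ : ∀ ε → ½ ℚ.* ε ℚ.+ ½ ℚ.* ε ≡ ε
½+½ ε = trans (sym (ℚ.*-distribʳ-+ ε ½ ½)) (ℚ.*-identityˡ ε)

0<* : ∀ {a b} → 0ℚ ℚ.< a → 0ℚ ℚ.< b → 0ℚ ℚ.< a ℚ.* b
0<* {a} {b} 0<a 0<b =
  subst (ℚ._< a ℚ.* b) (ℚ.*-zeroʳ a) (ℚ.*-monoʳ-<-pos a {{ℚ.positive 0<a}} 0<b)

0≤* : ∀ {a b} → 0ℚ ℚ.≤ a → 0ℚ ℚ.≤ b → 0ℚ ℚ.≤ a ℚ.* b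
0≤* {a} {b} 0≤a 0≤b =
  subst (ℚ._≤ a ℚ.* b) (ℚ.*-zeroʳ a) (ℚ.*-monoˡ-≤-nonNeg a {{ℚ.nonNegative 0≤a}} 0≤b)

*-mono-≤ : ∀ {a b c d} → 0ℚ ℚ.≤ a → 0ℚ ℚ.≤ d → a ℚ.≤ b → c ℚ.≤ d → a ℚ.* c ℚ.≤ b ℚ.* d
*-mono-≤ {a} {b} {c} {d} 0≤a 0≤d a≤b c≤d = ℚ.≤-trans
  (ℚ.*-monoˡ-≤-nonNeg a {{ℚ.nonNegative 0≤a}} c≤d)
  (ℚ.*-monoʳ-≤-nonNeg d {{ℚ.nonNegative 0≤d}} a≤b)

divide : ∀ {ε B} → 0ℚ ℚ.< ε → 0ℚ ℚ.< B → ∃[ δ ] 0ℚ ℚ.< δ × B ℚ.* δ ≡ ε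
divide {ε} {B} 0<ε 0<B = ℚ.1/ B ℚ.* ε , 0<* {ℚ.1/ B} (ℚ.positive⁻¹ (ℚ.1/ B) {{ℚ.1/pos⇒pos B}}) 0<ε ,
  trans (sym (ℚ.*-assoc B (ℚ.1/ B) ε))
        (trans (cong (ℚ._* ε) (ℚ.*-inverseʳ B)) (ℚ.*-identityˡ ε))
  where instance
    B>0 = ℚ.positive 0<B
    B≢0 = ℚ.pos⇒nonZero B

∣∣-sym : ∀ a b → ℚ.∣ a ℚ.- b ∣ ≡ ℚ.∣ b ℚ.- a ∣
∣∣-sym a b = trans (sym (ℚ.∣-p∣≡∣p∣ (a ℚ.- b)))
  (cong ℚ.∣_∣ (solve 2 (λ a b → :- (a :- b) := b :- a) refl a b))
  where open ℚSolver.+-*-Solver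

p≤∣p∣ : ∀ p → p ℚ.≤ ℚ.∣ p ∣
p≤∣p∣ p with ℚ.≤-total 0ℚ p
... | inj₁ 0≤p = ℚ.≤-reflexive (sym (ℚ.0≤p⇒∣p∣≡p 0≤p))
... | inj₂ p≤0 = ℚ.≤-trans p≤0 (ℚ.0≤∣p∣ p)

∣∣-< : ∀ a b {ε} → a ℚ.- b ℚ.< ε → b ℚ.- a ℚ.< ε → ℚ.∣ a ℚ.- b ∣ ℚ.< ε
∣∣-< a b {ε} lt gt with ℚ.∣p∣≡p∨∣p∣≡-p (a ℚ.- b)
... | inj₁ eq = subst (ℚ._< ε) (sym eq) lt
... | inj₂ eq = subst (ℚ._< ε)
  (sym (trans eq (solve 2 (λ a b → :- (a :- b) := b :- a) refl a b))) gt
  where open ℚSolver.+-*-Solver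

∣∣-reverse : ∀ a b → ℚ.∣ a ∣ ℚ.- ℚ.∣ b ∣ ℚ.≤ ℚ.∣ a ℚ.- b ∣
∣∣-reverse a b = begin
  ℚ.∣ a ∣ ℚ.- ℚ.∣ b ∣                         ≡⟨ cong (λ c → ℚ.∣ c ∣ ℚ.- ℚ.∣ b ∣) a≡ ⟩
  ℚ.∣ (a ℚ.- b) ℚ.+ b ∣ ℚ.- ℚ.∣ b ∣           ≤⟨ ℚ.+-monoˡ-≤ (ℚ.- ℚ.∣ b ∣) (ℚ.∣p+q∣≤∣p∣+∣q∣ (a ℚ.- b) b) ⟩
  ℚ.∣ a ℚ.- b ∣ ℚ.+ ℚ.∣ b ∣ ℚ.- ℚ.∣ b ∣       ≡⟨ solve 2 (λ x y → x :+ y :- y := x) refl ℚ.∣ a ℚ.- b ∣ ℚ.∣ b ∣ ⟩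
  ℚ.∣ a ℚ.- b ∣                               ∎
  where
  open ℚ.≤-Reasoning
  open ℚSolver.+-*-Solver
  a≡ : a ≡ (a ℚ.- b) ℚ.+ b
  a≡ = solve 2 (λ a b → a := (a :- b) :+ b) refl a b

-<⇒<+ : ∀ a b {c} → a ℚ.- b ℚ.< c → a ℚ.< b ℚ.+ c
-<⇒<+ a b {c} lt = subst₂ ℚ._<_
  (solve 2 (λ a b → a :- b :+ b := a) refl a b) (ℚ.+-comm c b) (ℚ.+-monoˡ-< b lt)
  where open ℚSolver.+-*-Solver

record ℝ : Set where
  constructor mkℝ
  field
    approx : ℕ → ℚ
    cauchy : ∀ ε → 0ℚ ℚ.< ε →
             ∃[ N ] ∀ m n → N ℕ.≤ m → N ℕ.≤ n → ℚ.∣ approx m ℚ.- approx n ∣ ℚ.< ε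

open ℝ public

infix  8 _⁻¹⟨_⟩
infix  8 √ᵣ_
infixl 7 _*ᵣ_ _÷ᵣ_⟨_⟩
infixl 6 _-ᵣ_
infix  4 _<ᵣ_ _#0 _⟶_ _∼_

fromℚ : ℚ → ℝ
fromℚ q .approx _ = q
fromℚ q .cauchy ε 0<ε = 0 , λ _ _ _ _ →
  subst (ℚ._< ε) (sym (cong ℚ.∣_∣ (ℚ.+-inverseʳ q))) 0<ε

_-ᵣ_ : ℝ → ℝ → ℝ
(x -ᵣ y) .approx n = approx x n ℚ.- approx y n
(x -ᵣ y) .cauchy ε 0<ε =
  let
    N₁ , X = cauchy x (½ ℚ.* ε) (0<½* 0<ε)
    N₂ , Y = cauchy y (½ ℚ.* ε) (0<½* 0<ε)
  in
  N₁ ℕ.⊔ N₂ , λ m n m≥ n≥ → let open ℚ.≤-Reasoning in begin-strict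
  ℚ.∣ (approx x m ℚ.- approx y m) ℚ.- (approx x n ℚ.- approx y n) ∣
    ≡⟨ cong ℚ.∣_∣ (solve 4 (λ a b c d → (a :- b) :- (c :- d) := (a :- c) :- (b :- d)) refl
         (approx x m) (approx y m) (approx x n) (approx y n)) ⟩
  ℚ.∣ (approx x m ℚ.- approx x n) ℚ.- (approx y m ℚ.- approx y n) ∣
    ≤⟨ ℚ.∣p-q∣≤∣p∣+∣q∣ (approx x m ℚ.- approx x n) (approx y m ℚ.- approx y n) ⟩
  ℚ.∣ approx x m ℚ.- approx x n ∣ ℚ.+ ℚ.∣ approx y m ℚ.- approx y n ∣
    <⟨ ℚ.+-mono-< (X m n (ℕ.m⊔n≤o⇒m≤o N₁ N₂ m≥) (ℕ.m⊔n≤o⇒m≤o N₁ N₂ n≥))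
                  (Y m n (ℕ.m⊔n≤o⇒n≤o N₁ N₂ m≥) (ℕ.m⊔n≤o⇒n≤o N₁ N₂ n≥)) ⟩
  ½ ℚ.* ε ℚ.+ ½ ℚ.* ε
    ≡⟨ ½+½ ε ⟩
  ε ∎
  where open ℚSolver.+-*-Solver

∣_∣ᵣ : ℝ → ℝ
∣ x ∣ᵣ .approx n = ℚ.∣ approx x n ∣
∣ x ∣ᵣ .cauchy ε 0<ε =
  let N , X = cauchy x ε 0<ε in
  N , λ m n m≥ n≥ → ∣∣-< ℚ.∣ approx x m ∣ ℚ.∣ approx x n ∣
    (ℚ.≤-<-trans (∣∣-reverse (approx x m) (approx x n)) (X m n m≥ n≥))
    (ℚ.≤-<-trans (∣∣-reverse (approx x n) (approx x m)) (X n m n≥ m≥))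

bounded : ∀ x → ∃[ B ] 0ℚ ℚ.< B × ∃[ N ] ∀ n → N ℕ.≤ n → ℚ.∣ approx x n ∣ ℚ.≤ B
bounded x =
  let N , X = cauchy x 1ℚ 0<1 in
  ℚ.∣ approx x N ∣ ℚ.+ 1ℚ ,
  ℚ.+-mono-≤-< (ℚ.0≤∣p∣ (approx x N)) 0<1 ,
  N , λ n n≥ → ℚ.<⇒≤ $ -<⇒<+ ℚ.∣ approx x n ∣ ℚ.∣ approx x N ∣ $
    ℚ.≤-<-trans (∣∣-reverse (approx x n) (approx x N)) (X n N n≥ ℕ.≤-refl)

*-close : ∀ {a b c d B C δ} → 0ℚ ℚ.< B → 0ℚ ℚ.< C → ℚ.∣ a ∣ ℚ.≤ B → ℚ.∣ d ∣ ℚ.≤ C →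
          ℚ.∣ a ℚ.- c ∣ ℚ.< δ → ℚ.∣ b ℚ.- d ∣ ℚ.< δ →
          ℚ.∣ a ℚ.* b ℚ.- c ℚ.* d ∣ ℚ.< (B ℚ.+ C) ℚ.* δ
*-close {a} {b} {c} {d} {B} {C} {δ} 0<B 0<C a≤B d≤C a≈c b≈d = begin-strict
  ℚ.∣ a ℚ.* b ℚ.- c ℚ.* d ∣
    ≡⟨ cong ℚ.∣_∣ (solve 4 (λ a b c d → a :* b :- c :* d := a :* (b :- d) :+ d :* (a :- c))
         refl a b c d) ⟩
  ℚ.∣ a ℚ.* (b ℚ.- d) ℚ.+ d ℚ.* (a ℚ.- c) ∣
    ≤⟨ ℚ.∣p+q∣≤∣p∣+∣q∣ (a ℚ.* (b ℚ.- d)) (d ℚ.* (a ℚ.- c)) ⟩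
  ℚ.∣ a ℚ.* (b ℚ.- d) ∣ ℚ.+ ℚ.∣ d ℚ.* (a ℚ.- c) ∣
    ≡⟨ cong₂ ℚ._+_ (ℚ.∣p*q∣≡∣p∣*∣q∣ a (b ℚ.- d)) (ℚ.∣p*q∣≡∣p∣*∣q∣ d (a ℚ.- c)) ⟩
  ℚ.∣ a ∣ ℚ.* ℚ.∣ b ℚ.- d ∣ ℚ.+ ℚ.∣ d ∣ ℚ.* ℚ.∣ a ℚ.- c ∣
    ≤⟨ ℚ.+-mono-≤
         (ℚ.*-monoʳ-≤-nonNeg ℚ.∣ b ℚ.- d ∣ {{ℚ.nonNegative (ℚ.0≤∣p∣ (b ℚ.- d))}} a≤B)
         (ℚ.*-monoʳ-≤-nonNeg ℚ.∣ a ℚ.- c ∣ {{ℚ.nonNegative (ℚ.0≤∣p∣ (a ℚ.- c))}} d≤C) ⟩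
  B ℚ.* ℚ.∣ b ℚ.- d ∣ ℚ.+ C ℚ.* ℚ.∣ a ℚ.- c ∣
    <⟨ ℚ.+-mono-<
         (ℚ.*-monoʳ-<-pos B {{ℚ.positive 0<B}} b≈d)
         (ℚ.*-monoʳ-<-pos C {{ℚ.positive 0<C}} a≈c) ⟩
  B ℚ.* δ ℚ.+ C ℚ.* δ
    ≡⟨ ℚ.*-distribʳ-+ δ B C ⟨
  (B ℚ.+ C) ℚ.* δ ∎
  where
  open ℚ.≤-Reasoning
  open ℚSolver.+-*-Solver

_*ᵣ_ : ℝ → ℝ → ℝ
(x *ᵣ y) .approx n = approx x n ℚ.* approx y n
(x *ᵣ y) .cauchy ε 0<ε =
  let
    B , 0<B , N₁ , X≤ = bounded x
    C , 0<C , N₂ , Y≤ = bounded y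
    δ , 0<δ , δ≡      = divide {ε} {B ℚ.+ C} 0<ε (ℚ.+-mono-< 0<B 0<C)
    N₃ , X            = cauchy x δ 0<δ
    N₄ , Y            = cauchy y δ 0<δ
  in
  (N₁ ℕ.⊔ N₂) ℕ.⊔ (N₃ ℕ.⊔ N₄) , λ m n m≥ n≥ →
    let
      m≥₁₂ = ℕ.m⊔n≤o⇒m≤o (N₁ ℕ.⊔ N₂) (N₃ ℕ.⊔ N₄) m≥
      n≥₁₂ = ℕ.m⊔n≤o⇒m≤o (N₁ ℕ.⊔ N₂) (N₃ ℕ.⊔ N₄) n≥
      m≥₃₄ = ℕ.m⊔n≤o⇒n≤o (N₁ ℕ.⊔ N₂) (N₃ ℕ.⊔ N₄) m≥
      n≥₃₄ = ℕ.m⊔n≤o⇒n≤o (N₁ ℕ.⊔ N₂) (N₃ ℕ.⊔ N₄) n≥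
    in subst (ℚ.∣ approx x m ℚ.* approx y m ℚ.- approx x n ℚ.* approx y n ∣ ℚ.<_) δ≡
      (*-close {approx x m} {approx y m} {approx x n} {approx y n} {B} {C} {δ} 0<B 0<C
        (X≤ m (ℕ.m⊔n≤o⇒m≤o N₁ N₂ m≥₁₂)) (Y≤ n (ℕ.m⊔n≤o⇒n≤o N₁ N₂ n≥₁₂))
        (X m n (ℕ.m⊔n≤o⇒m≤o N₃ N₄ m≥₃₄) (ℕ.m⊔n≤o⇒m≤o N₃ N₄ n≥₃₄))
        (Y m n (ℕ.m⊔n≤o⇒n≤o N₃ N₄ m≥₃₄) (ℕ.m⊔n≤o⇒n≤o N₃ N₄ n≥₃₄)))

_<ᵣ_ : ℝ → ℝ → Set
x <ᵣ y = ∃[ δ ] 0ℚ ℚ.< δ × ∃[ N ] ∀ n → N ℕ.≤ n → approx x n ℚ.+ δ ℚ.≤ approx y n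

_#0 : ℝ → Set
x #0 = fromℚ 0ℚ <ᵣ ∣ x ∣ᵣ

-- Reciprocal with the irrelevant value 1/0 = 0.
inv : ℚ → ℚ
inv q with q ℚ.≟ 0ℚ
... | yes _   = 0ℚ
... | no  q≢0 = (ℚ.1/ q) {{ℚ.≢-nonZero q≢0}}

inv-inverseʳ : ∀ q → 0ℚ ℚ.< ℚ.∣ q ∣ → q ℚ.* inv q ≡ 1ℚ
inv-inverseʳ q 0<∣q∣ with q ℚ.≟ 0ℚ
... | yes refl = contradiction refl (ℚ.<⇒≢ 0<∣q∣)
... | no  q≢0  = ℚ.*-inverseʳ q {{ℚ.≢-nonZero q≢0}}

inv-bound : ∀ {δ κ} q → 0ℚ ℚ.< δ → δ ℚ.* κ ≡ 1ℚ → δ ℚ.≤ ℚ.∣ q ∣ → ℚ.∣ inv q ∣ ℚ.≤ κ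
inv-bound {δ} {κ} q 0<δ δκ≡1 δ≤q = ℚ.*-cancelˡ-≤-pos δ {{ℚ.positive 0<δ}} $ begin
  δ ℚ.* ℚ.∣ inv q ∣        ≤⟨ ℚ.*-monoʳ-≤-nonNeg ℚ.∣ inv q ∣ {{ℚ.nonNegative (ℚ.0≤∣p∣ (inv q))}} δ≤q ⟩
  ℚ.∣ q ∣ ℚ.* ℚ.∣ inv q ∣  ≡⟨ ℚ.∣p*q∣≡∣p∣*∣q∣ q (inv q) ⟨
  ℚ.∣ q ℚ.* inv q ∣        ≡⟨ cong ℚ.∣_∣ (inv-inverseʳ q (ℚ.<-≤-trans 0<δ δ≤q)) ⟩
  1ℚ                       ≡⟨ δκ≡1 ⟨
  δ ℚ.* κ                  ∎
  where open ℚ.≤-Reasoning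

inv-difference : ∀ a b → 0ℚ ℚ.< ℚ.∣ a ∣ → 0ℚ ℚ.< ℚ.∣ b ∣ →
                 inv a ℚ.- inv b ≡ inv a ℚ.* inv b ℚ.* (b ℚ.- a)
inv-difference a b 0<a 0<b = begin
  inv a ℚ.- inv b
    ≡⟨ cong₂ ℚ._-_ (ℚ.*-identityʳ (inv a)) (ℚ.*-identityʳ (inv b)) ⟨
  inv a ℚ.* 1ℚ ℚ.- inv b ℚ.* 1ℚ
    ≡⟨ cong₂ (λ u v → inv a ℚ.* u ℚ.- inv b ℚ.* v) (inv-inverseʳ b 0<b) (inv-inverseʳ a 0<a) ⟨
  inv a ℚ.* (b ℚ.* inv b) ℚ.- inv b ℚ.* (a ℚ.* inv a)
    ≡⟨ solve 4 (λ a b u v → u :* (b :* v) :- v :* (a :* u) := u :* v :* (b :- a))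
         refl a b (inv a) (inv b) ⟩
  inv a ℚ.* inv b ℚ.* (b ℚ.- a) ∎
  where
  open ≡-Reasoning
  open ℚSolver.+-*-Solver

inv-close : ∀ {δ κ η} a b → 0ℚ ℚ.< δ → 0ℚ ℚ.< κ → δ ℚ.* κ ≡ 1ℚ → δ ℚ.≤ ℚ.∣ a ∣ → δ ℚ.≤ ℚ.∣ b ∣ →
            ℚ.∣ b ℚ.- a ∣ ℚ.< η → ℚ.∣ inv a ℚ.- inv b ∣ ℚ.< κ ℚ.* κ ℚ.* η
inv-close {δ} {κ} {η} a b 0<δ 0<κ δκ≡1 δ≤a δ≤b b≈a = begin-strict
  ℚ.∣ inv a ℚ.- inv b ∣
    ≡⟨ cong ℚ.∣_∣ (inv-difference a b (ℚ.<-≤-trans 0<δ δ≤a) (ℚ.<-≤-trans 0<δ δ≤b)) ⟩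
  ℚ.∣ inv a ℚ.* inv b ℚ.* (b ℚ.- a) ∣
    ≡⟨ trans (ℚ.∣p*q∣≡∣p∣*∣q∣ (inv a ℚ.* inv b) (b ℚ.- a))
             (cong (ℚ._* ℚ.∣ b ℚ.- a ∣) (ℚ.∣p*q∣≡∣p∣*∣q∣ (inv a) (inv b))) ⟩
  ℚ.∣ inv a ∣ ℚ.* ℚ.∣ inv b ∣ ℚ.* ℚ.∣ b ℚ.- a ∣
    ≤⟨ ℚ.*-monoʳ-≤-nonNeg ℚ.∣ b ℚ.- a ∣ {{ℚ.nonNegative (ℚ.0≤∣p∣ (b ℚ.- a))}}
         (*-mono-≤ (ℚ.0≤∣p∣ (inv a)) (ℚ.<⇒≤ 0<κ)
           (inv-bound a 0<δ δκ≡1 δ≤a) (inv-bound b 0<δ δκ≡1 δ≤b)) ⟩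
  κ ℚ.* κ ℚ.* ℚ.∣ b ℚ.- a ∣
    <⟨ ℚ.*-monoʳ-<-pos (κ ℚ.* κ) {{ℚ.positive (0<* 0<κ 0<κ)}} b≈a ⟩
  κ ℚ.* κ ℚ.* η ∎
  where open ℚ.≤-Reasoning

_⁻¹⟨_⟩ : (x : ℝ) → x #0 → ℝ
(x ⁻¹⟨ _ ⟩) .approx n = inv (approx x n)
(x ⁻¹⟨ δ , 0<δ , N₁ , apart ⟩) .cauchy ε 0<ε =
  let
    κ , 0<κ , δκ≡1  = divide {1ℚ} {δ} 0<1 0<δ
    η , 0<η , κκη≡ε = divide {ε} {κ ℚ.* κ} 0<ε (0<* 0<κ 0<κ)
    N₂ , X          = cauchy x η 0<η
  in
  N₁ ℕ.⊔ N₂ , λ m n m≥ n≥ →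
    subst (ℚ.∣ inv (approx x m) ℚ.- inv (approx x n) ∣ ℚ.<_) κκη≡ε
      (inv-close {δ} {κ} {η} (approx x m) (approx x n) 0<δ 0<κ δκ≡1
        (δ≤ m (ℕ.m⊔n≤o⇒m≤o N₁ N₂ m≥)) (δ≤ n (ℕ.m⊔n≤o⇒m≤o N₁ N₂ n≥))
        (X n m (ℕ.m⊔n≤o⇒n≤o N₁ N₂ n≥) (ℕ.m⊔n≤o⇒n≤o N₁ N₂ m≥)))
  where
  δ≤ : ∀ n → N₁ ℕ.≤ n → δ ℚ.≤ ℚ.∣ approx x n ∣
  δ≤ n n≥ = subst (ℚ._≤ ℚ.∣ approx x n ∣) (ℚ.+-identityˡ δ) (apart n n≥)

_÷ᵣ_⟨_⟩ : ℝ → (y : ℝ) → y #0 → ℝ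
x ÷ᵣ y ⟨ y#0 ⟩ = x *ᵣ y ⁻¹⟨ y#0 ⟩

⌊√_⌋ : ℕ → ℕ
⌊√ zero  ⌋ = 0
⌊√ suc m ⌋ with suc ⌊√ m ⌋ ℕ.* suc ⌊√ m ⌋ ℕ.≤? suc m
... | yes _ = suc ⌊√ m ⌋
... | no  _ = ⌊√ m ⌋

⌊√⌋-lower : ∀ m → ⌊√ m ⌋ ℕ.* ⌊√ m ⌋ ℕ.≤ m
⌊√⌋-lower zero    = z≤n
⌊√⌋-lower (suc m) with suc ⌊√ m ⌋ ℕ.* suc ⌊√ m ⌋ ℕ.≤? suc m
... | yes le = le
... | no  _  = ℕ.m≤n⇒m≤1+n (⌊√⌋-lower m)

⌊√⌋-upper : ∀ m → m ℕ.< suc ⌊√ m ⌋ ℕ.* suc ⌊√ m ⌋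
⌊√⌋-upper zero    = s≤s z≤n
⌊√⌋-upper (suc m) with suc ⌊√ m ⌋ ℕ.* suc ⌊√ m ⌋ ℕ.≤? suc m
... | yes _ = ℕ.≤-<-trans (⌊√⌋-upper m) (ℕ.*-mono-< (ℕ.n<1+n (suc ⌊√ m ⌋)) (ℕ.n<1+n (suc ⌊√ m ⌋)))
... | no ¬le = ℕ.≰⇒> ¬le

-- sqrt q n = ⌊ (n+1) √|q| ⌋ / (n+1)
sqrt : ℚ → ℕ → ℚ
sqrt q n = + ⌊√ (ℤ.∣ ℚ.↥ q ∣ ℕ.* (suc n ℕ.* suc n)) ℕ./ ℚ.↧ₙ q ⌋ / suc n

∣q∣≡ : ∀ q → ℚ.∣ q ∣ ≡ + ℤ.∣ ℚ.↥ q ∣ / ℚ.↧ₙ q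
∣q∣≡ q@record{} = sym (ℚ.↥p/↧p≡p ℚ.∣ q ∣)

sqrt-lower : ∀ q n → sqrt q n ℚ.* sqrt q n ℚ.≤ ℚ.∣ q ∣
sqrt-lower q n = subst₂ ℚ._≤_ (sym (/-*-/ r N r N)) (sym (∣q∣≡ q))
  (/-mono-≤ (r ℕ.* r) (N ℕ.* N) a b (ℕ.≤-trans (ℕ.*-monoˡ-≤ b (⌊√⌋-lower k)) (ℕ.m/n*n≤m (a ℕ.* (N ℕ.* N)) b)))
  where
  N = suc n ; a = ℤ.∣ ℚ.↥ q ∣ ; b = ℚ.↧ₙ q
  k = (a ℕ.* (N ℕ.* N)) ℕ./ b
  r = ⌊√ k ⌋

sqrt-upper : ∀ q n → let s = sqrt q n ℚ.+ + 1 / suc n in ℚ.∣ q ∣ ℚ.< s ℚ.* s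
sqrt-upper q n = subst₂ ℚ._<_ (sym (∣q∣≡ q))
  (trans (sym (/-*-/ (suc r) N (suc r) N)) (cong₂ ℚ._*_ (/-suc r n) (/-suc r n)))
  (/-mono-< a b (suc r ℕ.* suc r) (N ℕ.* N) lt)
  where
  N = suc n ; a = ℤ.∣ ℚ.↥ q ∣ ; b = ℚ.↧ₙ q
  A = a ℕ.* (N ℕ.* N)
  k = A ℕ./ b
  r = ⌊√ k ⌋
  lt : A ℕ.< suc r ℕ.* suc r ℕ.* b
  lt = begin-strict
    A                        ≡⟨ ℕ.m≡m%n+[m/n]*n A b ⟩
    A ℕ.% b ℕ.+ k ℕ.* b      <⟨ ℕ.+-monoˡ-< (k ℕ.* b) (ℕ.m%n<n A b) ⟩
    suc k ℕ.* b              ≤⟨ ℕ.*-monoˡ-≤ b (⌊√⌋-upper k) ⟩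
    suc r ℕ.* suc r ℕ.* b    ∎
    where open ℕ.≤-Reasoning

0≤sqrt : ∀ q n → 0ℚ ℚ.≤ sqrt q n
0≤sqrt q n = 0≤/ ⌊√ (ℤ.∣ ℚ.↥ q ∣ ℕ.* (suc n ℕ.* suc n)) ℕ./ ℚ.↧ₙ q ⌋ (suc n)

square-close : ∀ s t {r δ} {p q} → 0ℚ ℚ.≤ s → 0ℚ ℚ.≤ t → 0ℚ ℚ.≤ r → 0ℚ ℚ.< δ →
               s ℚ.* s ℚ.≤ p → q ℚ.< (t ℚ.+ r) ℚ.* (t ℚ.+ r) →
               p ℚ.< q ℚ.+ δ ℚ.* δ → r ℚ.< δ → s ℚ.- t ℚ.< δ ℚ.+ δ
square-close s t {r} {δ} {p} {q} 0≤s 0≤t 0≤r 0<δ s²≤p q<t² p≈q r<δ with s ℚ.- t ℚ.<? δ ℚ.+ δ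
... | yes lt = lt
... | no ¬lt = ⊥-elim $ ℚ.<-irrefl refl $ begin-strict
  s ℚ.* s                                    ≤⟨ s²≤p ⟩
  p                                          <⟨ p≈q ⟩
  q ℚ.+ δ ℚ.* δ                              <⟨ ℚ.+-monoˡ-< (δ ℚ.* δ) q<t² ⟩
  u ℚ.* u ℚ.+ δ ℚ.* δ                        ≡⟨ ℚ.+-identityʳ (u ℚ.* u ℚ.+ δ ℚ.* δ) ⟨
  u ℚ.* u ℚ.+ δ ℚ.* δ ℚ.+ 0ℚ                 ≤⟨ ℚ.+-monoʳ-≤ (u ℚ.* u ℚ.+ δ ℚ.* δ)
                                                  (ℚ.+-mono-≤ (0≤* 0≤u (ℚ.<⇒≤ 0<δ)) (0≤* 0≤u (ℚ.<⇒≤ 0<δ))) ⟩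
  u ℚ.* u ℚ.+ δ ℚ.* δ ℚ.+ (u ℚ.* δ ℚ.+ u ℚ.* δ)
    ≡⟨ solve 2 (λ u d → u :* u :+ d :* d :+ (u :* d :+ u :* d) := (u :+ d) :* (u :+ d)) refl u δ ⟩
  (u ℚ.+ δ) ℚ.* (u ℚ.+ δ)                    ≤⟨ *-mono-≤ 0≤u+δ 0≤s u+δ≤s u+δ≤s ⟩
  s ℚ.* s                                    ∎
  where
  open ℚ.≤-Reasoning
  open ℚSolver.+-*-Solver
  u = t ℚ.+ r
  0≤u : 0ℚ ℚ.≤ u
  0≤u = ℚ.+-mono-≤ 0≤t 0≤r
  0≤u+δ : 0ℚ ℚ.≤ u ℚ.+ δ
  0≤u+δ = ℚ.+-mono-≤ 0≤u (ℚ.<⇒≤ 0<δ)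
  u+δ≤s : u ℚ.+ δ ℚ.≤ s
  u+δ≤s = begin
    t ℚ.+ r ℚ.+ δ              ≤⟨ ℚ.+-monoˡ-≤ δ (ℚ.+-monoʳ-≤ t (ℚ.<⇒≤ r<δ)) ⟩
    t ℚ.+ δ ℚ.+ δ              ≡⟨ solve 2 (λ t d → t :+ d :+ d := (d :+ d) :+ t) refl t δ ⟩
    (δ ℚ.+ δ) ℚ.+ t            ≤⟨ ℚ.+-monoˡ-≤ t (ℚ.≮⇒≥ ¬lt) ⟩
    (s ℚ.- t) ℚ.+ t            ≡⟨ solve 2 (λ s t → (s :- t) :+ t := s) refl s t ⟩
    s                          ∎

sqrt-close : ∀ {δ p q} m n → 0ℚ ℚ.< δ → ℚ.∣ p ℚ.- q ∣ ℚ.< δ ℚ.* δ →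
             + 1 / suc n ℚ.< δ → sqrt p m ℚ.- sqrt q n ℚ.< δ ℚ.+ δ
sqrt-close {δ} {p} {q} m n 0<δ p≈q 1/n<δ =
  square-close (sqrt p m) (sqrt q n) {+ 1 / suc n} {δ} {ℚ.∣ p ∣} {ℚ.∣ q ∣}
    (0≤sqrt p m) (0≤sqrt q n) (0≤/ 1 (suc n)) 0<δ (sqrt-lower p m) (sqrt-upper q n)
    (-<⇒<+ ℚ.∣ p ∣ ℚ.∣ q ∣ (ℚ.≤-<-trans (∣∣-reverse p q) p≈q)) 1/n<δ

-- √ᵣ x is √|x|, which agrees with √x for x ≥ 0.
√ᵣ_ : ℝ → ℝ
(√ᵣ x) .approx n = sqrt (approx x n) n
(√ᵣ x) .cauchy ε 0<ε =
  let
    N₁ , X     = cauchy x (½ ℚ.* ε ℚ.* (½ ℚ.* ε)) (0<* (0<½* 0<ε) (0<½* 0<ε))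
    N₂ , small = /<ε 1 (½ ℚ.* ε) (0<½* 0<ε)
    close : ∀ m n → N₁ ℕ.⊔ N₂ ℕ.≤ m → N₁ ℕ.⊔ N₂ ℕ.≤ n →
            sqrt (approx x m) m ℚ.- sqrt (approx x n) n ℚ.< ε
    close m n m≥ n≥ =
      subst (sqrt (approx x m) m ℚ.- sqrt (approx x n) n ℚ.<_) (½+½ ε) $
        sqrt-close {½ ℚ.* ε} {approx x m} {approx x n} m n (0<½* 0<ε)
          (X m n (ℕ.m⊔n≤o⇒m≤o N₁ N₂ m≥) (ℕ.m⊔n≤o⇒m≤o N₁ N₂ n≥))
          (small n (ℕ.m⊔n≤o⇒n≤o N₁ N₂ n≥))
  in
  N₁ ℕ.⊔ N₂ , λ m n m≥ n≥ →
    ∣∣-< (sqrt (approx x m) m) (sqrt (approx x n) n) (close m n m≥ n≥) (close n m n≥ m≥)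

-- alternating a n = a 0 - a 1 + a 2 - ⋯ ± a (n-1)
alternating : (ℕ → ℚ) → ℕ → ℚ
alternating a zero    = 0ℚ
alternating a (suc n) = a 0 ℚ.- alternating (a ∘ suc) n

Antitone : (ℕ → ℚ) → Set
Antitone a = ∀ n → 0ℚ ℚ.≤ a n × a (suc n) ℚ.≤ a n

alternating-bounds : ∀ {a} → Antitone a → ∀ n →
                     0ℚ ℚ.≤ alternating a n × alternating a n ℚ.≤ a 0
alternating-bounds     anti zero    = ℚ.≤-refl , proj₁ (anti 0)
alternating-bounds {a} anti (suc n) =
  let
    t          = alternating (a ∘ suc) n
    0≤t , t≤a₁ = alternating-bounds (anti ∘ suc) n
  in
  subst (ℚ._≤ a 0 ℚ.- t) (ℚ.+-inverseʳ (a 0))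
    (ℚ.+-monoʳ-≤ (a 0) (ℚ.neg-antimono-≤ (ℚ.≤-trans t≤a₁ (proj₂ (anti 0))))) ,
  subst (a 0 ℚ.- t ℚ.≤_) (ℚ.+-identityʳ (a 0)) (ℚ.+-monoʳ-≤ (a 0) (ℚ.neg-antimono-≤ 0≤t))

alternating-tail : ∀ {a} → Antitone a → ∀ m j →
                   ℚ.∣ alternating a (m ℕ.+ j) ℚ.- alternating a m ∣ ℚ.≤ a m
alternating-tail {a} anti zero j with 0≤t , t≤a₀ ← alternating-bounds anti j
  = subst (ℚ._≤ a 0) (sym (trans (cong ℚ.∣_∣ (ℚ.+-identityʳ _)) (ℚ.0≤p⇒∣p∣≡p 0≤t))) t≤a₀
alternating-tail {a} anti (suc m) j = subst (ℚ._≤ a (suc m))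
  (trans (∣∣-sym u v) (cong ℚ.∣_∣ (solve 3 (λ c u v → v :- u := (c :- u) :- (c :- v)) refl (a 0) u v)))
  (alternating-tail (anti ∘ suc) m j)
  where
  open ℚSolver.+-*-Solver
  u = alternating (a ∘ suc) (m ℕ.+ j)
  v = alternating (a ∘ suc) m

leibniz : ℕ → ℚ
leibniz m = + 4 / suc (2 ℕ.* m)

leibniz-antitone : Antitone leibniz
leibniz-antitone m = 0≤/ 4 (suc (2 ℕ.* m)) ,
  /-mono-≤ 4 (suc (2 ℕ.* suc m)) 4 (suc (2 ℕ.* m))
    (ℕ.*-monoʳ-≤ 4 (s≤s (ℕ.*-monoʳ-≤ 2 (ℕ.n≤1+n m))))

-- Leibniz: π = 4 (1 - 1/3 + 1/5 - 1/7 + ⋯).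
π : ℝ
π .approx = alternating leibniz
π .cauchy ε 0<ε =
  let
    N , small = /<ε 4 ε 0<ε
    tail : ∀ m j → N ℕ.≤ m →
           ℚ.∣ alternating leibniz (m ℕ.+ j) ℚ.- alternating leibniz m ∣ ℚ.< ε
    tail m j m≥ = ℚ.≤-<-trans (alternating-tail {leibniz} leibniz-antitone m j)
      (small (2 ℕ.* m) (ℕ.≤-trans m≥ (ℕ.m≤m+n m (m ℕ.+ 0))))
  in N , close N tail
  where
  close : ∀ N →
          (∀ m j → N ℕ.≤ m → ℚ.∣ alternating leibniz (m ℕ.+ j) ℚ.- alternating leibniz m ∣ ℚ.< ε) →
          ∀ m n → N ℕ.≤ m → N ℕ.≤ n → ℚ.∣ alternating leibniz m ℚ.- alternating leibniz n ∣ ℚ.< ε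
  close N tail m n m≥ n≥ with ℕ.≤-total m n
  ... | inj₁ m≤n with j , refl ← ℕ.m≤n⇒∃[o]m+o≡n m≤n =
    subst (ℚ._< ε) (∣∣-sym (alternating leibniz (m ℕ.+ j)) (alternating leibniz m)) (tail m j m≥)
  ... | inj₂ n≤m with j , refl ← ℕ.m≤n⇒∃[o]m+o≡n n≤m = tail n j n≥

π#0 : π #0
π#0 = 1ℚ , 0<1 , 1 , λ { (suc n) _ → bound n }
  where
  bound : ∀ n → 0ℚ ℚ.+ 1ℚ ℚ.≤ ℚ.∣ alternating leibniz (suc n) ∣
  bound n = begin
    0ℚ ℚ.+ 1ℚ                             ≤⟨ toWitness {a? = 0ℚ ℚ.+ 1ℚ ℚ.≤? leibniz 0 ℚ.- leibniz 1} _ ⟩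
    leibniz 0 ℚ.- leibniz 1               ≤⟨ ℚ.+-monoʳ-≤ (leibniz 0) (ℚ.neg-antimono-≤
                                               (proj₂ (alternating-bounds (leibniz-antitone ∘ suc) n))) ⟩
    alternating leibniz (suc n)           ≤⟨ p≤∣p∣ (alternating leibniz (suc n)) ⟩
    ℚ.∣ alternating leibniz (suc n) ∣     ∎
    where open ℚ.≤-Reasoning

_⟶_ : (ℕ → ℝ) → ℝ → Set
x ⟶ y = ∀ ε → 0ℚ ℚ.< ε → ∃[ N ] ∀ n → N ℕ.≤ n → ∣ x n -ᵣ y ∣ᵣ <ᵣ fromℚ ε

-- aₙ / bₙ → 1, the quotient being required to exist from some index N on.
_∼_ : (ℕ → ℝ) → (ℕ → ℝ) → Set
a ∼ b = ∃[ N ] Σ[ b#0 ∈ (∀ n → b (N ℕ.+ n) #0) ]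
  (λ n → a (N ℕ.+ n) ÷ᵣ b (N ℕ.+ n) ⟨ b#0 n ⟩) ⟶ fromℚ 1ℚ

{-# OPTIONS --safe #-}
module Submission where

-- A cover γ ⋖ δ raises one vertex of γ by 1, at a place where a step D or H is
-- followed by H or U.  Summing over the position of the two steps and the
-- choices of the other n gives, with x⁻¹ + 1 + x = P,
--   ℓ(GM (n+2)) = (n+1) [x⁰] (2 + x + x⁻¹) Pⁿ = (n+1) (T (n+1) + T n).
-- The coefficient of x in P θ(Pⁿ) = n (x - x⁻¹) Pⁿ, θ = x d/dx, yields the
-- three-term recurrence of T, hence ΣT xⁿ = 1/√(1-2x-3x²) as solutions of one
-- differential equation, and the exact formulas follow.
-- For the asymptotics, ℓ(GM (n+2)) / (2·3ⁿ) is the convolution of the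
-- coefficients of (1-x)^(-3/2) and (1+x/3)^(-1/2).  It is compared with the
-- n-th coefficient of the former times √3/2, the value of the latter at 1.
-- Wallis' product for that coefficient tends to the Leibniz series for π,
-- because its N-th term is an alternating sum (the partial fraction expansion
-- of N!²/((x-N)⋯(x+N)) at 1/2) whose k-th summand tends to that of Leibniz.

open import Defs
open import Algebra.Bundles using (CommutativeSemiring)
import Algebra.Properties.AbelianGroup
open import Algebra.Properties.CommutativeSemigroup using (interchange; x∙yz≈y∙xz)
import Algebra.Solver.Ring.NaturalCoefficients.Default as SemiringSolver
open import Algebra.Structures.Biased using (isCommutativeSemiringˡ)
open import Data.Fin.Base using (Fin; zero; suc; fromℕ; toℕ)
import Data.Fin.Properties as Fin
open import Data.Integer.Base as ℤ using (ℤ; +_; -[1+_]; -_; 0ℤ; 1ℤ)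
import Data.Integer.Properties as ℤ
import Data.Integer.Solver as ℤSolver
open import Data.List.Base using (List; []; _∷_; _++_; map; length; filter; cartesianProduct)
open import Data.List.Membership.Propositional using (_∈_)
open import Data.List.Membership.Propositional.Properties using (∈-map⁺; ∈-map⁻; ∈-++⁺ˡ; ∈-++⁺ʳ; ∈-++⁻; ∈-filter⁺; ∈-filter⁻)
open import Data.List.Membership.Propositional.Properties.WithK using (unique∧set⇒bag)
open import Data.List.Properties using (length-map; length-++; filter-++; map-++; map-∘; map-cong; ++-identityʳ)
open import Data.List.Relation.Binary.BagAndSetEquality using (∼bag⇒↭)
open import Data.List.Relation.Binary.Permutation.Propositional.Properties using (↭-length)
open import Data.List.Relation.Unary.All using ([]; _∷_)
open import Data.List.Relation.Unary.AllPairs using ([]; _∷_)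
open import Data.List.Relation.Unary.Any using (here)
open import Data.List.Relation.Unary.Unique.Propositional using (Unique)
import Data.List.Relation.Unary.Unique.Propositional.Properties as Unique
open import Data.Nat.Base as ℕ using (ℕ; zero; suc; _+_; _*_; _∸_; _^_; _⊔_; z≤n; s≤s)
open import Data.Nat.Combinatorics using (_C_; nCk+nC[k+1]≡[n+1]C[k+1]; nCk≡nC[n∸k])
open import Data.Nat.Combinatorics.Specification using (k>n⇒nCk≡0)
open import Data.Nat.ListAction using (sum)
open import Data.Nat.ListAction.Properties using (sum-++)
import Data.Nat.Properties as ℕ
open import Data.Nat.Properties using (m^n≢0)
import Data.Nat.Solver as ℕSolver
open import Data.Product.Base using (∃-syntax; _×_; _,_; proj₁; proj₂; uncurry)
open import Data.Rational.Base as ℚ using (ℚ; 0ℚ; 1ℚ; ½; _/_)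
import Data.Rational.Properties as ℚ
import Data.Rational.Solver as ℚSolver
import Data.Rational.Unnormalised.Base as ℚᵘ
import Data.Rational.Unnormalised.Properties as ℚᵘ
open import Data.Sum.Base using (_⊎_; inj₁; inj₂; [_,_]′)
open import Data.Vec.Base as Vec using (Vec; []; _∷_; _∷ʳ_)
import Data.Vec.Properties as Vec
open import Function.Base using (_∘_; _$_)
open import Function.Bundles using (mk⇔)
open import Level using (0ℓ)
open import Relation.Binary.Bundles using (Setoid)
open import Relation.Binary.PropositionalEquality hiding (setoid)
open import Relation.Nullary using (¬_; Dec; yes; no; contradiction)
open import Relation.Nullary.Decidable using (toWitness)
open import Relation.Unary using (Pred; Decidable)

-- The numbers behind the asymptotics are irrational: the partial sums of (1+x/3)^(-1/2) at 1
-- approach √3/2, and Wallis' products approach π, whereas `_⇾_` only speaks of rational limits.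
-- Hence √3/2 enters through its square 3/4, and π through a comparison of `wallis N` with the
-- approximants of `π` that is uniform in both indices. The quotient y of ℓ and its claimed
-- equivalent is likewise controlled through its square, since |y-1| ≤ |y²-1| for y ≥ 0. The index i
-- needs neither: its quotient by 4n/9 is rational in n and in T n / T (n+1), which tends to 1/3 by
-- two-sided bounds drawn from the recurrence. Square roots of series are also treated through
-- squares. In characteristic 0, θ f = 0 and f 0 = 1 force f = 1, so a series with constant term 1
-- is determined by its inverse square.

module ℤ-Group = Algebra.Properties.AbelianGroup ℤ.+-0-abelianGroup


-- Covering pairs of Grand Motzkin lattices as single raised vertices

infix 4 _↗_

-- In terms of rises the pair s, t becomes s + 1, t - 1, which lifts the vertex between the two
-- steps and moves no other. This is possible exactly when s is not `U` and t is not `D`.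
data Lift : Step → Step → Step → Step → Set where
  DH : Lift D H H D
  DU : Lift D U H H
  HH : Lift H H U D
  HU : Lift H U U H

data _↗_ : ∀ {n} → Vec Step n → Vec Step n → Set where
  valley : ∀ {n s t s′ t′} {γ : Vec Step n} → Lift s t s′ t′ → s ∷ t ∷ γ ↗ s′ ∷ t′ ∷ γ
  later  : ∀ {n s} {γ δ : Vec Step n} → γ ↗ δ → s ∷ γ ↗ s ∷ δ

Lift-rise : ∀ {s t s′ t′} → Lift s t s′ t′ → rise s′ ≡ 1ℤ ℤ.+ rise s
Lift-rise DH = refl
Lift-rise DU = refl
Lift-rise HH = refl
Lift-rise HU = refl

Lift-total : ∀ {s t s′ t′} → Lift s t s′ t′ → rise s′ ℤ.+ rise t′ ≡ rise s ℤ.+ rise t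
Lift-total DH = refl
Lift-total DU = refl
Lift-total HH = refl
Lift-total HU = refl

liftable : ∀ s t → s ≢ U → t ≢ D → ∃[ s′ ] ∃[ t′ ] Lift s t s′ t′
liftable U t s≢U t≢D = contradiction refl s≢U
liftable D U s≢U t≢D = _ , _ , DU
liftable D D s≢U t≢D = contradiction refl t≢D
liftable D H s≢U t≢D = _ , _ , DH
liftable H U s≢U t≢D = _ , _ , HU
liftable H D s≢U t≢D = contradiction refl t≢D
liftable H H s≢U t≢D = _ , _ , HH

Lift-height : ∀ {n s t s′ t′} (γ : Vec Step n) → Lift s t s′ t′ → ∀ k →
              height (s′ ∷ t′ ∷ γ) (suc (suc k)) ≡ height (s ∷ t ∷ γ) (suc (suc k))
Lift-height {s = s} {t} {s′} {t′} γ l k = begin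
  rise s′ ℤ.+ (rise t′ ℤ.+ height γ k) ≡⟨ ℤ.+-assoc (rise s′) (rise t′) (height γ k) ⟨
  rise s′ ℤ.+ rise t′ ℤ.+ height γ k   ≡⟨ cong (ℤ._+ height γ k) (Lift-total l) ⟩
  rise s ℤ.+ rise t ℤ.+ height γ k     ≡⟨ ℤ.+-assoc (rise s) (rise t) (height γ k) ⟩
  rise s ℤ.+ (rise t ℤ.+ height γ k)   ∎
  where open ≡-Reasoning

↗-height : ∀ {n} {γ δ : Vec Step n} → γ ↗ δ →
           ∃[ p ] height δ p ≡ 1ℤ ℤ.+ height γ p × (∀ k → k ≢ p → height δ k ≡ height γ k)
↗-height (valley {s = s} {t} {s′} {γ = γ} l) = suc zero , raised , others
  where
  raised : rise s′ ℤ.+ 0ℤ ≡ 1ℤ ℤ.+ (rise s ℤ.+ 0ℤ)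
  raised = trans (cong (ℤ._+ 0ℤ) (Lift-rise l)) (ℤ.+-assoc 1ℤ (rise s) 0ℤ)
  others : ∀ k → k ≢ suc zero → _
  others zero          k≢p = refl
  others (suc zero)    k≢p = contradiction refl k≢p
  others (suc (suc k)) k≢p = Lift-height γ l k
↗-height (later {s = s} {γ} {δ} γ↗δ) with p , raised , others ← ↗-height γ↗δ =
  suc p ,
  trans (cong (ℤ._+_ (rise s)) raised) (solve 2 (λ r h → r :+ (con 1ℤ :+ h) := con 1ℤ :+ (r :+ h)) refl (rise s) (height γ p)) ,
  λ { zero    k≢p → refl
    ; (suc k) k≢p → cong (ℤ._+_ (rise s)) (others k (k≢p ∘ cong suc)) }
  where open ℤSolver.+-*-Solver

infix 4 _⊑_

_⊑_ : ∀ {n} → Vec Step n → Vec Step n → Set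
γ ⊑ δ = ∀ k → height γ k ℤ.≤ height δ k

end : ∀ {n} → Vec Step n → ℤ
end {n} γ = height γ (fromℕ n)

↗⇒⊑ : ∀ {n} {γ δ : Vec Step n} → γ ↗ δ → γ ⊑ δ
↗⇒⊑ {γ = γ} {δ} γ↗δ k with p , raised , others ← ↗-height γ↗δ | k Fin.≟ p
... | yes refl = ℤ.≤-trans (ℤ.i≤j+i (height γ p) 1ℤ) (ℤ.≤-reflexive (sym raised))
... | no k≢p   = ℤ.≤-reflexive (sym (others k k≢p))

↗⇒≢ : ∀ {n} {γ δ : Vec Step n} → γ ↗ δ → γ ≢ δ
↗⇒≢ {γ = γ} γ↗γ refl with p , raised , _ ← ↗-height γ↗γ =
  ℤ.<-irrefl raised (ℤ.suc[i]≤j⇒i<j ℤ.≤-refl)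

↗-end : ∀ {n} {γ δ : Vec Step n} → γ ↗ δ → end δ ≡ end γ
↗-end (valley {n} {γ = γ} l) = Lift-height γ l (fromℕ n)
↗-end (later {s = s} γ↗δ) = cong (ℤ._+_ (rise s)) (↗-end γ↗δ)

-- Only at the raised vertex do γ and δ differ, and there by 1, so the integer height of ε has two
-- options at that vertex and is squeezed everywhere else.
↗-between : ∀ {n} {γ ε δ : Vec Step n} → γ ↗ δ → γ ⊑ ε → ε ⊑ δ → ε ≡ γ ⊎ ε ≡ δ
↗-between {γ = γ} {ε} {δ} γ↗δ γ⊑ε ε⊑δ with p , raised , others ← ↗-height γ↗δ | height γ p ℤ.≟ height ε p
... | yes eq = inj₁ (height-injective ε γ λ k → agree k)
  where
  agree : ∀ k → height ε k ≡ height γ k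
  agree k with k Fin.≟ p
  ... | yes refl = sym eq
  ... | no k≢p   = ℤ.≤-antisym (ℤ.≤-trans (ε⊑δ k) (ℤ.≤-reflexive (others k k≢p))) (γ⊑ε k)
... | no neq = inj₂ (height-injective ε δ λ k → agree k)
  where
  agree : ∀ k → height ε k ≡ height δ k
  agree k with k Fin.≟ p
  ... | yes refl = ℤ.≤-antisym (ε⊑δ p) (ℤ.≤-trans (ℤ.≤-reflexive raised) (ℤ.i<j⇒suc[i]≤j (ℤ.≤∧≢⇒< (γ⊑ε p) neq)))
  ... | no k≢p   = ℤ.≤-antisym (ε⊑δ k) (ℤ.≤-trans (ℤ.≤-reflexive (others k k≢p)) (γ⊑ε k))

-- γ runs below d + δ, starting strictly below and ending level with it, so it
-- must stop descending; there the last step of s ∷ γ together with the next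
-- one forms a valley.
raise-catching-up :
  ∀ {n} s (γ δ : Vec Step n) d → s ≢ U → 1ℤ ℤ.≤ d →
  (∀ k → height γ k ℤ.≤ d ℤ.+ height δ k) → end γ ≡ d ℤ.+ end δ →
  ∃[ ε ] s ∷ γ ↗ ε × (∀ k → height ε (suc k) ℤ.≤ rise s ℤ.+ (d ℤ.+ height δ k))
raise-catching-up s [] [] d s≢U 1≤d γ≤δ ends =
  -- The gap `d` is at least 1 but must be closed at the end, so the search stops before the steps
  -- run out.
  contradiction (subst (1ℤ ℤ.≤_) (trans (sym (ℤ.+-identityʳ d)) (sym ends)) 1≤d) λ { (ℤ.+≤+ ()) }
raise-catching-up s (t ∷ γ) (t′ ∷ δ) d s≢U 1≤d γ≤δ ends with rise t ℤ.≟ rise D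
... | no t≢D with s′ , t″ , l ← liftable s t s≢U (t≢D ∘ cong rise) =
  s′ ∷ t″ ∷ γ , valley l , bound
  where
  bound : ∀ k → height (s′ ∷ t″ ∷ γ) (suc k) ℤ.≤ rise s ℤ.+ (d ℤ.+ height (t′ ∷ δ) k)
  bound zero    = begin
    rise s′ ℤ.+ 0ℤ         ≡⟨ trans (ℤ.+-identityʳ (rise s′)) (trans (Lift-rise l) (ℤ.+-comm 1ℤ (rise s))) ⟩
    rise s ℤ.+ 1ℤ          ≤⟨ ℤ.+-monoʳ-≤ (rise s) 1≤d ⟩
    rise s ℤ.+ d           ≡⟨ cong (ℤ._+_ (rise s)) (ℤ.+-identityʳ d) ⟨
    rise s ℤ.+ (d ℤ.+ 0ℤ)  ∎
    where open ℤ.≤-Reasoning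
  bound (suc k) = ℤ.≤-trans (ℤ.≤-reflexive (Lift-height γ l k)) (ℤ.+-monoʳ-≤ (rise s) (γ≤δ (suc k)))
... | yes t≡D with refl ← rise-injective t D t≡D =
  let ε , γ↗ε , bound = raise-catching-up D γ δ d′ (λ ()) 1≤d′ below ends′ in
  s ∷ ε , later γ↗ε , λ
    { zero    → ℤ.+-monoʳ-≤ (rise s) (ℤ.≤-trans (ℤ.≤-trans (ℤ.+≤+ z≤n) 1≤d) (ℤ.≤-reflexive (sym (ℤ.+-identityʳ d))))
    ; (suc k) → ℤ.+-monoʳ-≤ (rise s) (ℤ.≤-trans (bound k) (ℤ.≤-reflexive (regroup (height δ k)))) }
  where
  open ℤSolver.+-*-Solver
  -- The gap after the descent, d + `rise t′` - `rise D`; as no step falls faster than `D`, it does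
  -- not shrink.
  d′ = d ℤ.+ (rise t′ ℤ.+ 1ℤ)
  0≤rise+1 : ∀ t → 0ℤ ℤ.≤ rise t ℤ.+ 1ℤ
  0≤rise+1 U = ℤ.+≤+ z≤n
  0≤rise+1 D = ℤ.+≤+ z≤n
  0≤rise+1 H = ℤ.+≤+ z≤n
  1≤d′ : 1ℤ ℤ.≤ d′
  1≤d′ = ℤ.≤-trans 1≤d (ℤ.≤-trans (ℤ.≤-reflexive (sym (ℤ.+-identityʳ d))) (ℤ.+-monoʳ-≤ d (0≤rise+1 t′)))
  regroup : ∀ h → rise D ℤ.+ (d′ ℤ.+ h) ≡ d ℤ.+ (rise t′ ℤ.+ h)
  regroup = solve 3 (λ d r h → con (rise D) :+ (d :+ (r :+ con 1ℤ) :+ h) := d :+ (r :+ h)) refl d (rise t′)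
  below : ∀ k → height γ k ℤ.≤ d′ ℤ.+ height δ k
  below k = ℤ-cancel (ℤ.≤-trans (γ≤δ (suc k)) (ℤ.≤-reflexive (sym (regroup (height δ k)))))
    where
    ℤ-cancel : ∀ {a b} → rise D ℤ.+ a ℤ.≤ rise D ℤ.+ b → a ℤ.≤ b
    ℤ-cancel {a} {b} le = subst₂ ℤ._≤_
      (solve 1 (λ a → con 1ℤ :+ (con (rise D) :+ a) := a) refl a)
      (solve 1 (λ a → con 1ℤ :+ (con (rise D) :+ a) := a) refl b) (ℤ.+-monoʳ-≤ 1ℤ le)
  ends′ : end γ ≡ d′ ℤ.+ end δ
  ends′ = ℤ-Group.∙-cancelˡ (rise D) _ _ (trans ends (sym (regroup (end δ))))

-- Follow both paths to the first step at which they differ. There γ ⊑ δ forces `rise s < rise t`,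
-- so s is not `U`, and γ has to catch up from a gap of at least 1.
raise-below : ∀ {n} (γ δ : Vec Step n) → γ ⊑ δ → end γ ≡ end δ → γ ≢ δ →
              ∃[ ε ] γ ↗ ε × ε ⊑ δ
raise-below []      []      γ⊑δ ends γ≢δ = contradiction refl γ≢δ
raise-below (s ∷ γ) (t ∷ δ) γ⊑δ ends γ≢δ with rise s ℤ.≟ rise t
... | yes s≡t with refl ← rise-injective s t s≡t
  = let ε , γ↗ε , ε⊑δ = raise-below γ δ
          (λ k → cancel (γ⊑δ (suc k))) (ℤ-Group.∙-cancelˡ (rise s) _ _ ends) (γ≢δ ∘ cong (s ∷_)) in
  s ∷ ε , later γ↗ε , λ { zero → ℤ.≤-refl ; (suc k) → ℤ.+-monoʳ-≤ (rise s) (ε⊑δ k) }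
  where
  open ℤSolver.+-*-Solver
  cancel : ∀ {a b} → rise s ℤ.+ a ℤ.≤ rise s ℤ.+ b → a ℤ.≤ b
  cancel {a} {b} le = subst₂ ℤ._≤_
    (solve 2 (λ r a → :- r :+ (r :+ a) := a) refl (rise s) a)
    (solve 2 (λ r a → :- r :+ (r :+ a) := a) refl (rise s) b) (ℤ.+-monoʳ-≤ (ℤ.- rise s) le)
... | no s≢t =
  let ε , γ↗ε , bound = raise-catching-up s γ δ d s≢U 1≤d below ends′ in
  ε , γ↗ε , λ { zero → ℤ.≤-reflexive (start ε) ; (suc k) → ℤ.≤-trans (bound k) (ℤ.≤-reflexive (regroup (height δ k))) }
  where
  open ℤSolver.+-*-Solver
  start : ∀ {n} (ε : Vec Step n) → height ε zero ≡ 0ℤ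
  start ε = refl
  d = rise t ℤ.- rise s
  s<t : rise s ℤ.< rise t
  s<t = ℤ.≤∧≢⇒< (subst₂ ℤ._≤_ (rise-+0 s γ) (rise-+0 t δ) (γ⊑δ (suc zero))) s≢t
  s≢U : s ≢ U
  s≢U refl = U-max t s<t
    where
    U-max : ∀ t → ¬ 1ℤ ℤ.< rise t
    U-max U (ℤ.+<+ (s≤s ()))
    U-max D ()
    U-max H (ℤ.+<+ ())
  1≤d : 1ℤ ℤ.≤ d
  1≤d = subst (ℤ._≤ d) (solve 1 (λ r → con 1ℤ :+ r :- r := con 1ℤ) refl (rise s))
          (ℤ.+-monoˡ-≤ (ℤ.- rise s) (ℤ.i<j⇒suc[i]≤j s<t))
  regroup : ∀ h → rise s ℤ.+ (d ℤ.+ h) ≡ rise t ℤ.+ h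
  regroup = solve 3 (λ s t h → s :+ (t :- s :+ h) := t :+ h) refl (rise s) (rise t)
  below : ∀ k → height γ k ℤ.≤ d ℤ.+ height δ k
  below k = subst₂ ℤ._≤_
    (solve 2 (λ r a → :- r :+ (r :+ a) := a) refl (rise s) (height γ k))
    (solve 3 (λ s t h → :- s :+ (t :+ h) := t :- s :+ h) refl (rise s) (rise t) (height δ k))
    (ℤ.+-monoʳ-≤ (ℤ.- rise s) (γ⊑δ (suc k)))
  ends′ : end γ ≡ d ℤ.+ end δ
  ends′ = ℤ-Group.∙-cancelˡ (rise s) _ _ (trans ends (sym (regroup (end δ))))

module _ {n : ℕ} where
  open FinitePoset (GM n) using (_⋖_)

  ↗⇒⋖ : {γ δ : GrandMotzkin n} → proj₁ γ ↗ proj₁ δ → γ ⋖ δ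
  ↗⇒⋖ γ↗δ = (↗⇒⊑ γ↗δ , ↗⇒≢ γ↗δ ∘ cong proj₁) , λ { ε ((γ⊑ε , γ≢ε) , (ε⊑δ , ε≢δ)) →
    [ (λ eq → γ≢ε (sym (GM-≡ eq))) , (λ eq → ε≢δ (GM-≡ eq)) ]′ (↗-between γ↗δ γ⊑ε ε⊑δ) }

  -- The raise of γ found by `raise-below` has the same end, hence belongs to the lattice. It lies
  -- above γ and weakly below δ, so a cover leaves it no choice but δ.
  ⋖⇒↗ : {γ δ : GrandMotzkin n} → γ ⋖ δ → proj₁ γ ↗ proj₁ δ
  ⋖⇒↗ {γ , γ-end} {δ , δ-end} ((γ⊑δ , γ≢δ) , none)
    with ε , γ↗ε , ε⊑δ ← raise-below γ δ γ⊑δ (trans γ-end (sym δ-end)) (γ≢δ ∘ GM-≡)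
    with FinitePoset._≟_ (GM n) (ε , trans (↗-end γ↗ε) γ-end) (δ , δ-end)
  ... | yes eq = subst (γ ↗_) (cong proj₁ eq) γ↗ε
  ... | no ε≢δ = contradiction
    ((↗⇒⊑ γ↗ε , ↗⇒≢ γ↗ε ∘ cong proj₁) , (ε⊑δ , ε≢δ)) (none (ε , trans (↗-end γ↗ε) γ-end))


-- Enumeration of upper covers and double counting of Hasse edges

lifts : Step → Step → List (Step × Step)
lifts D H = (H , D) ∷ []
lifts D U = (H , H) ∷ []
lifts H H = (U , D) ∷ []
lifts H U = (U , H) ∷ []
lifts _ _ = []

-- Built by recursion on the path, so that upper covers can be counted step by step instead of by
-- testing pairs of paths.
raises : ∀ {n} → Vec Step n → List (Vec Step n)
raises []          = []
raises (s ∷ [])    = []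
raises (s ∷ t ∷ γ) = map (λ { (s′ , t′) → s′ ∷ t′ ∷ γ }) (lifts s t) ++ map (s ∷_) (raises (t ∷ γ))

∈-lifts⁺ : ∀ {s t s′ t′} → Lift s t s′ t′ → (s′ , t′) ∈ lifts s t
∈-lifts⁺ DH = here refl
∈-lifts⁺ DU = here refl
∈-lifts⁺ HH = here refl
∈-lifts⁺ HU = here refl

∈-lifts⁻ : ∀ s t {s′ t′} → (s′ , t′) ∈ lifts s t → Lift s t s′ t′
∈-lifts⁻ D H (here refl) = DH
∈-lifts⁻ D U (here refl) = DU
∈-lifts⁻ H H (here refl) = HH
∈-lifts⁻ H U (here refl) = HU

lifts-distinct : ∀ s t → Unique (lifts s t)
lifts-distinct U _ = []
lifts-distinct D U = [] ∷ []
lifts-distinct D D = []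
lifts-distinct D H = [] ∷ []
lifts-distinct H U = [] ∷ []
lifts-distinct H D = []
lifts-distinct H H = [] ∷ []

Lift-≢ : ∀ {s t s′ t′} → Lift s t s′ t′ → s′ ≢ s
Lift-≢ DH ()
Lift-≢ DU ()
Lift-≢ HH ()
Lift-≢ HU ()

∈-raises⁺ : ∀ {n} {γ δ : Vec Step n} → γ ↗ δ → δ ∈ raises γ
∈-raises⁺ (valley l) = ∈-++⁺ˡ (∈-map⁺ _ (∈-lifts⁺ l))
∈-raises⁺ {γ = s ∷ t ∷ γ} (later γ↗δ) = ∈-++⁺ʳ (map _ (lifts s t)) (∈-map⁺ (s ∷_) (∈-raises⁺ γ↗δ))

∈-raises⁻ : ∀ {n} (γ : Vec Step n) {δ} → δ ∈ raises γ → γ ↗ δ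
∈-raises⁻ (s ∷ t ∷ γ) δ∈ with ∈-++⁻ (map _ (lifts s t)) δ∈
... | inj₁ δ∈ˡ with (s′ , t′) , l∈ , refl ← ∈-map⁻ _ δ∈ˡ = valley (∈-lifts⁻ s t l∈)
... | inj₂ δ∈ʳ with δ′ , δ′∈ , refl ← ∈-map⁻ (s ∷_) δ∈ʳ = later (∈-raises⁻ (t ∷ γ) δ′∈)

raises-distinct : ∀ {n} (γ : Vec Step n) → Unique (raises γ)
raises-distinct []          = []
raises-distinct (s ∷ [])    = []
raises-distinct (s ∷ t ∷ γ) = Unique.++⁺
  (Unique.map⁺ (λ { refl → refl }) (lifts-distinct s t))
  (Unique.map⁺ (λ { refl → refl }) (raises-distinct (t ∷ γ)))
  disjoint
  where
  -- Raising the first pair changes the first step, raising a later one keeps it.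
  disjoint : ∀ {δ} → ¬ (δ ∈ map (λ { (s′ , t′) → s′ ∷ t′ ∷ γ }) (lifts s t) × δ ∈ map (s ∷_) (raises (t ∷ γ)))
  disjoint (δ∈ˡ , δ∈ʳ) with (s′ , t′) , l∈ , refl ← ∈-map⁻ _ δ∈ˡ | _ , _ , refl ← ∈-map⁻ (s ∷_) δ∈ʳ =
    Lift-≢ (∈-lifts⁻ s t l∈) refl

module _ {A B : Set} {P : Pred (A × B) 0ℓ} (P? : Decidable P) where

  filter-row : ∀ x ys → length (filter P? (map (x ,_) ys)) ≡ length (filter (λ y → P? (x , y)) ys)
  filter-row x []       = refl
  filter-row x (y ∷ ys) with P? (x , y)
  ... | yes _ = cong suc (filter-row x ys)
  ... | no  _ = filter-row x ys

  filter-cartesianProduct : ∀ xs ys → length (filter P? (cartesianProduct xs ys)) ≡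
                            sum (map (λ x → length (filter (λ y → P? (x , y)) ys)) xs)
  filter-cartesianProduct []       ys = refl
  filter-cartesianProduct (x ∷ xs) ys = begin
    length (filter P? (map (x ,_) ys ++ cartesianProduct xs ys))
      ≡⟨ cong length (filter-++ P? (map (x ,_) ys) _) ⟩
    length (filter P? (map (x ,_) ys) ++ filter P? (cartesianProduct xs ys))
      ≡⟨ length-++ (filter P? (map (x ,_) ys)) ⟩
    length (filter P? (map (x ,_) ys)) + length (filter P? (cartesianProduct xs ys))
      ≡⟨ cong₂ _+_ (filter-row x ys) (filter-cartesianProduct xs ys) ⟩
    length (filter (λ y → P? (x , y)) ys) + sum (map (λ x → length (filter (λ y → P? (x , y)) ys)) xs) ∎
    where open ≡-Reasoning

module _ {n : ℕ} where
  open FinitePoset (GM n) using (_⋖?_; elements)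

  -- Two duplicate-free lists with the same members are permutations of each other, hence equally
  -- long.
  upperCovers : ∀ γ → length (filter (γ ⋖?_) elements) ≡ length (raises (proj₁ γ))
  upperCovers γ = trans (sym (length-map proj₁ (filter (γ ⋖?_) elements))) $
    ↭-length $ ∼bag⇒↭ $ unique∧set⇒bag
      (Unique.map⁺ GM-≡ (Unique.filter⁺ (γ ⋖?_) (FinitePoset.distinct (GM n))))
      (raises-distinct (proj₁ γ))
      (mk⇔ to from)
    where
    to : ∀ {δ} → δ ∈ map proj₁ (filter (γ ⋖?_) elements) → δ ∈ raises (proj₁ γ)
    to δ∈ with δ , δ∈′ , refl ← ∈-map⁻ proj₁ δ∈ =
      ∈-raises⁺ (⋖⇒↗ {γ = γ} {δ} (proj₂ (∈-filter⁻ (γ ⋖?_) {xs = elements} δ∈′)))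
    from : ∀ {δ} → δ ∈ raises (proj₁ γ) → δ ∈ map proj₁ (filter (γ ⋖?_) elements)
    from {δ} δ∈ =
      let γ↗δ = ∈-raises⁻ (proj₁ γ) δ∈
          δ′ = δ , trans (↗-end γ↗δ) (proj₂ γ)
      in ∈-map⁺ proj₁ (∈-filter⁺ (γ ⋖?_) (FinitePoset.complete (GM n) δ′) (↗⇒⋖ {γ = γ} {δ′} γ↗δ))

-- Total number of valleys over all paths with a given end

𝟙[_] : ∀ {P : Set} → Dec P → ℕ
𝟙[ yes _ ] = 1
𝟙[ no  _ ] = 0

𝟙-cong : ∀ {P Q : Set} (P? : Dec P) (Q? : Dec Q) → (P → Q) → (Q → P) → 𝟙[ P? ] ≡ 𝟙[ Q? ]
𝟙-cong (yes _) (yes _) f g = refl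
𝟙-cong (yes p) (no ¬q) f g = contradiction (f p) ¬q
𝟙-cong (no ¬p) (yes q) f g = contradiction (g q) ¬p
𝟙-cong (no _)  (no _)  f g = refl

-- The end j is arbitrary because removing the first step shifts it: the case j = 0 alone would not
-- support an induction.
total : ∀ {n} → (Vec Step n → ℕ) → ℤ → ℕ
total {n} f j = sum (map (λ γ → 𝟙[ end γ ℤ.≟ j ] * f γ) (allPaths n))

sum-map-+ : ∀ {A : Set} (f g : A → ℕ) xs → sum (map (λ x → f x + g x) xs) ≡ sum (map f xs) + sum (map g xs)
sum-map-+ f g []       = refl
sum-map-+ f g (x ∷ xs) = trans (cong (_+_ (f x + g x)) (sum-map-+ f g xs))
  (interchange ℕ.+-commutativeSemigroup (f x) (g x) _ _)

total-+ : ∀ {n} (f g : Vec Step n → ℕ) j → total (λ γ → f γ + g γ) j ≡ total f j + total g j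
total-+ {n} f g j = trans
  (cong sum (map-cong (λ γ → ℕ.*-distribˡ-+ 𝟙[ end γ ℤ.≟ j ] (f γ) (g γ)) (allPaths n)))
  (sum-map-+ _ _ (allPaths n))

total-cong : ∀ {n} {f g : Vec Step n → ℕ} → (∀ γ → f γ ≡ g γ) → ∀ j → total f j ≡ total g j
total-cong {n} f≗g j = cong sum (map-cong (λ γ → cong (𝟙[ end γ ℤ.≟ j ] *_) (f≗g γ)) (allPaths n))

total-0 : ∀ {n} j → total {n} (λ _ → 0) j ≡ 0
total-0 {n} j = zeros (allPaths n)
  where
  zeros : ∀ γs → sum (map (λ γ → 𝟙[ end γ ℤ.≟ j ] * 0) γs) ≡ 0
  zeros []       = refl
  zeros (γ ∷ γs) = cong₂ _+_ (ℕ.*-zeroʳ 𝟙[ end γ ℤ.≟ j ]) (zeros γs)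

total-closed : ∀ {n} (f : Vec Step n → ℕ) →
               sum (map (f ∘ proj₁) (FinitePoset.elements (GM n))) ≡ total f 0ℤ
total-closed {n} f = go (allPaths n)
  where
  go : ∀ γs → sum (map (f ∘ proj₁) (closed γs)) ≡ sum (map (λ γ → 𝟙[ end γ ℤ.≟ 0ℤ ] * f γ) γs)
  go []       = refl
  go (γ ∷ γs) with height γ (fromℕ n) ℤ.≟ 0ℤ
  ... | yes _ = cong₂ _+_ (sym (ℕ.+-identityʳ (f γ))) (go γs)
  ... | no  _ = go γs

total-suc : ∀ {n} (f : Vec Step (suc n) → ℕ) j →
            total f j ≡ total (f ∘ (U ∷_)) (j ℤ.- 1ℤ) + (total (f ∘ (D ∷_)) (j ℤ.+ 1ℤ) + total (f ∘ (H ∷_)) j)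
total-suc {n} f j = begin
  sum (map F (map (U ∷_) γs ++ (map (D ∷_) γs ++ (map (H ∷_) γs ++ []))))
    ≡⟨ sum-map-++ (map (U ∷_) γs) _ ⟩
  sum (map F (map (U ∷_) γs)) + sum (map F (map (D ∷_) γs ++ (map (H ∷_) γs ++ [])))
    ≡⟨ cong₂ _+_ (branch U (j ℤ.- 1ℤ) refl) (trans (sum-map-++ (map (D ∷_) γs) _)
         (cong₂ _+_ (branch D (j ℤ.+ 1ℤ) refl)
           (trans (cong (sum ∘ map F) (++-identityʳ (map (H ∷_) γs))) (branch H j (sym (ℤ.+-identityʳ j)))))) ⟩
  total (f ∘ (U ∷_)) (j ℤ.- 1ℤ) + (total (f ∘ (D ∷_)) (j ℤ.+ 1ℤ) + total (f ∘ (H ∷_)) j) ∎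
  where
  open ≡-Reasoning
  open ℤSolver.+-*-Solver
  γs = allPaths n
  F : Vec Step (suc n) → ℕ
  F γ = 𝟙[ end γ ℤ.≟ j ] * f γ
  sum-map-++ : ∀ δs εs → sum (map F (δs ++ εs)) ≡ sum (map F δs) + sum (map F εs)
  sum-map-++ δs εs = trans (cong sum (map-++ F δs εs)) (sum-++ (map F δs) (map F εs))
  branch : ∀ s j′ → j′ ≡ j ℤ.- rise s → sum (map F (map (s ∷_) γs)) ≡ total (f ∘ (s ∷_)) j′
  branch s j′ refl = cong sum (trans (sym (map-∘ γs)) (map-cong (λ γ → cong (_* f (s ∷ γ))
    (𝟙-cong (end (s ∷ γ) ℤ.≟ j) (end γ ℤ.≟ j′)
      (λ { refl → solve 2 (λ r h → h := r :+ h :- r) refl (rise s) (end γ) })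
      (λ eq → trans (cong (ℤ._+_ (rise s)) eq) (solve 2 (λ r j → r :+ (j :- r) := j) refl (rise s) j))))
    γs))

-- The coefficient of xʲ in Pⁿ for P = x⁻¹ + 1 + x; the recursion splits off one factor.
walks : ℕ → ℤ → ℕ
walks zero    j = 𝟙[ 0ℤ ℤ.≟ j ]
walks (suc n) j = walks n (j ℤ.- 1ℤ) + (walks n (j ℤ.+ 1ℤ) + walks n j)

total-1 : ∀ n j → total {n} (λ _ → 1) j ≡ walks n j
total-1 zero    j = trans (ℕ.+-identityʳ _) (ℕ.*-identityʳ _)
total-1 (suc n) j = trans (total-suc {n} (λ _ → 1) j)
  (cong₂ _+_ (total-1 n (j ℤ.- 1ℤ)) (cong₂ _+_ (total-1 n (j ℤ.+ 1ℤ)) (total-1 n j)))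

valleyCount : ∀ {n} → Vec Step n → ℕ
valleyCount γ = length (raises γ)

valleyAt : ∀ {n} → Step → Vec Step n → ℕ
valleyAt s []      = 0
valleyAt s (t ∷ γ) = length (lifts s t)

valleyCount-∷ : ∀ {n} s (γ : Vec Step n) → valleyCount (s ∷ γ) ≡ valleyAt s γ + valleyCount γ
valleyCount-∷ s []      = refl
valleyCount-∷ s (t ∷ γ) = trans (length-++ (map _ (lifts s t)))
  (cong₂ _+_ (length-map _ (lifts s t)) (length-map (s ∷_) (raises (t ∷ γ))))

-- The raisable pairs `DH`, `DU`, `HH`, `HU` rise by -1, 0, 0, 1 in total, so each of the n places
-- among n + 1 steps has weight x⁻¹ + 2 + x = P + 1, times Pⁿ⁻¹ for the other steps. At n = 0 the
-- value of `ℕ.pred n` is multiplied by 0.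
total-valleyCount : ∀ n j → total {suc n} valleyCount j ≡ n * (walks n j + walks (ℕ.pred n) j)
total-valleyCount zero    j = trans (total-suc {0} valleyCount j)
  (cong₂ _+_ (total-0 {0} (j ℤ.- 1ℤ)) (cong₂ _+_ (total-0 {0} (j ℤ.+ 1ℤ)) (total-0 {0} j)))
total-valleyCount (suc n) j = begin
  total {2 + n} valleyCount j
    ≡⟨ total-suc {suc n} valleyCount j ⟩
  total {suc n} (λ γ → valleyCount (U ∷ γ)) (j ℤ.- 1ℤ) + (total {suc n} (λ γ → valleyCount (D ∷ γ)) (j ℤ.+ 1ℤ) + total {suc n} (λ γ → valleyCount (H ∷ γ)) j)
    ≡⟨ cong₂ _+_ (split U (j ℤ.- 1ℤ)) (cong₂ _+_ (split D (j ℤ.+ 1ℤ)) (split H j)) ⟩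
  (total {suc n} (valleyAt U) (j ℤ.- 1ℤ) + n * (walks n (j ℤ.- 1ℤ) + walks (ℕ.pred n) (j ℤ.- 1ℤ)))
    + ((total {suc n} (valleyAt D) (j ℤ.+ 1ℤ) + n * (walks n (j ℤ.+ 1ℤ) + walks (ℕ.pred n) (j ℤ.+ 1ℤ)))
    + (total {suc n} (valleyAt H) j + n * (walks n j + walks (ℕ.pred n) j)))
    ≡⟨ cong₂ _+_ (cong (_+ n * (walks n (j ℤ.- 1ℤ) + walks (ℕ.pred n) (j ℤ.- 1ℤ))) (atU (j ℤ.- 1ℤ)))
        (cong₂ _+_ (cong (_+ n * (walks n (j ℤ.+ 1ℤ) + walks (ℕ.pred n) (j ℤ.+ 1ℤ))) (trans (atDH D (λ { U → refl ; D → refl ; H → refl }) (j ℤ.+ 1ℤ)) (cong (λ i → walks n i + walks n (j ℤ.+ 1ℤ)) (solveℤ j))))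
                   (cong (_+ n * (walks n j + walks (ℕ.pred n) j)) (atDH H (λ { U → refl ; D → refl ; H → refl }) j))) ⟩
  n * (walks n (j ℤ.- 1ℤ) + walks (ℕ.pred n) (j ℤ.- 1ℤ))
    + ((walks n j + walks n (j ℤ.+ 1ℤ) + n * (walks n (j ℤ.+ 1ℤ) + walks (ℕ.pred n) (j ℤ.+ 1ℤ)))
    + (walks n (j ℤ.- 1ℤ) + walks n j + n * (walks n j + walks (ℕ.pred n) j)))
    ≡⟨ collect n ⟩
  suc n * (walks (suc n) j + walks n j) ∎
  where
  open ≡-Reasoning
  solveℤ : ∀ j → j ℤ.+ 1ℤ ℤ.- 1ℤ ≡ j
  solveℤ = solve 1 (λ j → j :+ con 1ℤ :- con 1ℤ := j) refl
    where open ℤSolver.+-*-Solver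
  split : ∀ s j → total {suc n} (λ γ → valleyCount (s ∷ γ)) j ≡
                  total {suc n} (valleyAt s) j + n * (walks n j + walks (ℕ.pred n) j)
  split s j = trans (total-cong {suc n} (valleyCount-∷ s) j)
    (trans (total-+ {suc n} (valleyAt s) valleyCount j) (cong (_+_ (total {suc n} (valleyAt s) j)) (total-valleyCount n j)))
  -- No pair starting with `U` can be raised; after `D` or `H` exactly the next steps `U` and `H`
  -- allow it, each in one way.
  atU : ∀ j → total {suc n} (valleyAt U) j ≡ 0
  atU j = trans (total-cong {suc n} {valleyAt U} {λ _ → 0} (λ { (t ∷ γ) → refl }) j) (total-0 {suc n} j)
  atDH : ∀ s → (∀ t → length (lifts s t) ≡ length (lifts H t)) → ∀ j →
         total {suc n} (valleyAt s) j ≡ walks n (j ℤ.- 1ℤ) + walks n j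
  atDH s eq j = trans (total-suc {n} (valleyAt s) j) (cong₂ _+_
    (trans (total-cong {n} {valleyAt s ∘ (U ∷_)} {λ _ → 1} (λ _ → eq U) (j ℤ.- 1ℤ)) (total-1 n (j ℤ.- 1ℤ)))
    (trans (cong₂ _+_ (trans (total-cong {n} {valleyAt s ∘ (D ∷_)} {λ _ → 0} (λ _ → eq D) (j ℤ.+ 1ℤ)) (total-0 {n} (j ℤ.+ 1ℤ)))
                   (total-cong {n} {valleyAt s ∘ (H ∷_)} {λ _ → 1} (λ _ → eq H) j))
      (total-1 n j)))
  collect : ∀ n → n * (walks n (j ℤ.- 1ℤ) + walks (ℕ.pred n) (j ℤ.- 1ℤ))
    + ((walks n j + walks n (j ℤ.+ 1ℤ) + n * (walks n (j ℤ.+ 1ℤ) + walks (ℕ.pred n) (j ℤ.+ 1ℤ)))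
    + (walks n (j ℤ.- 1ℤ) + walks n j + n * (walks n j + walks (ℕ.pred n) j))) ≡ suc n * (walks (suc n) j + walks n j)
  -- At n = 0 the walks of length `pred n` are not one step shorter, so the unfolding of `walks n j`
  -- used in the other case is available from n = 1 on.
  collect zero = solve 3 (λ a b c → (b :+ c :+ con 0) :+ (a :+ b :+ con 0) := (a :+ (c :+ b)) :+ b :+ con 0)
    refl (walks 0 (j ℤ.- 1ℤ)) (walks 0 j) (walks 0 (j ℤ.+ 1ℤ))
    where open ℕSolver.+-*-Solver
  collect (suc m) = solve 6 (λ n a c x y z → let b = x :+ (z :+ y) in
      n :* (a :+ x) :+ ((b :+ c :+ n :* (c :+ z)) :+ (a :+ b :+ n :* (b :+ y)))
        := (con 1 :+ n) :* ((a :+ (c :+ b)) :+ b))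
    refl (suc m) (walks (suc m) (j ℤ.- 1ℤ)) (walks (suc m) (j ℤ.+ 1ℤ))
    (walks m (j ℤ.- 1ℤ)) (walks m j) (walks m (j ℤ.+ 1ℤ))
    where open ℕSolver.+-*-Solver

size-GM : ∀ n → FinitePoset.size (GM n) ≡ walks n 0ℤ
size-GM n = trans (count (FinitePoset.elements (GM n))) (trans (total-closed {n} (λ _ → 1)) (total-1 n 0ℤ))
  where
  count : ∀ {A : Set} (xs : List A) → length xs ≡ sum (map (λ _ → 1) xs)
  count []       = refl
  count (x ∷ xs) = cong suc (count xs)

ℓ-GM : ∀ n → ℓ (GM (2 + n)) ≡ suc n * (walks (suc n) 0ℤ + walks n 0ℤ)
ℓ-GM n = begin
  ℓ (GM (2 + n))
    ≡⟨ filter-cartesianProduct (uncurry _⋖?_) elements elements ⟩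
  sum (map (λ γ → length (filter (γ ⋖?_) elements)) elements)
    ≡⟨ cong sum (map-cong upperCovers elements) ⟩
  sum (map (valleyCount ∘ proj₁) elements)
    ≡⟨ total-closed {2 + n} valleyCount ⟩
  total {2 + n} valleyCount 0ℤ
    ≡⟨ total-valleyCount (suc n) 0ℤ ⟩
  suc n * (walks (suc n) 0ℤ + walks n 0ℤ) ∎
  where
  open ≡-Reasoning
  open FinitePoset (GM (2 + n)) using (_⋖?_; elements)

-- Symmetry and three-term recurrence of the walk counts

walks-below : ∀ n m → walks n -[1+ n + m ] ≡ 0
walks-below zero    m = refl
walks-below (suc n) m = cong₂ _+_
  (trans (cong (λ k → walks n -[1+ k ]) index) (walks-below n (2 + m)))
  (cong₂ _+_ (walks-below n m)
    (trans (cong (λ k → walks n -[1+ k ]) (sym (ℕ.+-suc n m))) (walks-below n (suc m))))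
  where
  index : 2 + (n + m + 0) ≡ n + (2 + m)
  index = solve 2 (λ n m → con 2 :+ (n :+ m :+ con 0) := n :+ (con 2 :+ m)) refl n m
    where open ℕSolver.+-*-Solver

walks-sym : ∀ n j → walks n (ℤ.- j) ≡ walks n j
walks-sym zero    j = 𝟙-cong (0ℤ ℤ.≟ ℤ.- j) (0ℤ ℤ.≟ j)
  (λ eq → trans (cong ℤ.-_ eq) (ℤ.neg-involutive j)) (λ eq → cong ℤ.-_ eq)
walks-sym (suc n) j = begin
  walks n (ℤ.- j ℤ.- 1ℤ) + (walks n (ℤ.- j ℤ.+ 1ℤ) + walks n (ℤ.- j))
    ≡⟨ cong₂ _+_ (trans (cong (walks n) (solve 1 (λ j → :- j :- con 1ℤ := :- (j :+ con 1ℤ)) refl j)) (walks-sym n (j ℤ.+ 1ℤ)))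
         (cong₂ _+_ (trans (cong (walks n) (solve 1 (λ j → :- j :+ con 1ℤ := :- (j :- con 1ℤ)) refl j)) (walks-sym n (j ℤ.- 1ℤ)))
           (walks-sym n j)) ⟩
  walks n (j ℤ.+ 1ℤ) + (walks n (j ℤ.- 1ℤ) + walks n j)
    ≡⟨ x∙yz≈y∙xz ℕ.+-commutativeSemigroup (walks n (j ℤ.+ 1ℤ)) (walks n (j ℤ.- 1ℤ)) (walks n j) ⟩
  walks n (j ℤ.- 1ℤ) + (walks n (j ℤ.+ 1ℤ) + walks n j) ∎
  where
  open ≡-Reasoning
  open ℤSolver.+-*-Solver

walksℤ : ℕ → ℤ → ℤ
walksℤ n j = + walks n j

-- Centred at i + 1, so that the indices are i, i + 1, i + 2 and the identity below involves
-- successors only.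
walksℤ-suc : ∀ n i → walksℤ (suc n) (ℤ.suc i) ≡
             walksℤ n i ℤ.+ (walksℤ n (ℤ.suc (ℤ.suc i)) ℤ.+ walksℤ n (ℤ.suc i))
walksℤ-suc n i = trans (ℤ.pos-+ (walks n (ℤ.suc i ℤ.- 1ℤ)) _)
  (cong₂ ℤ._+_ (cong (walksℤ n) (solve 1 (λ i → con 1ℤ :+ i :- con 1ℤ := i) refl i))
    (trans (ℤ.pos-+ (walks n (ℤ.suc i ℤ.+ 1ℤ)) _)
      (cong (λ k → walksℤ n k ℤ.+ walksℤ n (ℤ.suc i)) (ℤ.+-comm (ℤ.suc i) 1ℤ))))
  where open ℤSolver.+-*-Solver

-- The coefficient of x^(i+1) in P θ(Pⁿ) = n (x - x⁻¹) Pⁿ for P = x⁻¹ + 1 + x.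
walksℤ-derivative : ∀ n i → let W = walksℤ n in
  i ℤ.* W i ℤ.+ ℤ.suc i ℤ.* W (ℤ.suc i) ℤ.+ ℤ.suc (ℤ.suc i) ℤ.* W (ℤ.suc (ℤ.suc i)) ℤ.+ + n ℤ.* W (ℤ.suc (ℤ.suc i))
    ≡ + n ℤ.* W i
walksℤ-derivative zero i = trans
  (cong₂ ℤ._+_ (cong₂ ℤ._+_ (cong₂ ℤ._+_ (zeroed i) (zeroed (ℤ.suc i))) (zeroed (ℤ.suc (ℤ.suc i)))) (ℤ.*-zeroˡ (walksℤ 0 (ℤ.suc (ℤ.suc i))))) (sym (ℤ.*-zeroˡ (walksℤ 0 i)))
  where
  zeroed : ∀ j → j ℤ.* walksℤ 0 j ≡ 0ℤ
  zeroed j with 0ℤ ℤ.≟ j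
  ... | yes refl = refl
  ... | no _     = ℤ.*-zeroʳ j
-- The recurrence yields indices of the form `ℤ.suc i`; an arbitrary integer is the successor of i -
-- 1.
walksℤ-derivative (suc n) i = subst Derivative (solve 1 (λ i → con 1ℤ :+ (i :- con 1ℤ) := i) refl i) (step (i ℤ.- 1ℤ))
  where
  open ℤSolver.+-*-Solver
  W = walksℤ n
  W′ = walksℤ (suc n)
  Derivative : ℤ → Set
  Derivative i = i ℤ.* W′ i ℤ.+ ℤ.suc i ℤ.* W′ (ℤ.suc i) ℤ.+ ℤ.suc (ℤ.suc i) ℤ.* W′ (ℤ.suc (ℤ.suc i)) ℤ.+ + suc n ℤ.* W′ (ℤ.suc (ℤ.suc i))
    ≡ + suc n ℤ.* W′ i
  step : ∀ i → Derivative (ℤ.suc i)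
  step i = begin
    i₁ ℤ.* W′ i₁ ℤ.+ i₂ ℤ.* W′ i₂ ℤ.+ i₃ ℤ.* W′ i₃ ℤ.+ + suc n ℤ.* W′ i₃
      ≡⟨ cong₂ ℤ._+_ (cong₂ ℤ._+_ (cong₂ ℤ._+_ (cong (i₁ ℤ.*_) (walksℤ-suc n i)) (cong (i₂ ℤ.*_) (walksℤ-suc n i₁)))
           (cong (i₃ ℤ.*_) (walksℤ-suc n i₂))) (cong (+ suc n ℤ.*_) (walksℤ-suc n i₂)) ⟩
    i₁ ℤ.* (a ℤ.+ (c ℤ.+ b)) ℤ.+ i₂ ℤ.* (b ℤ.+ (d ℤ.+ c)) ℤ.+ i₃ ℤ.* (c ℤ.+ (e ℤ.+ d)) ℤ.+ + suc n ℤ.* (c ℤ.+ (e ℤ.+ d))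
      -- Multiplication by P adds the identities for n at i, i + 1, i + 2. What remains is one copy
      -- of `W′ i₁`, by which the factor `suc n` exceeds n.
      ≡⟨ solve 7 (λ i n a b c d e →
           let i₁ = con 1ℤ :+ i ; i₂ = con 1ℤ :+ i₁ ; i₃ = con 1ℤ :+ i₂ ; i₄ = con 1ℤ :+ i₃ in
           i₁ :* (a :+ (c :+ b)) :+ i₂ :* (b :+ (d :+ c)) :+ i₃ :* (c :+ (e :+ d)) :+ (con 1ℤ :+ n) :* (c :+ (e :+ d))
           := (i :* a :+ i₁ :* b :+ i₂ :* c :+ n :* c) :+ (i₁ :* b :+ i₂ :* c :+ i₃ :* d :+ n :* d)
              :+ (i₂ :* c :+ i₃ :* d :+ i₄ :* e :+ n :* e) :+ (a :+ (c :+ b)))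
           refl i (+ n) a b c d e ⟩
    (i ℤ.* a ℤ.+ i₁ ℤ.* b ℤ.+ i₂ ℤ.* c ℤ.+ + n ℤ.* c) ℤ.+ (i₁ ℤ.* b ℤ.+ i₂ ℤ.* c ℤ.+ i₃ ℤ.* d ℤ.+ + n ℤ.* d)
      ℤ.+ (i₂ ℤ.* c ℤ.+ i₃ ℤ.* d ℤ.+ ℤ.suc i₃ ℤ.* e ℤ.+ + n ℤ.* e) ℤ.+ (a ℤ.+ (c ℤ.+ b))
      ≡⟨ cong (ℤ._+ (a ℤ.+ (c ℤ.+ b))) (cong₂ ℤ._+_ (cong₂ ℤ._+_ (walksℤ-derivative n i) (walksℤ-derivative n i₁)) (walksℤ-derivative n i₂)) ⟩
    (+ n ℤ.* a ℤ.+ + n ℤ.* b ℤ.+ + n ℤ.* c) ℤ.+ (a ℤ.+ (c ℤ.+ b))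
      ≡⟨ solve 4 (λ n a b c → (n :* a :+ n :* b :+ n :* c) :+ (a :+ (c :+ b)) := (con 1ℤ :+ n) :* (a :+ (c :+ b))) refl (+ n) a b c ⟩
    + suc n ℤ.* (a ℤ.+ (c ℤ.+ b))
      ≡⟨ cong (+ suc n ℤ.*_) (walksℤ-suc n i) ⟨
    + suc n ℤ.* W′ i₁ ∎
    where
    open ≡-Reasoning
    i₁ = ℤ.suc i ; i₂ = ℤ.suc i₁ ; i₃ = ℤ.suc i₂
    a = W i ; b = W i₁ ; c = W i₂ ; d = W i₃ ; e = W (ℤ.suc i₃)

-- By symmetry everything is expressed through the counts t, s, b at 0, 1, 2, and the derivative
-- identity at i = 0 eliminates b.
walksℤ-recurrence : ∀ n → + (2 + n) ℤ.* walksℤ (2 + n) 0ℤ ≡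
                    + (3 + 2 * n) ℤ.* walksℤ (suc n) 0ℤ ℤ.+ + (3 * suc n) ℤ.* walksℤ n 0ℤ
walksℤ-recurrence n = begin
  + (2 + n) ℤ.* walksℤ (2 + n) 0ℤ
    ≡⟨ cong (+ (2 + n) ℤ.*_) (trans (centre (suc n)) (cong₂ (λ x y → x ℤ.+ (x ℤ.+ y)) (walksℤ-suc n 0ℤ) (centre n))) ⟩
  + (2 + n) ℤ.* (t ℤ.+ (b ℤ.+ s) ℤ.+ (t ℤ.+ (b ℤ.+ s) ℤ.+ (s ℤ.+ (s ℤ.+ t))))
    ≡⟨ solve 4 (λ n t s b → (con (+ 2) :+ n) :* (t :+ (b :+ s) :+ (t :+ (b :+ s) :+ (s :+ (s :+ t))))
         := con (+ 2) :* (con 0ℤ :* t :+ con (+ 1) :* s :+ con (+ 2) :* b :+ n :* b)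
            :+ ((con (+ 3) :* n :+ con (+ 6)) :* t :+ (con (+ 4) :* n :+ con (+ 6)) :* s)) refl (+ n) t s b ⟩
  + 2 ℤ.* (0ℤ ℤ.* t ℤ.+ + 1 ℤ.* s ℤ.+ + 2 ℤ.* b ℤ.+ + n ℤ.* b) ℤ.+ ((+ 3 ℤ.* + n ℤ.+ + 6) ℤ.* t ℤ.+ (+ 4 ℤ.* + n ℤ.+ + 6) ℤ.* s)
    ≡⟨ cong (λ x → + 2 ℤ.* x ℤ.+ ((+ 3 ℤ.* + n ℤ.+ + 6) ℤ.* t ℤ.+ (+ 4 ℤ.* + n ℤ.+ + 6) ℤ.* s)) (walksℤ-derivative n 0ℤ) ⟩
  + 2 ℤ.* (+ n ℤ.* t) ℤ.+ ((+ 3 ℤ.* + n ℤ.+ + 6) ℤ.* t ℤ.+ (+ 4 ℤ.* + n ℤ.+ + 6) ℤ.* s)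
    ≡⟨ solve 3 (λ n t s → con (+ 2) :* (n :* t) :+ ((con (+ 3) :* n :+ con (+ 6)) :* t :+ (con (+ 4) :* n :+ con (+ 6)) :* s)
         := (con (+ 3) :+ con (+ 2) :* n) :* (s :+ (s :+ t)) :+ (con (+ 3) :* (con 1ℤ :+ n)) :* t) refl (+ n) t s ⟩
  (+ 3 ℤ.+ + 2 ℤ.* + n) ℤ.* (s ℤ.+ (s ℤ.+ t)) ℤ.+ (+ 3 ℤ.* + suc n) ℤ.* t
    ≡⟨ cong₂ ℤ._+_ (cong₂ ℤ._*_ (cong (ℤ._+_ (+ 3)) (sym (ℤ.pos-* 2 n))) (sym (centre n))) (cong (ℤ._* t) (sym (ℤ.pos-* 3 (suc n)))) ⟩
  + (3 + 2 * n) ℤ.* walksℤ (suc n) 0ℤ ℤ.+ + (3 * suc n) ℤ.* t ∎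
  where
  open ≡-Reasoning
  open ℤSolver.+-*-Solver
  t = walksℤ n 0ℤ ; s = walksℤ n (+ 1) ; b = walksℤ n (+ 2)
  centre : ∀ n → walksℤ (suc n) 0ℤ ≡ walksℤ n (+ 1) ℤ.+ (walksℤ n (+ 1) ℤ.+ walksℤ n 0ℤ)
  centre n = trans (cong (λ k → + (k + (walks n (+ 1) + walks n 0ℤ))) (walks-sym n (+ 1)))
    (trans (ℤ.pos-+ (walks n (+ 1)) _) (cong (ℤ._+_ (walksℤ n (+ 1))) (ℤ.pos-+ (walks n (+ 1)) (walks n 0ℤ))))

walks-below₁ : ∀ n → walks n (0ℤ ℤ.- + suc n) ≡ 0
walks-below₁ n = trans (cong (λ k → walks n -[1+ k ]) (sym (ℕ.+-identityʳ n))) (walks-below n 0)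

walks-below₂ : ∀ n → walks n (0ℤ ℤ.- + suc n ℤ.- 1ℤ) ≡ 0
walks-below₂ n = trans (cong (λ k → walks n -[1+ k ]) (sym (ℕ.+-suc n 0))) (walks-below n 1)

module _ (j n : ℤ) where
  open ℤSolver.+-*-Solver

  j-[1+n]+1≡j-n : j ℤ.- (1ℤ ℤ.+ n) ℤ.+ 1ℤ ≡ j ℤ.- n
  j-[1+n]+1≡j-n = solve 2 (λ j n → j :- (con 1ℤ :+ n) :+ con 1ℤ := j :- n) refl j n

  [1+j]-[1+n]≡j-n : 1ℤ ℤ.+ j ℤ.- (1ℤ ℤ.+ n) ≡ j ℤ.- n
  [1+j]-[1+n]≡j-n = solve 2 (λ j n → con 1ℤ :+ j :- (con 1ℤ :+ n) := j :- n) refl j n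

  [1+j]-[1+n]-1≡j-[1+n] : 1ℤ ℤ.+ j ℤ.- (1ℤ ℤ.+ n) ℤ.- 1ℤ ≡ j ℤ.- (1ℤ ℤ.+ n)
  [1+j]-[1+n]-1≡j-[1+n] =
    solve 2 (λ j n → con 1ℤ :+ j :- (con 1ℤ :+ n) :- con 1ℤ := j :- (con 1ℤ :+ n)) refl j n

-- Binomial coefficients and an exponential bound

C-absorption : ∀ n k → suc k * (suc n C suc k) ≡ suc n * (n C k)
C-absorption zero    zero    = refl
C-absorption zero    (suc k) = trans (cong ((2 + k) *_) (k>n⇒nCk≡0 {1} {2 + k} (s≤s (s≤s z≤n)))) (trans (ℕ.*-zeroʳ (2 + k))
  (sym (cong (1 *_) (k>n⇒nCk≡0 {0} {suc k} (s≤s z≤n)))))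
C-absorption (suc n) zero    = begin
  1 * (suc (suc n) C 1)              ≡⟨ cong (1 *_) (nCk+nC[k+1]≡[n+1]C[k+1] (suc n) 0) ⟨
  1 * (1 + suc n C 1)                ≡⟨ cong (λ x → 1 * (1 + x)) (trans (sym (ℕ.*-identityˡ (suc n C 1))) (C-absorption n zero)) ⟩
  1 * (1 + suc n * 1)                ≡⟨ ℕ.*-identityˡ (1 + suc n * 1) ⟩
  suc (suc n) * 1                    ∎
  where open ≡-Reasoning
C-absorption (suc n) (suc k) = begin
  (2 + k) * (suc (suc n) C suc (suc k))
    ≡⟨ cong ((2 + k) *_) (nCk+nC[k+1]≡[n+1]C[k+1] (suc n) (suc k)) ⟨
  (2 + k) * (a + b)
    ≡⟨ solve 3 (λ k a b → (con 2 :+ k) :* (a :+ b) := ((con 1 :+ k) :* a :+ a) :+ (con 2 :+ k) :* b) refl k a b ⟩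
  (suc k * a + a) + (2 + k) * b
    ≡⟨ cong₂ (λ x y → (x + a) + y) (C-absorption n k) (C-absorption n (suc k)) ⟩
  (suc n * (n C k) + a) + suc n * (n C suc k)
    ≡⟨ solve 4 (λ n x y a → ((con 1 :+ n) :* x :+ a) :+ (con 1 :+ n) :* y := (con 1 :+ n) :* (x :+ y) :+ a) refl n (n C k) (n C suc k) a ⟩
  suc n * (n C k + n C suc k) + a
    ≡⟨ cong (λ x → suc n * x + a) (nCk+nC[k+1]≡[n+1]C[k+1] n k) ⟩
  suc n * a + a
    ≡⟨ ℕ.+-comm (suc n * a) a ⟩
  suc (suc n) * a ∎
  where
  open ≡-Reasoning
  open ℕSolver.+-*-Solver using (solve; con; _:=_; _:+_; _:*_)
  a = suc n C suc k
  b = suc n C suc (suc k)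

centralBinomial : ℕ → ℕ
centralBinomial k = (2 * k) C k

-- Absorption leads from C(2k+2, k+1) to C(2k+1, k), which by symmetry is C(2k+1, k+1), and a second
-- absorption reaches C(2k, k).
centralBinomial-suc : ∀ k → suc k * centralBinomial (suc k) ≡ 2 * ((1 + 2 * k) * centralBinomial k)
centralBinomial-suc k = begin
  suc k * ((2 * suc k) C suc k)          ≡⟨ cong (λ m → suc k * (m C suc k)) (ℕ.*-suc 2 k) ⟩
  suc k * (suc (1 + 2 * k) C suc k)      ≡⟨ C-absorption (1 + 2 * k) k ⟩
  (2 + 2 * k) * ((1 + 2 * k) C k)        ≡⟨ cong ((2 + 2 * k) *_) (trans (nCk≡nC[n∸k] {k} {1 + 2 * k} (ℕ.m≤n⇒m≤1+n (ℕ.m≤m+n k (k + 0)))) (cong ((1 + 2 * k) C_) complement)) ⟩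
  (2 + 2 * k) * ((1 + 2 * k) C suc k)    ≡⟨ cong (_* ((1 + 2 * k) C suc k)) (ℕ.*-suc 2 k) ⟨
  (2 * suc k) * ((1 + 2 * k) C suc k)    ≡⟨ ℕ.*-assoc 2 (suc k) ((1 + 2 * k) C suc k) ⟩
  2 * (suc k * ((1 + 2 * k) C suc k))    ≡⟨ cong (2 *_) (C-absorption (2 * k) k) ⟩
  2 * ((1 + 2 * k) * centralBinomial k)  ∎
  where
  open ≡-Reasoning
  complement : 1 + 2 * k ∸ k ≡ suc k
  complement = trans (cong (_∸ k) (trans (cong (λ m → suc (k + m)) (ℕ.+-identityʳ k)) (sym (ℕ.+-suc k k)))) (ℕ.m+n∸m≡n k (suc k))

3+2n≤4*3^n : ∀ n → 3 + 2 * n ℕ.≤ 4 * 3 ^ n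
3+2n≤4*3^n zero    = s≤s (s≤s (s≤s z≤n))
3+2n≤4*3^n (suc n) = begin
  3 + 2 * suc n              ≡⟨ solve 1 (λ n → con 3 :+ con 2 :* (con 1 :+ n) := con 2 :+ (con 3 :+ con 2 :* n)) refl n ⟩
  2 + (3 + 2 * n)            ≤⟨ ℕ.+-mono-≤ (ℕ.≤-trans (ℕ.m≤m+n 2 6) (ℕ.*-monoʳ-≤ 8 (ℕ.m^n>0 3 n))) (3+2n≤4*3^n n) ⟩
  8 * 3 ^ n + 4 * 3 ^ n      ≡⟨ solve 1 (λ p → con 8 :* p :+ con 4 :* p := con 4 :* (con 3 :* p)) refl (3 ^ n) ⟩
  4 * 3 ^ suc n              ∎
  where
  open ℕ.≤-Reasoning
  open ℕSolver.+-*-Solver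

-- From n to n + 1 the left side grows by 3 + 2n and the right side by 4·3ⁿ. Equivalently (n+1)/3ⁿ ≤
-- 2/(n+1), the rate at which geometric errors are estimated.
[1+n]²≤2*3^n : ∀ n → suc n * suc n ℕ.≤ 2 * 3 ^ n
[1+n]²≤2*3^n zero    = s≤s z≤n
[1+n]²≤2*3^n (suc n) = begin
  suc (suc n) * suc (suc n)        ≡⟨ solve 1 (λ n → (con 2 :+ n) :* (con 2 :+ n) := (con 1 :+ n) :* (con 1 :+ n) :+ (con 3 :+ con 2 :* n)) refl n ⟩
  suc n * suc n + (3 + 2 * n)      ≤⟨ ℕ.+-mono-≤ ([1+n]²≤2*3^n n) (3+2n≤4*3^n n) ⟩
  2 * 3 ^ n + 4 * 3 ^ n            ≡⟨ solve 1 (λ p → con 2 :* p :+ con 4 :* p := con 2 :* (con 3 :* p)) refl (3 ^ n) ⟩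
  2 * 3 ^ suc n                    ∎
  where
  open ℕ.≤-Reasoning
  open ℕSolver.+-*-Solver

-- Integers and naturals inside the rationals

fromℤ-+ : ∀ a b → fromℤ (a ℤ.+ b) ≡ fromℤ a ℚ.+ fromℤ b
fromℤ-+ a b = ℚ.toℚᵘ-injective $
  ℚᵘ.≃-trans (ℚ.toℚᵘ-fromℚᵘ (ℚᵘ.mkℚᵘ (a ℤ.+ b) 0)) $ ℚᵘ.≃-sym $
  ℚᵘ.≃-trans (ℚ.toℚᵘ-homo-+ (fromℤ a) (fromℤ b)) $
  ℚᵘ.≃-trans (ℚᵘ.+-cong (ℚ.toℚᵘ-fromℚᵘ (ℚᵘ.mkℚᵘ a 0)) (ℚ.toℚᵘ-fromℚᵘ (ℚᵘ.mkℚᵘ b 0))) $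
  ℚᵘ.*≡* (solve 2 (λ a b → (a :* con 1ℤ :+ b :* con 1ℤ) :* con 1ℤ := (a :+ b) :* con 1ℤ) refl a b)
  where open ℤSolver.+-*-Solver

fromℤ-* : ∀ a b → fromℤ (a ℤ.* b) ≡ fromℤ a ℚ.* fromℤ b
fromℤ-* a b = ℚ.toℚᵘ-injective $
  ℚᵘ.≃-trans (ℚ.toℚᵘ-fromℚᵘ (ℚᵘ.mkℚᵘ (a ℤ.* b) 0)) $ ℚᵘ.≃-sym $
  ℚᵘ.≃-trans (ℚ.toℚᵘ-homo-* (fromℤ a) (fromℤ b)) $
  ℚᵘ.*-cong (ℚ.toℚᵘ-fromℚᵘ (ℚᵘ.mkℚᵘ a 0)) (ℚ.toℚᵘ-fromℚᵘ (ℚᵘ.mkℚᵘ b 0))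

-- Identities with a variable denominator are proved by multiplying it out: this removes the
-- fraction, and `*-cancelˡ-≡` afterwards removes the factor.
/-*-cancel : ∀ a d .{{_ : ℕ.NonZero d}} → (+ a / d) ℚ.* fromℕℚ d ≡ fromℕℚ a
/-*-cancel a (suc d) = ℚ.toℚᵘ-injective $
  ℚᵘ.≃-trans (ℚ.toℚᵘ-homo-* (+ a / suc d) (fromℕℚ (suc d))) $
  ℚᵘ.≃-trans (ℚᵘ.*-cong (ℚ.toℚᵘ-fromℚᵘ (ℚᵘ.mkℚᵘ (+ a) d)) (ℚ.toℚᵘ-fromℚᵘ (ℚᵘ.mkℚᵘ (+ suc d) 0))) $
  ℚᵘ.≃-sym $ ℚᵘ.≃-trans (ℚ.toℚᵘ-fromℚᵘ (ℚᵘ.mkℚᵘ (+ a) 0)) $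
  ℚᵘ.*≡* (solve 2 (λ a d → a :* (d :* con 1ℤ) := a :* d :* con 1ℤ) refl (+ a) (+ suc d))
  where open ℤSolver.+-*-Solver

open ℚSolver.+-*-Solver using (solve; con; _:=_; _:+_; _:*_; _:-_; :-_)

2ℚ 3ℚ 4ℚ 6ℚ 8ℚ 9ℚ ¼ : ℚ
2ℚ = fromℕℚ 2
3ℚ = fromℕℚ 3
4ℚ = fromℕℚ 4
6ℚ = fromℕℚ 6
8ℚ = fromℕℚ 8
9ℚ = fromℕℚ 9
¼ = + 1 / 4

fromℕℚ-+ : ∀ m n → fromℕℚ (m + n) ≡ fromℕℚ m ℚ.+ fromℕℚ n
fromℕℚ-+ m n = trans (cong fromℤ (ℤ.pos-+ m n)) (fromℤ-+ (+ m) (+ n))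

fromℕℚ-* : ∀ m n → fromℕℚ (m * n) ≡ fromℕℚ m ℚ.* fromℕℚ n
fromℕℚ-* m n = trans (cong fromℤ (ℤ.pos-* m n)) (fromℤ-* (+ m) (+ n))

fromℕℚ-suc : ∀ n → fromℕℚ (suc n) ≡ 1ℚ ℚ.+ fromℕℚ n
fromℕℚ-suc n = fromℕℚ-+ 1 n

fromℕℚ-^ : ∀ m n → fromℕℚ (m ^ n) ≡ fromℕℚ m ^ℚ n
fromℕℚ-^ m zero    = refl
fromℕℚ-^ m (suc n) = trans (fromℕℚ-* m (m ^ n)) (cong (fromℕℚ m ℚ.*_) (fromℕℚ-^ m n))

fromℕℚ-mono-< : ∀ {m n} → m ℕ.< n → fromℕℚ m ℚ.< fromℕℚ n
fromℕℚ-mono-< {m} {n} m<n = /-mono-< m 1 n 1 (ℕ.*-monoˡ-< 1 m<n)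

fromℕℚ-mono-≤ : ∀ {m n} → m ℕ.≤ n → fromℕℚ m ℚ.≤ fromℕℚ n
fromℕℚ-mono-≤ {m} {n} m≤n = /-mono-≤ m 1 n 1 (ℕ.*-monoˡ-≤ 1 m≤n)

0<fromℕℚ-suc : ∀ n → 0ℚ ℚ.< fromℕℚ (suc n)
0<fromℕℚ-suc n = fromℕℚ-mono-< {0} {suc n} (s≤s z≤n)

*-cancelˡ-≡ : ∀ {a b} c → 0ℚ ℚ.< c → c ℚ.* a ≡ c ℚ.* b → a ≡ b
*-cancelˡ-≡ {a} {b} c 0<c eq = begin
  a                       ≡⟨ ℚ.*-identityˡ a ⟨
  1ℚ ℚ.* a                ≡⟨ cong (ℚ._* a) (ℚ.*-inverseˡ c) ⟨
  ℚ.1/ c ℚ.* c ℚ.* a      ≡⟨ ℚ.*-assoc (ℚ.1/ c) c a ⟩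
  ℚ.1/ c ℚ.* (c ℚ.* a)    ≡⟨ cong (ℚ.1/ c ℚ.*_) eq ⟩
  ℚ.1/ c ℚ.* (c ℚ.* b)    ≡⟨ ℚ.*-assoc (ℚ.1/ c) c b ⟨
  ℚ.1/ c ℚ.* c ℚ.* b      ≡⟨ cong (ℚ._* b) (ℚ.*-inverseˡ c) ⟩
  1ℚ ℚ.* b                ≡⟨ ℚ.*-identityˡ b ⟩
  b                       ∎
  where
  open ≡-Reasoning
  instance
    c>0 = ℚ.positive 0<c
    c≢0 = ℚ.pos⇒nonZero c

-- Finite sums

Σ≤-cong-≤ : ∀ n {f g : ℕ → ℚ} → (∀ k → k ℕ.≤ n → f k ≡ g k) → Σ≤ n f ≡ Σ≤ n g
Σ≤-cong-≤ zero    eq = eq 0 z≤n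
Σ≤-cong-≤ (suc n) eq = cong₂ ℚ._+_ (Σ≤-cong-≤ n (λ k k≤n → eq k (ℕ.m≤n⇒m≤1+n k≤n))) (eq (suc n) ℕ.≤-refl)

Σ≤-cong : ∀ n {f g : ℕ → ℚ} → f ≗ g → Σ≤ n f ≡ Σ≤ n g
Σ≤-cong n eq = Σ≤-cong-≤ n (λ k _ → eq k)

Σ≤-+ : ∀ n (f g : ℕ → ℚ) → Σ≤ n (λ k → f k ℚ.+ g k) ≡ Σ≤ n f ℚ.+ Σ≤ n g
Σ≤-+ zero    f g = refl
Σ≤-+ (suc n) f g = trans (cong (ℚ._+ (f (suc n) ℚ.+ g (suc n))) (Σ≤-+ n f g))
  (solve 4 (λ a b c d → a :+ b :+ (c :+ d) := a :+ c :+ (b :+ d)) refl (Σ≤ n f) (Σ≤ n g) (f (suc n)) (g (suc n)))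

Σ≤-*ˡ : ∀ n a (f : ℕ → ℚ) → Σ≤ n (λ k → a ℚ.* f k) ≡ a ℚ.* Σ≤ n f
Σ≤-*ˡ zero    a f = refl
Σ≤-*ˡ (suc n) a f = trans (cong (ℚ._+ a ℚ.* f (suc n)) (Σ≤-*ˡ n a f)) (sym (ℚ.*-distribˡ-+ a (Σ≤ n f) (f (suc n))))

Σ≤-peel : ∀ n (f : ℕ → ℚ) → Σ≤ (suc n) f ≡ f 0 ℚ.+ Σ≤ n (f ∘ suc)
Σ≤-peel zero    f = refl
Σ≤-peel (suc n) f = trans (cong (ℚ._+ f (2 + n)) (Σ≤-peel n f)) (ℚ.+-assoc (f 0) (Σ≤ n (f ∘ suc)) (f (2 + n)))

-- The semiring of formal power series

infixl 6 _+ₛ_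

_+ₛ_ : Series → Series → Series
(f +ₛ g) n = f n ℚ.+ g n

0ₛ 1ₛ : Series
0ₛ = poly []
1ₛ = poly (+ 1 ∷ [])

*ₛ-cong : ∀ {f f′ g g′} → f ≗ f′ → g ≗ g′ → f *ₛ g ≗ f′ *ₛ g′
*ₛ-cong f≗ g≗ n = Σ≤-cong n (λ k → cong₂ ℚ._*_ (f≗ k) (g≗ (n ∸ k)))

-- Reads f as f 0 + x·(`f ∘ suc`). With its mirror image `*ₛ-sucʳ` it proves the semiring laws by
-- induction on the coefficient, for all series at once since the factors get shifted.
*ₛ-suc : ∀ f g n → (f *ₛ g) (suc n) ≡ f 0 ℚ.* g (suc n) ℚ.+ ((f ∘ suc) *ₛ g) n
*ₛ-suc f g n = Σ≤-peel n _

*ₛ-sucʳ : ∀ f g n → (f *ₛ g) (suc n) ≡ (f *ₛ (g ∘ suc)) n ℚ.+ f (suc n) ℚ.* g 0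
*ₛ-sucʳ f g zero    = refl
*ₛ-sucʳ f g (suc n) = begin
  (f *ₛ g) (2 + n)
    ≡⟨ *ₛ-suc f g (suc n) ⟩
  f 0 ℚ.* g (2 + n) ℚ.+ ((f ∘ suc) *ₛ g) (suc n)
    ≡⟨ cong (f 0 ℚ.* g (2 + n) ℚ.+_) (*ₛ-sucʳ (f ∘ suc) g n) ⟩
  f 0 ℚ.* g (2 + n) ℚ.+ (((f ∘ suc) *ₛ (g ∘ suc)) n ℚ.+ f (2 + n) ℚ.* g 0)
    ≡⟨ ℚ.+-assoc (f 0 ℚ.* g (2 + n)) _ _ ⟨
  f 0 ℚ.* g (2 + n) ℚ.+ ((f ∘ suc) *ₛ (g ∘ suc)) n ℚ.+ f (2 + n) ℚ.* g 0
    ≡⟨ cong (ℚ._+ f (2 + n) ℚ.* g 0) (*ₛ-suc f (g ∘ suc) n) ⟨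
  (f *ₛ (g ∘ suc)) (suc n) ℚ.+ f (2 + n) ℚ.* g 0 ∎
  where open ≡-Reasoning

*ₛ-comm : ∀ f g → f *ₛ g ≗ g *ₛ f
*ₛ-comm f g zero    = ℚ.*-comm (f 0) (g 0)
*ₛ-comm f g (suc n) = begin
  (f *ₛ g) (suc n)                                  ≡⟨ *ₛ-suc f g n ⟩
  f 0 ℚ.* g (suc n) ℚ.+ ((f ∘ suc) *ₛ g) n          ≡⟨ ℚ.+-comm (f 0 ℚ.* g (suc n)) (((f ∘ suc) *ₛ g) n) ⟩
  ((f ∘ suc) *ₛ g) n ℚ.+ f 0 ℚ.* g (suc n)          ≡⟨ cong₂ ℚ._+_ (*ₛ-comm (f ∘ suc) g n) (ℚ.*-comm (f 0) (g (suc n))) ⟩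
  (g *ₛ (f ∘ suc)) n ℚ.+ g (suc n) ℚ.* f 0          ≡⟨ *ₛ-sucʳ g f n ⟨
  (g *ₛ f) (suc n)                                  ∎
  where open ≡-Reasoning

*ₛ-distribʳ : ∀ h f g → (f +ₛ g) *ₛ h ≗ f *ₛ h +ₛ g *ₛ h
*ₛ-distribʳ h f g n = trans (Σ≤-cong n (λ k → ℚ.*-distribʳ-+ (h (n ∸ k)) (f k) (g k))) (Σ≤-+ n _ _)

*ₛ-scaleˡ : ∀ a f g → (λ k → a ℚ.* f k) *ₛ g ≗ (λ k → a ℚ.* (f *ₛ g) k)
*ₛ-scaleˡ a f g n = trans (Σ≤-cong n (λ k → ℚ.*-assoc a (f k) (g (n ∸ k)))) (Σ≤-*ˡ n a _)

*ₛ-assoc : ∀ f g h → (f *ₛ g) *ₛ h ≗ f *ₛ (g *ₛ h)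
*ₛ-assoc f g h zero    = ℚ.*-assoc (f 0) (g 0) (h 0)
*ₛ-assoc f g h (suc n) = begin
  ((f *ₛ g) *ₛ h) (suc n)
    ≡⟨ *ₛ-suc (f *ₛ g) h n ⟩
  f 0 ℚ.* g 0 ℚ.* h (suc n) ℚ.+ (((f *ₛ g) ∘ suc) *ₛ h) n
    ≡⟨ cong (f 0 ℚ.* g 0 ℚ.* h (suc n) ℚ.+_) (*ₛ-cong {g = h} (*ₛ-suc f g) (λ _ → refl) n) ⟩
  f 0 ℚ.* g 0 ℚ.* h (suc n) ℚ.+ (((λ k → f 0 ℚ.* g (suc k)) +ₛ (f ∘ suc) *ₛ g) *ₛ h) n
    ≡⟨ cong (f 0 ℚ.* g 0 ℚ.* h (suc n) ℚ.+_) (trans (*ₛ-distribʳ h (λ k → f 0 ℚ.* g (suc k)) ((f ∘ suc) *ₛ g) n)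
         (cong₂ ℚ._+_ (*ₛ-scaleˡ (f 0) (g ∘ suc) h n) (*ₛ-assoc (f ∘ suc) g h n))) ⟩
  f 0 ℚ.* g 0 ℚ.* h (suc n) ℚ.+ (f 0 ℚ.* ((g ∘ suc) *ₛ h) n ℚ.+ ((f ∘ suc) *ₛ (g *ₛ h)) n)
    ≡⟨ solve 5 (λ a b c d e → a :* b :* c :+ (a :* d :+ e) := a :* (b :* c :+ d) :+ e) refl
         (f 0) (g 0) (h (suc n)) (((g ∘ suc) *ₛ h) n) (((f ∘ suc) *ₛ (g *ₛ h)) n) ⟩
  f 0 ℚ.* (g 0 ℚ.* h (suc n) ℚ.+ ((g ∘ suc) *ₛ h) n) ℚ.+ ((f ∘ suc) *ₛ (g *ₛ h)) n
    ≡⟨ cong (λ x → f 0 ℚ.* x ℚ.+ ((f ∘ suc) *ₛ (g *ₛ h)) n) (*ₛ-suc g h n) ⟨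
  f 0 ℚ.* (g *ₛ h) (suc n) ℚ.+ ((f ∘ suc) *ₛ (g *ₛ h)) n
    ≡⟨ *ₛ-suc f (g *ₛ h) n ⟨
  (f *ₛ (g *ₛ h)) (suc n) ∎
  where
  open ≡-Reasoning

*ₛ-zeroˡ : ∀ f → 0ₛ *ₛ f ≗ 0ₛ
*ₛ-zeroˡ f zero    = ℚ.*-zeroˡ (f 0)
*ₛ-zeroˡ f (suc n) = trans (*ₛ-suc 0ₛ f n) (cong₂ ℚ._+_ (ℚ.*-zeroˡ (f (suc n))) (*ₛ-zeroˡ f n))

poly-*ₛ : ∀ a as f n → (poly (a ∷ as) *ₛ f) (suc n) ≡ fromℤ a ℚ.* f (suc n) ℚ.+ (poly as *ₛ f) n
poly-*ₛ a as f n = *ₛ-suc (poly (a ∷ as)) f n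

*ₛ-identityˡ : ∀ f → 1ₛ *ₛ f ≗ f
*ₛ-identityˡ f zero    = ℚ.*-identityˡ (f 0)
*ₛ-identityˡ f (suc n) = trans (poly-*ₛ (+ 1) [] f n)
  (trans (cong₂ ℚ._+_ (ℚ.*-identityˡ (f (suc n))) (*ₛ-zeroˡ f n)) (ℚ.+-identityʳ (f (suc n))))

seriesSemiring : CommutativeSemiring 0ℓ 0ℓ
seriesSemiring = record
  { Carrier = Series ; _≈_ = _≗_ ; _+_ = _+ₛ_ ; _*_ = _*ₛ_ ; 0# = 0ₛ ; 1# = 1ₛ
  ; isCommutativeSemiring = isCommutativeSemiringˡ record
    { +-isCommutativeMonoid = record
      { isMonoid = record
        { isSemigroup = record
          { isMagma = record
            { isEquivalence = isEq
            ; ∙-cong        = λ f≗ g≗ n → cong₂ ℚ._+_ (f≗ n) (g≗ n)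
            }
          ; assoc = λ f g h n → ℚ.+-assoc (f n) (g n) (h n)
          }
        ; identity = (λ f n → ℚ.+-identityˡ (f n)) , (λ f n → ℚ.+-identityʳ (f n))
        }
      ; comm = λ f g n → ℚ.+-comm (f n) (g n)
      }
    ; *-isCommutativeMonoid = record
      { isMonoid = record
        { isSemigroup = record
          { isMagma = record { isEquivalence = isEq ; ∙-cong = *ₛ-cong }
          ; assoc   = *ₛ-assoc
          }
        ; identity = *ₛ-identityˡ , λ f n → trans (*ₛ-comm f 1ₛ n) (*ₛ-identityˡ f n)
        }
      ; comm = *ₛ-comm
      }
    ; distribʳ = *ₛ-distribʳ
    ; zeroˡ    = *ₛ-zeroˡ
    }
  }
  where isEq = Setoid.isEquivalence (ℕ →-setoid ℚ)

module 𝕊 where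
  open CommutativeSemiring seriesSemiring public hiding (_+_; _*_; refl; sym; trans)
  open SemiringSolver seriesSemiring public using () renaming (solve to solveₛ; _:=_ to _⊜_; _:+_ to _⊕_; _:*_ to _⊗_)
  open import Relation.Binary.Reasoning.Setoid setoid public

-- The Euler operator x d/dx.
θ : Series → Series
θ f n = fromℕℚ n ℚ.* f n

-- In each summand the factor n splits as k + (n - k).
θ-* : ∀ f g → θ (f *ₛ g) ≗ θ f *ₛ g +ₛ f *ₛ θ g
θ-* f g n = begin
  fromℕℚ n ℚ.* (f *ₛ g) n
    ≡⟨ Σ≤-*ˡ n (fromℕℚ n) _ ⟨
  Σ≤ n (λ k → fromℕℚ n ℚ.* (f k ℚ.* g (n ∸ k)))
    ≡⟨ Σ≤-cong-≤ n (λ k k≤n → trans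
         (cong (ℚ._* (f k ℚ.* g (n ∸ k))) (trans (cong fromℕℚ (sym (ℕ.m+[n∸m]≡n k≤n))) (fromℕℚ-+ k (n ∸ k))))
         (solve 4 (λ a b c d → (a :+ b) :* (c :* d) := a :* c :* d :+ c :* (b :* d)) refl
           (fromℕℚ k) (fromℕℚ (n ∸ k)) (f k) (g (n ∸ k)))) ⟩
  Σ≤ n (λ k → fromℕℚ k ℚ.* f k ℚ.* g (n ∸ k) ℚ.+ f k ℚ.* (fromℕℚ (n ∸ k) ℚ.* g (n ∸ k)))
    ≡⟨ Σ≤-+ n _ _ ⟩
  (θ f *ₛ g) n ℚ.+ (f *ₛ θ g) n ∎
  where
  open ≡-Reasoning

-- Characteristic 0: for n > 0 the factor n cancels from n · f n = 0. This is the source of all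
-- uniqueness statements for series here.
θ-constant : ∀ f → θ f ≗ 0ₛ → f 0 ≡ 1ℚ → f ≗ 1ₛ
θ-constant f θf≗0 f₀ zero    = f₀
θ-constant f θf≗0 f₀ (suc n) = *-cancelˡ-≡ (fromℕℚ (suc n)) (0<fromℕℚ-suc n)
  (trans (θf≗0 (suc n)) (sym (ℚ.*-zeroʳ (fromℕℚ (suc n)))))

*-zero : ∀ f g → f ≗ 0ₛ → g *ₛ f ≗ 0ₛ
*-zero f g f≗0 n = trans (*ₛ-cong {g} {g} (λ _ → refl) f≗0 n) (𝕊.zeroʳ g n)

-- θ (q f²) = f² (θ q + 2 p) when q θ f = p f.
inverse-square : ∀ f q p → q *ₛ θ f ≗ p *ₛ f → θ q +ₛ (p +ₛ p) ≗ 0ₛ →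
                 f 0 ≡ 1ℚ → q 0 ≡ 1ℚ → f *ₛ f *ₛ q ≗ 1ₛ
inverse-square f q p ode θq f₀ q₀ = θ-constant (f *ₛ f *ₛ q) flat′ constant
  where
  constant : f 0 ℚ.* f 0 ℚ.* q 0 ≡ 1ℚ
  constant = cong₂ (λ a b → a ℚ.* a ℚ.* b) f₀ q₀
  flat′ : θ (f *ₛ f *ₛ q) ≗ 0ₛ
  flat′ = begin
    θ (f *ₛ f *ₛ q)
      ≈⟨ θ-* (f *ₛ f) q ⟩
    θ (f *ₛ f) *ₛ q +ₛ f *ₛ f *ₛ θ q
      ≈⟨ +-congʳ {f *ₛ f *ₛ θ q} (*-congʳ {q} (θ-* f f)) ⟩
    (θ f *ₛ f +ₛ f *ₛ θ f) *ₛ q +ₛ f *ₛ f *ₛ θ q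
      ≈⟨ solveₛ 4 (λ f f′ q q′ → (f′ ⊗ f ⊕ f ⊗ f′) ⊗ q ⊕ f ⊗ f ⊗ q′ ⊜ f ⊗ (q ⊗ f′) ⊕ f ⊗ (q ⊗ f′) ⊕ f ⊗ f ⊗ q′)
           (λ _ → refl) f (θ f) q (θ q) ⟩
    f *ₛ (q *ₛ θ f) +ₛ f *ₛ (q *ₛ θ f) +ₛ f *ₛ f *ₛ θ q
      ≈⟨ +-congʳ {f *ₛ f *ₛ θ q} (+-cong (*-congˡ {f} ode) (*-congˡ {f} ode)) ⟩
    f *ₛ (p *ₛ f) +ₛ f *ₛ (p *ₛ f) +ₛ f *ₛ f *ₛ θ q
      ≈⟨ solveₛ 3 (λ f p q′ → f ⊗ (p ⊗ f) ⊕ f ⊗ (p ⊗ f) ⊕ f ⊗ f ⊗ q′ ⊜ f ⊗ f ⊗ (q′ ⊕ (p ⊕ p)))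
           (λ _ → refl) f p (θ q) ⟩
    f *ₛ f *ₛ (θ q +ₛ (p +ₛ p))
      ≈⟨ *-zero _ (f *ₛ f) θq ⟩
    0ₛ ∎
    where open 𝕊

-- θ(f²) = 2 f θ f vanishes, and since f is its own inverse, θ f = f (f θ f) vanishes too.
square-root-of-1 : ∀ f → f *ₛ f ≗ 1ₛ → f 0 ≡ 1ℚ → f ≗ 1ₛ
square-root-of-1 f f² f₀ = θ-constant f θf f₀
  where
  open 𝕊
  θ1 : θ 1ₛ ≗ 0ₛ
  θ1 zero    = refl
  θ1 (suc n) = ℚ.*-zeroʳ (fromℕℚ (suc n))
  2fθf : f *ₛ θ f +ₛ f *ₛ θ f ≗ 0ₛ
  2fθf = begin
    f *ₛ θ f +ₛ f *ₛ θ f  ≈⟨ +-congʳ {f *ₛ θ f} (*-comm f (θ f)) ⟩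
    θ f *ₛ f +ₛ f *ₛ θ f  ≈⟨ θ-* f f ⟨
    θ (f *ₛ f)            ≈⟨ (λ n → cong (fromℕℚ n ℚ.*_) (f² n)) ⟩
    θ 1ₛ                  ≈⟨ θ1 ⟩
    0ₛ                    ∎
  halve : ∀ {a} → a ℚ.+ a ≡ 0ℚ → a ≡ 0ℚ
  halve {a} a+a≡0 = trans (sym (½+½ a)) (trans (sym (ℚ.*-distribˡ-+ ½ a a)) (cong (½ ℚ.*_) a+a≡0))
  θf : θ f ≗ 0ₛ
  θf = begin
    θ f              ≈⟨ *-identityˡ (θ f) ⟨
    1ₛ *ₛ θ f        ≈⟨ *-congʳ {θ f} f² ⟨
    f *ₛ f *ₛ θ f    ≈⟨ *-assoc f f (θ f) ⟩
    f *ₛ (f *ₛ θ f)  ≈⟨ *-zero _ f (λ n → halve {(f *ₛ θ f) n} (2fθf n)) ⟩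
    0ₛ               ∎

-- The square of fgq is (f²q)(g²q) = 1, hence fgq = 1 and f = f (g²q) = g (fgq) = g.
inverse-square-unique : ∀ f g q → f *ₛ f *ₛ q ≗ 1ₛ → g *ₛ g *ₛ q ≗ 1ₛ → f 0 ≡ 1ℚ → g 0 ≡ 1ℚ → q 0 ≡ 1ℚ → f ≗ g
inverse-square-unique f g q ffq ggq f₀ g₀ q₀ = begin
  f                      ≈⟨ *-identityʳ f ⟨
  f *ₛ 1ₛ                ≈⟨ *-congˡ {f} ggq ⟨
  f *ₛ (g *ₛ g *ₛ q)     ≈⟨ solveₛ 3 (λ f g q → f ⊗ (g ⊗ g ⊗ q) ⊜ g ⊗ (f ⊗ g ⊗ q)) (λ _ → refl) f g q ⟩
  g *ₛ (f *ₛ g *ₛ q)     ≈⟨ *-congˡ {g} (square-root-of-1 (f *ₛ g *ₛ q) square constant) ⟩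
  g *ₛ 1ₛ                ≈⟨ *-identityʳ g ⟩
  g                      ∎
  where
  open 𝕊
  constant : f 0 ℚ.* g 0 ℚ.* q 0 ≡ 1ℚ
  constant = trans (cong (ℚ._* q 0) (cong₂ ℚ._*_ f₀ g₀)) (cong (1ℚ ℚ.*_) q₀)
  square : f *ₛ g *ₛ q *ₛ (f *ₛ g *ₛ q) ≗ 1ₛ
  square = begin
    f *ₛ g *ₛ q *ₛ (f *ₛ g *ₛ q)   ≈⟨ solveₛ 3 (λ f g q → f ⊗ g ⊗ q ⊗ (f ⊗ g ⊗ q) ⊜ f ⊗ f ⊗ q ⊗ (g ⊗ g ⊗ q)) (λ _ → refl) f g q ⟩
    f *ₛ f *ₛ q *ₛ (g *ₛ g *ₛ q)   ≈⟨ *-cong ffq ggq ⟩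
    1ₛ *ₛ 1ₛ                       ≈⟨ *-identityˡ 1ₛ ⟩
    1ₛ                             ∎

-- Inverses and square roots

-- Stated for any vectors listing g n, ..., g 0, because it serves both `1/ₛ-coeffs` and, in
-- `√ₛ-square`, the lists without the constant term.
dot-coeffs : ∀ (g : Series) (gs : ∀ n → Vec ℚ (suc n)) →
             gs 0 ≡ g 0 ∷ [] → (∀ n → gs (suc n) ≡ g (suc n) ∷ gs n) →
             ∀ h n → dot (Vec.tabulate (h ∘ toℕ)) (gs n) ≡ (h *ₛ g) n
dot-coeffs g gs g₀ gₛ h zero    rewrite g₀   = ℚ.+-identityʳ (h 0 ℚ.* g 0)
dot-coeffs g gs g₀ gₛ h (suc n) rewrite gₛ n =
  trans (cong (h 0 ℚ.* g (suc n) ℚ.+_) (dot-coeffs g gs g₀ gₛ (h ∘ suc) n)) (sym (*ₛ-suc h g n))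

*ₛ-1/ₛ : ∀ f .{{_ : ℚ.NonZero (f 0)}} → f *ₛ 1/ₛ f ≗ 1ₛ
*ₛ-1/ₛ f zero    = ℚ.*-inverseʳ (f 0)
*ₛ-1/ₛ f (suc n) = begin
  (f *ₛ g) (suc n)                            ≡⟨ *ₛ-suc f g n ⟩
  f 0 ℚ.* (ℚ.- d ℚ.* ℚ.1/ f 0) ℚ.+ ((f ∘ suc) *ₛ g) n
    ≡⟨ cong (f 0 ℚ.* (ℚ.- d ℚ.* ℚ.1/ f 0) ℚ.+_)
         (dot-coeffs g (1/ₛ-coeffs f) refl (λ _ → refl) (f ∘ suc) n) ⟨
  f 0 ℚ.* (ℚ.- d ℚ.* ℚ.1/ f 0) ℚ.+ d
    ≡⟨ solve 3 (λ a b d → a :* (:- d :* b) :+ d := d :- (a :* b) :* d) refl (f 0) (ℚ.1/ f 0) d ⟩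
  d ℚ.- f 0 ℚ.* ℚ.1/ f 0 ℚ.* d
    ≡⟨ cong (λ e → d ℚ.- e ℚ.* d) (ℚ.*-inverseʳ (f 0)) ⟩
  d ℚ.- 1ℚ ℚ.* d
    ≡⟨ solve 1 (λ d → d :- con 1ℚ :* d := con 0ℚ) refl d ⟩
  0ℚ ∎
  where
  open ≡-Reasoning
  g = 1/ₛ f
  d = dot (Vec.tabulate (f ∘ suc ∘ toℕ)) (1/ₛ-coeffs f n)

1/ₛ-unique : ∀ f g .{{_ : ℚ.NonZero (f 0)}} → g *ₛ f ≗ 1ₛ → 1/ₛ f ≗ g
1/ₛ-unique f g gf = begin
  1/ₛ f               ≈⟨ *-identityˡ (1/ₛ f) ⟨
  1ₛ *ₛ 1/ₛ f         ≈⟨ *-congʳ {1/ₛ f} gf ⟨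
  g *ₛ f *ₛ 1/ₛ f     ≈⟨ *-assoc g f (1/ₛ f) ⟩
  g *ₛ (f *ₛ 1/ₛ f)   ≈⟨ *-congˡ {g} (*ₛ-1/ₛ f) ⟩
  g *ₛ 1ₛ             ≈⟨ *-identityʳ g ⟩
  g                   ∎
  where open 𝕊

tabulate-∷ʳ : ∀ n (g : Series) → Vec.tabulate {n = n} (g ∘ toℕ) ∷ʳ g n ≡ Vec.tabulate {n = suc n} (g ∘ toℕ)
tabulate-∷ʳ zero    g = refl
tabulate-∷ʳ (suc n) g = cong (g 0 ∷_) (tabulate-∷ʳ n (g ∘ suc))

dot-comm : ∀ {n} (u v : Vec ℚ n) → dot u v ≡ dot v u
dot-comm []      []      = refl
dot-comm (a ∷ u) (b ∷ v) = cong₂ ℚ._+_ (ℚ.*-comm a b) (dot-comm u v)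

√ₛ-square : ∀ f → f 0 ≡ 1ℚ → √ₛ f *ₛ √ₛ f ≗ f
√ₛ-square f f₀ zero          = sym f₀
√ₛ-square f f₀ (suc zero)    = begin
  1ℚ ℚ.* (½ ℚ.* (f 1 ℚ.- 0ℚ)) ℚ.+ ½ ℚ.* (f 1 ℚ.- 0ℚ) ℚ.* 1ℚ
    ≡⟨ solve 2 (λ h x → con 1ℚ :* (h :* (x :- con 0ℚ)) :+ h :* (x :- con 0ℚ) :* con 1ℚ := h :* x :+ h :* x) refl ½ (f 1) ⟩
  ½ ℚ.* f 1 ℚ.+ ½ ℚ.* f 1
    ≡⟨ ½+½ (f 1) ⟩
  f 1 ∎
  where
  open ≡-Reasoning
√ₛ-square f f₀ (suc (suc n)) = begin
  (g *ₛ g) (2 + n)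
    ≡⟨ *ₛ-suc g g (suc n) ⟩
  1ℚ ℚ.* g (2 + n) ℚ.+ (g′ *ₛ g) (suc n)
    ≡⟨ cong (1ℚ ℚ.* g (2 + n) ℚ.+_) (*ₛ-sucʳ g′ g n) ⟩
  1ℚ ℚ.* g (2 + n) ℚ.+ ((g′ *ₛ g′) n ℚ.+ g (2 + n) ℚ.* 1ℚ)
    ≡⟨ cong (λ x → 1ℚ ℚ.* g (2 + n) ℚ.+ (x ℚ.+ g (2 + n) ℚ.* 1ℚ)) middle ⟨
  1ℚ ℚ.* (½ ℚ.* (f (2 + n) ℚ.- d)) ℚ.+ (d ℚ.+ ½ ℚ.* (f (2 + n) ℚ.- d) ℚ.* 1ℚ)
    ≡⟨ solve 3 (λ h x d → con 1ℚ :* (h :* (x :- d)) :+ (d :+ h :* (x :- d) :* con 1ℚ) := (h :* (x :- d) :+ h :* (x :- d)) :+ d) refl ½ (f (2 + n)) d ⟩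
  (½ ℚ.* (f (2 + n) ℚ.- d) ℚ.+ ½ ℚ.* (f (2 + n) ℚ.- d)) ℚ.+ d
    ≡⟨ cong (ℚ._+ d) (½+½ (f (2 + n) ℚ.- d)) ⟩
  f (2 + n) ℚ.- d ℚ.+ d
    ≡⟨ solve 2 (λ x d → x :- d :+ d := x) refl (f (2 + n)) d ⟩
  f (2 + n) ∎
  where
  open ≡-Reasoning
  g = √ₛ f
  g′ = g ∘ suc
  gs : ∀ n → Vec ℚ (suc n)
  -- `init` drops the constant term: what is left are g (n+1), ..., g 1, the coefficients of `g′` in
  -- descending order.
  gs n = Vec.init (√ₛ-coeffs f (suc n))
  d = dot (gs n) (Vec.reverse (gs n))
  reversed : ∀ n → Vec.reverse (gs n) ≡ Vec.tabulate (g′ ∘ toℕ)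
  reversed zero    = refl
  reversed (suc n) = trans (Vec.reverse-∷ (g (2 + n)) (gs n))
    (trans (cong (_∷ʳ g (2 + n)) (reversed n)) (tabulate-∷ʳ (suc n) g′))
  middle : d ≡ (g′ *ₛ g′) n
  middle = trans (dot-comm (gs n) (Vec.reverse (gs n))) (trans (cong (λ v → dot v (gs n)) (reversed n))
    (dot-coeffs g′ gs refl (λ _ → refl) g′ n))

-- Central trinomial coefficients

1+x+x² : Series
1+x+x² = poly (+ 1 ∷ + 1 ∷ + 1 ∷ [])

-- (1 + x + x²)ⁿ = xⁿ (x⁻¹ + 1 + x)ⁿ, whence the index shift by n.
1+x+x²-^ : ∀ n m → (1+x+x² ^ₛ n) m ≡ fromℕℚ (walks n (+ m ℤ.- + n))
1+x+x²-^ zero    zero    = refl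
1+x+x²-^ zero    (suc m) = refl
1+x+x²-^ (suc n) m = trans (coefficient m) (sym (trans
  (fromℕℚ-+ (walks n (+ m ℤ.- + suc n ℤ.- 1ℤ)) _)
  (cong (fromℕℚ (walks n (+ m ℤ.- + suc n ℤ.- 1ℤ)) ℚ.+_)
     (trans (fromℕℚ-+ (walks n (+ m ℤ.- + suc n ℤ.+ 1ℤ)) (walks n (+ m ℤ.- + suc n)))
       (cong (λ j → fromℕℚ (walks n j) ℚ.+ fromℕℚ (walks n (+ m ℤ.- + suc n))) (j-[1+n]+1≡j-n (+ m) (+ n)))))))
  where
  f = 1+x+x² ^ₛ n
  0+ : ∀ {k} → k ≡ 0 → ∀ x → fromℕℚ k ℚ.+ x ≡ x
  0+ refl x = ℚ.+-identityˡ x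
  coefficient : ∀ m → (1+x+x² *ₛ f) m ≡ fromℕℚ (walks n (+ m ℤ.- + suc n ℤ.- 1ℤ)) ℚ.+
                      (fromℕℚ (walks n (+ m ℤ.- + n)) ℚ.+ fromℕℚ (walks n (+ m ℤ.- + suc n)))
  -- In degrees 0 and 1 the product lacks two summands and one; the corresponding walks would end
  -- below -n and there are none.
  coefficient zero = begin
    1ℚ ℚ.* f 0
      ≡⟨ trans (ℚ.*-identityˡ (f 0)) (1+x+x²-^ n 0) ⟩
    fromℕℚ (walks n (0ℤ ℤ.- + n))
      ≡⟨ ℚ.+-identityʳ _ ⟨
    fromℕℚ (walks n (0ℤ ℤ.- + n)) ℚ.+ 0ℚ
      ≡⟨ cong (λ k → fromℕℚ (walks n (0ℤ ℤ.- + n)) ℚ.+ fromℕℚ k) (walks-below₁ n) ⟨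
    fromℕℚ (walks n (0ℤ ℤ.- + n)) ℚ.+ fromℕℚ (walks n (0ℤ ℤ.- + suc n))
      ≡⟨ 0+ (walks-below₂ n) _ ⟨
    fromℕℚ (walks n (0ℤ ℤ.- + suc n ℤ.- 1ℤ)) ℚ.+ (fromℕℚ (walks n (0ℤ ℤ.- + n)) ℚ.+ fromℕℚ (walks n (0ℤ ℤ.- + suc n))) ∎
    where open ≡-Reasoning
  coefficient (suc zero) = begin
    1ℚ ℚ.* f 1 ℚ.+ 1ℚ ℚ.* f 0
      ≡⟨ solve 2 (λ a b → con 1ℚ :* b :+ con 1ℚ :* a := b :+ a) refl (f 0) (f 1) ⟩
    f 1 ℚ.+ f 0
      ≡⟨ cong₂ ℚ._+_ (1+x+x²-^ n 1) (trans (1+x+x²-^ n 0) (cong (fromℕℚ ∘ walks n) (sym ([1+j]-[1+n]≡j-n 0ℤ (+ n))))) ⟩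
    fromℕℚ (walks n (1ℤ ℤ.- + n)) ℚ.+ fromℕℚ (walks n (1ℤ ℤ.- + suc n))
      ≡⟨ 0+ (trans (cong (walks n) ([1+j]-[1+n]-1≡j-[1+n] 0ℤ (+ n))) (walks-below₁ n)) _ ⟨
    fromℕℚ (walks n (1ℤ ℤ.- + suc n ℤ.- 1ℤ)) ℚ.+ (fromℕℚ (walks n (1ℤ ℤ.- + n)) ℚ.+ fromℕℚ (walks n (1ℤ ℤ.- + suc n))) ∎
    where open ≡-Reasoning
  coefficient (suc (suc m)) = begin
    (1+x+x² *ₛ f) (2 + m)
      ≡⟨ trans (poly-*ₛ (+ 1) (+ 1 ∷ + 1 ∷ []) f (suc m))
           (cong (1ℚ ℚ.* f (2 + m) ℚ.+_) (trans (poly-*ₛ (+ 1) (+ 1 ∷ []) f m) (cong (1ℚ ℚ.* f (suc m) ℚ.+_) (*ₛ-identityˡ f m)))) ⟩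
    1ℚ ℚ.* f (2 + m) ℚ.+ (1ℚ ℚ.* f (suc m) ℚ.+ f m)
      ≡⟨ solve 3 (λ a b c → con 1ℚ :* c :+ (con 1ℚ :* b :+ a) := a :+ (c :+ b)) refl (f m) (f (suc m)) (f (2 + m)) ⟩
    f m ℚ.+ (f (2 + m) ℚ.+ f (suc m))
      ≡⟨ cong₂ ℚ._+_ (trans (1+x+x²-^ n m) (cong (fromℕℚ ∘ walks n) (sym (trans ([1+j]-[1+n]-1≡j-[1+n] (+ suc m) (+ n)) ([1+j]-[1+n]≡j-n (+ m) (+ n))))))
           (cong₂ ℚ._+_ (1+x+x²-^ n (2 + m)) (trans (1+x+x²-^ n (suc m)) (cong (fromℕℚ ∘ walks n) (sym ([1+j]-[1+n]≡j-n (+ suc m) (+ n)))))) ⟩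
    fromℕℚ (walks n (+ (2 + m) ℤ.- + suc n ℤ.- 1ℤ)) ℚ.+
      (fromℕℚ (walks n (+ (2 + m) ℤ.- + n)) ℚ.+ fromℕℚ (walks n (+ (2 + m) ℤ.- + suc n))) ∎
    where open ≡-Reasoning

T-walks : ∀ n → T n ≡ fromℕℚ (walks n 0ℤ)
T-walks n = trans (1+x+x²-^ n n) (cong (fromℕℚ ∘ walks n) (ℤ.+-inverseʳ (+ n)))

-- The coefficients from degree 2 on of (1-2x-3x²) θ f = (x+3x²) f, the equation of 1/√(1-2x-3x²).
ThreeTerm : Series → Set
ThreeTerm f = ∀ n → fromℕℚ (2 + n) ℚ.* f (2 + n) ≡ fromℕℚ (3 + 2 * n) ℚ.* f (suc n) ℚ.+ fromℕℚ (3 * suc n) ℚ.* f n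

ThreeTerm-unique : ∀ f g → ThreeTerm f → ThreeTerm g → f 0 ≡ g 0 → f 1 ≡ g 1 → f ≗ g
ThreeTerm-unique f g F G eq₀ eq₁ n = proj₁ (go n)
  where
  go : ∀ n → f n ≡ g n × f (suc n) ≡ g (suc n)
  go zero    = eq₀ , eq₁
  go (suc n) with eqₙ , eqₙ₊₁ ← go n = eqₙ₊₁ , *-cancelˡ-≡ (fromℕℚ (2 + n)) (0<fromℕℚ-suc (suc n))
    (trans (F n) (trans (cong₂ (λ x y → fromℕℚ (3 + 2 * n) ℚ.* x ℚ.+ fromℕℚ (3 * suc n) ℚ.* y) eqₙ₊₁ eqₙ) (sym (G n))))

T-recurrence : ThreeTerm T
T-recurrence n = begin
  fromℕℚ (2 + n) ℚ.* T (2 + n)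
    ≡⟨ cong (fromℕℚ (2 + n) ℚ.*_) (T-walks (2 + n)) ⟩
  fromℤ (+ (2 + n)) ℚ.* fromℤ (walksℤ (2 + n) 0ℤ)
    ≡⟨ fromℤ-* (+ (2 + n)) (walksℤ (2 + n) 0ℤ) ⟨
  fromℤ (+ (2 + n) ℤ.* walksℤ (2 + n) 0ℤ)
    ≡⟨ cong fromℤ (walksℤ-recurrence n) ⟩
  fromℤ (+ (3 + 2 * n) ℤ.* walksℤ (suc n) 0ℤ ℤ.+ + (3 * suc n) ℤ.* walksℤ n 0ℤ)
    ≡⟨ trans (fromℤ-+ (+ (3 + 2 * n) ℤ.* walksℤ (suc n) 0ℤ) _) (cong₂ ℚ._+_ (fromℤ-* (+ (3 + 2 * n)) (walksℤ (suc n) 0ℤ)) (fromℤ-* (+ (3 * suc n)) (walksℤ n 0ℤ))) ⟩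
  fromℕℚ (3 + 2 * n) ℚ.* fromℕℚ (walks (suc n) 0ℤ) ℚ.+ fromℕℚ (3 * suc n) ℚ.* fromℕℚ (walks n 0ℤ)
    ≡⟨ cong₂ (λ x y → fromℕℚ (3 + 2 * n) ℚ.* x ℚ.+ fromℕℚ (3 * suc n) ℚ.* y) (T-walks (suc n)) (T-walks n) ⟨
  fromℕℚ (3 + 2 * n) ℚ.* T (suc n) ℚ.+ fromℕℚ (3 * suc n) ℚ.* T n ∎
  where open ≡-Reasoning

poly-const : ∀ a f n → (poly (a ∷ []) *ₛ f) n ≡ fromℤ a ℚ.* f n
poly-const a f zero    = refl
poly-const a f (suc n) = trans (poly-*ₛ a [] f n)
  (trans (cong (fromℤ a ℚ.* f (suc n) ℚ.+_) (*ₛ-zeroˡ f n)) (ℚ.+-identityʳ _))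

poly-linear : ∀ a b f n → (poly (a ∷ b ∷ []) *ₛ f) (suc n) ≡ fromℤ a ℚ.* f (suc n) ℚ.+ fromℤ b ℚ.* f n
poly-linear a b f n = trans (poly-*ₛ a (b ∷ []) f n) (cong (fromℤ a ℚ.* f (suc n) ℚ.+_) (poly-const b f n))

poly-quadratic : ∀ a b c f n → (poly (a ∷ b ∷ c ∷ []) *ₛ f) (2 + n) ≡
                 fromℤ a ℚ.* f (2 + n) ℚ.+ (fromℤ b ℚ.* f (suc n) ℚ.+ fromℤ c ℚ.* f n)
poly-quadratic a b c f n = trans (poly-*ₛ a (b ∷ c ∷ []) f (suc n)) (cong (fromℤ a ℚ.* f (2 + n) ℚ.+_) (poly-linear b c f n))

1-2x-3x² : Series
1-2x-3x² = poly (+ 1 ∷ - + 2 ∷ - + 3 ∷ [])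

1-3x : Series
1-3x = poly (+ 1 ∷ - + 3 ∷ [])

fromℕℚ-affine : ∀ a b n → fromℕℚ (a + b * n) ≡ fromℕℚ a ℚ.+ fromℕℚ b ℚ.* fromℕℚ n
fromℕℚ-affine a b n = trans (fromℕℚ-+ a (b * n)) (cong (fromℕℚ a ℚ.+_) (fromℕℚ-* b n))

ThreeTerm-ℚ : ∀ {f} → ThreeTerm f → ∀ n → let x = fromℕℚ n in
  (2ℚ ℚ.+ x) ℚ.* f (2 + n) ≡ (3ℚ ℚ.+ 2ℚ ℚ.* x) ℚ.* f (suc n) ℚ.+ (3ℚ ℚ.* (1ℚ ℚ.+ x)) ℚ.* f n
ThreeTerm-ℚ {f} F n = trans (cong (ℚ._* f (2 + n)) (sym (fromℕℚ-+ 2 n))) $ trans (F n) $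
  cong₂ (λ a b → a ℚ.* f (suc n) ℚ.+ b ℚ.* f n) (fromℕℚ-affine 3 2 n)
    (trans (fromℕℚ-* 3 (suc n)) (cong (3ℚ ℚ.*_) (fromℕℚ-suc n)))

T-inverse-square : T *ₛ T *ₛ 1-2x-3x² ≗ 1ₛ
T-inverse-square = inverse-square T 1-2x-3x² p ode θq refl refl
  where
  open ≡-Reasoning
  -- Half of -θ(1-2x-3x²) = 2x + 6x², as `inverse-square` requires.
  p = poly (+ 0 ∷ + 1 ∷ + 3 ∷ [])
  θq : θ 1-2x-3x² +ₛ (p +ₛ p) ≗ 0ₛ
  θq zero                = refl
  θq (suc zero)          = refl
  θq (suc (suc zero))    = refl
  θq (suc (suc (suc n))) = cong (ℚ._+ 0ℚ) (ℚ.*-zeroʳ (fromℕℚ (3 + n)))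
  ode : 1-2x-3x² *ₛ θ T ≗ p *ₛ T
  ode zero          = refl
  ode (suc zero)    = refl
  ode (suc (suc n)) = begin
    (1-2x-3x² *ₛ θ T) (2 + n)
      ≡⟨ poly-quadratic (+ 1) (- + 2) (- + 3) (θ T) n ⟩
    1ℚ ℚ.* (fromℕℚ (2 + n) ℚ.* T (2 + n)) ℚ.+ (fromℤ (- + 2) ℚ.* (fromℕℚ (suc n) ℚ.* T (suc n)) ℚ.+ fromℤ (- + 3) ℚ.* (x ℚ.* T n))
      ≡⟨ cong₂ (λ a b → 1ℚ ℚ.* (a ℚ.* T (2 + n)) ℚ.+ (fromℤ (- + 2) ℚ.* (b ℚ.* T (suc n)) ℚ.+ fromℤ (- + 3) ℚ.* (x ℚ.* T n)))
           (fromℕℚ-+ 2 n) (fromℕℚ-suc n) ⟩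
    1ℚ ℚ.* ((2ℚ ℚ.+ x) ℚ.* T (2 + n)) ℚ.+ (fromℤ (- + 2) ℚ.* ((1ℚ ℚ.+ x) ℚ.* T (suc n)) ℚ.+ fromℤ (- + 3) ℚ.* (x ℚ.* T n))
      ≡⟨ cong (λ a → 1ℚ ℚ.* a ℚ.+ (fromℤ (- + 2) ℚ.* ((1ℚ ℚ.+ x) ℚ.* T (suc n)) ℚ.+ fromℤ (- + 3) ℚ.* (x ℚ.* T n))) (ThreeTerm-ℚ {T} T-recurrence n) ⟩
    _ ≡⟨ solve 3 (λ x a b → con 1ℚ :* ((con 3ℚ :+ con 2ℚ :* x) :* a :+ (con 3ℚ :* (con 1ℚ :+ x)) :* b)
             :+ (con (fromℤ (- + 2)) :* ((con 1ℚ :+ x) :* a) :+ con (fromℤ (- + 3)) :* (x :* b))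
             := con 0ℚ :* con 0ℚ :+ (con 1ℚ :* a :+ con 3ℚ :* b)) refl x (T (suc n)) (T n) ⟩
    0ℚ ℚ.* 0ℚ ℚ.+ (1ℚ ℚ.* T (suc n) ℚ.+ 3ℚ ℚ.* T n)
      ≡⟨ cong (ℚ._+ (1ℚ ℚ.* T (suc n) ℚ.+ 3ℚ ℚ.* T n)) (sym (ℚ.*-zeroˡ (T (2 + n)))) ⟩
    0ℚ ℚ.* T (2 + n) ℚ.+ (1ℚ ℚ.* T (suc n) ℚ.+ 3ℚ ℚ.* T n)
      ≡⟨ poly-quadratic (+ 0) (+ 1) (+ 3) T n ⟨
    (p *ₛ T) (2 + n) ∎
    where x = fromℕℚ n

-- Scaling the variable: f(x) ↦ f(ax)

scale : ℚ → Series → Series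
scale a f n = a ^ℚ n ℚ.* f n

scale-* : ∀ a f g → scale a (f *ₛ g) ≗ scale a f *ₛ scale a g
scale-* a f g zero    = solve 2 (λ x y → con 1ℚ :* (x :* y) := (con 1ℚ :* x) :* (con 1ℚ :* y)) refl (f 0) (g 0)
scale-* a f g (suc n) = begin
  a ℚ.* b ℚ.* (f *ₛ g) (suc n)
    ≡⟨ cong (a ℚ.* b ℚ.*_) (*ₛ-suc f g n) ⟩
  a ℚ.* b ℚ.* (f 0 ℚ.* g (suc n) ℚ.+ ((f ∘ suc) *ₛ g) n)
    ≡⟨ solve 5 (λ a b x y z → a :* b :* (x :* y :+ z) := con 1ℚ :* x :* (a :* b :* y) :+ a :* (b :* z)) refl
         a b (f 0) (g (suc n)) (((f ∘ suc) *ₛ g) n) ⟩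
  1ℚ ℚ.* f 0 ℚ.* (a ℚ.* b ℚ.* g (suc n)) ℚ.+ a ℚ.* (b ℚ.* ((f ∘ suc) *ₛ g) n)
    ≡⟨ cong (λ z → 1ℚ ℚ.* f 0 ℚ.* (a ℚ.* b ℚ.* g (suc n)) ℚ.+ a ℚ.* z) (scale-* a (f ∘ suc) g n) ⟩
  1ℚ ℚ.* f 0 ℚ.* (a ℚ.* b ℚ.* g (suc n)) ℚ.+ a ℚ.* (scale a (f ∘ suc) *ₛ scale a g) n
    ≡⟨ cong (1ℚ ℚ.* f 0 ℚ.* (a ℚ.* b ℚ.* g (suc n)) ℚ.+_) (sym (*ₛ-scaleˡ a (scale a (f ∘ suc)) (scale a g) n)) ⟩
  1ℚ ℚ.* f 0 ℚ.* (a ℚ.* b ℚ.* g (suc n)) ℚ.+ ((λ k → a ℚ.* scale a (f ∘ suc) k) *ₛ scale a g) n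
    ≡⟨ cong (1ℚ ℚ.* f 0 ℚ.* (a ℚ.* b ℚ.* g (suc n)) ℚ.+_)
         (*ₛ-cong {g = scale a g} (λ k → sym (ℚ.*-assoc a (a ^ℚ k) (f (suc k)))) (λ _ → refl) n) ⟩
  scale a f 0 ℚ.* scale a g (suc n) ℚ.+ ((scale a f ∘ suc) *ₛ scale a g) n
    ≡⟨ *ₛ-suc (scale a f) (scale a g) n ⟨
  (scale a f *ₛ scale a g) (suc n) ∎
  where
  open ≡-Reasoning
  b = a ^ℚ n

scale-cong : ∀ a {f g} → f ≗ g → scale a f ≗ scale a g
scale-cong a f≗g n = cong (a ^ℚ n ℚ.*_) (f≗g n)

scale-1 : ∀ a → scale a 1ₛ ≗ 1ₛ
scale-1 a zero    = refl
scale-1 a (suc n) = ℚ.*-zeroʳ (a ^ℚ suc n)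

-- The coefficients of (1-x)^(-1/2).
c₁ : Series
c₁ zero    = 1ℚ
c₁ (suc k) = c₁ k ℚ.* (+ (1 + 2 * k) / (2 + 2 * k))

c₁-suc : ∀ k → (2ℚ ℚ.+ 2ℚ ℚ.* fromℕℚ k) ℚ.* c₁ (suc k) ≡ (1ℚ ℚ.+ 2ℚ ℚ.* fromℕℚ k) ℚ.* c₁ k
c₁-suc k = begin
  (2ℚ ℚ.+ 2ℚ ℚ.* fromℕℚ k) ℚ.* (c₁ k ℚ.* r)
    ≡⟨ cong (ℚ._* (c₁ k ℚ.* r)) (fromℕℚ-affine 2 2 k) ⟨
  fromℕℚ (2 + 2 * k) ℚ.* (c₁ k ℚ.* r)
    ≡⟨ solve 3 (λ a b r → a :* (b :* r) := (r :* a) :* b) refl (fromℕℚ (2 + 2 * k)) (c₁ k) r ⟩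
  r ℚ.* fromℕℚ (2 + 2 * k) ℚ.* c₁ k
    ≡⟨ cong (ℚ._* c₁ k) (trans (/-*-cancel (1 + 2 * k) (2 + 2 * k)) (fromℕℚ-affine 1 2 k)) ⟩
  (1ℚ ℚ.+ 2ℚ ℚ.* fromℕℚ k) ℚ.* c₁ k ∎
  where
  open ≡-Reasoning
  r = + (1 + 2 * k) / (2 + 2 * k)

1-x : Series
1-x = poly (+ 1 ∷ - + 1 ∷ [])

c₁-inverse-square : c₁ *ₛ c₁ *ₛ 1-x ≗ 1ₛ
c₁-inverse-square = inverse-square c₁ 1-x p ode θq refl refl
  where
  open ≡-Reasoning
  p : Series
  p k = ½ ℚ.* poly (+ 0 ∷ + 1 ∷ []) k
  θq : θ 1-x +ₛ (p +ₛ p) ≗ 0ₛ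
  θq zero          = refl
  θq (suc zero)    = refl
  θq (suc (suc n)) = cong (ℚ._+ 0ℚ) (ℚ.*-zeroʳ (fromℕℚ (2 + n)))
  ode : 1-x *ₛ θ c₁ ≗ p *ₛ c₁
  ode zero    = refl
  ode (suc n) = begin
    (1-x *ₛ θ c₁) (suc n)
      ≡⟨ poly-linear (+ 1) (- + 1) (θ c₁) n ⟩
    1ℚ ℚ.* (fromℕℚ (suc n) ℚ.* c₁ (suc n)) ℚ.+ fromℤ (- + 1) ℚ.* (x ℚ.* c₁ n)
      ≡⟨ cong (λ y → 1ℚ ℚ.* (y ℚ.* c₁ (suc n)) ℚ.+ fromℤ (- + 1) ℚ.* (x ℚ.* c₁ n)) (fromℕℚ-suc n) ⟩
    1ℚ ℚ.* ((1ℚ ℚ.+ x) ℚ.* c₁ (suc n)) ℚ.+ fromℤ (- + 1) ℚ.* (x ℚ.* c₁ n)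
      ≡⟨ solve 3 (λ x a b → con 1ℚ :* ((con 1ℚ :+ x) :* a) :+ con (fromℤ (- + 1)) :* (x :* b)
           := con ½ :* ((con 2ℚ :+ con 2ℚ :* x) :* a) :- x :* b) refl x (c₁ (suc n)) (c₁ n) ⟩
    ½ ℚ.* ((2ℚ ℚ.+ 2ℚ ℚ.* x) ℚ.* c₁ (suc n)) ℚ.- x ℚ.* c₁ n
      ≡⟨ cong (λ y → ½ ℚ.* y ℚ.- x ℚ.* c₁ n) (c₁-suc n) ⟩
    ½ ℚ.* ((1ℚ ℚ.+ 2ℚ ℚ.* x) ℚ.* c₁ n) ℚ.- x ℚ.* c₁ n
      ≡⟨ solve 3 (λ x a b → con ½ :* ((con 1ℚ :+ con 2ℚ :* x) :* b) :- x :* b := con ½ :* (con 0ℚ :+ con 1ℚ :* b)) refl x (c₁ (suc n)) (c₁ n) ⟩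
    ½ ℚ.* (0ℚ ℚ.+ 1ℚ ℚ.* c₁ n)
      ≡⟨ cong (λ y → ½ ℚ.* (y ℚ.+ 1ℚ ℚ.* c₁ n)) (ℚ.*-zeroˡ (c₁ (suc n))) ⟨
    ½ ℚ.* (0ℚ ℚ.* c₁ (suc n) ℚ.+ 1ℚ ℚ.* c₁ n)
      ≡⟨ cong (½ ℚ.*_) (poly-linear (+ 0) (+ 1) c₁ n) ⟨
    ½ ℚ.* (poly (+ 0 ∷ + 1 ∷ []) *ₛ c₁) (suc n)
      ≡⟨ *ₛ-scaleˡ ½ (poly (+ 0 ∷ + 1 ∷ [])) c₁ (suc n) ⟨
    (p *ₛ c₁) (suc n) ∎
    where x = fromℕℚ n

scale-c₁-inverse-square : ∀ a → scale a c₁ *ₛ scale a c₁ *ₛ scale a 1-x ≗ 1ₛ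
scale-c₁-inverse-square a = begin
  scale a c₁ *ₛ scale a c₁ *ₛ scale a 1-x  ≈⟨ *-congʳ {scale a 1-x} (scale-* a c₁ c₁) ⟨
  scale a (c₁ *ₛ c₁) *ₛ scale a 1-x        ≈⟨ scale-* a (c₁ *ₛ c₁) 1-x ⟨
  scale a (c₁ *ₛ c₁ *ₛ 1-x)                ≈⟨ scale-cong a c₁-inverse-square ⟩
  scale a 1ₛ                             ≈⟨ scale-1 a ⟩
  1ₛ                                     ∎
  where open 𝕊

-1ℚ : ℚ
-1ℚ = ℚ.- fromℕℚ 1

c₁[3x] c₁[-x] : Series
c₁[3x] = scale 3ℚ c₁
c₁[-x] = scale -1ℚ c₁

1-3x-scale : scale 3ℚ 1-x ≗ 1-3x
1-3x-scale zero          = refl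
1-3x-scale (suc zero)    = refl
1-3x-scale (suc (suc n)) = ℚ.*-zeroʳ (3ℚ ^ℚ (2 + n))

1-2x-3x²-factors : scale 3ℚ 1-x *ₛ scale -1ℚ 1-x ≗ 1-2x-3x²
1-2x-3x²-factors n = trans (*ₛ-cong {g = scale -1ℚ 1-x} 1-3x-scale (λ _ → refl) n) (product n)
  where
  product : 1-3x *ₛ scale -1ℚ 1-x ≗ 1-2x-3x²
  product zero                = refl
  product (suc zero)          = refl
  product (suc (suc zero))    = refl
  product (suc (suc (suc n))) = trans (poly-linear (+ 1) (- + 3) (scale -1ℚ 1-x) (2 + n))
    (cong₂ (λ a b → 1ℚ ℚ.* a ℚ.+ fromℤ (- + 3) ℚ.* b) (ℚ.*-zeroʳ (-1ℚ ^ℚ (3 + n))) (ℚ.*-zeroʳ (-1ℚ ^ℚ (2 + n))))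

-- Since 1-2x-3x² = (1-3x)(1+x), both sides have the same inverse square and the same constant term.
T-convolution : c₁[3x] *ₛ c₁[-x] ≗ T
T-convolution = inverse-square-unique (c₁[3x] *ₛ c₁[-x]) T 1-2x-3x² square T-inverse-square refl refl refl
  where
  open 𝕊
  q₁ = scale 3ℚ 1-x
  q₂ = scale -1ℚ 1-x
  square : c₁[3x] *ₛ c₁[-x] *ₛ (c₁[3x] *ₛ c₁[-x]) *ₛ 1-2x-3x² ≗ 1ₛ
  square = begin
    c₁[3x] *ₛ c₁[-x] *ₛ (c₁[3x] *ₛ c₁[-x]) *ₛ 1-2x-3x²   ≈⟨ *-congˡ {c₁[3x] *ₛ c₁[-x] *ₛ (c₁[3x] *ₛ c₁[-x])} 1-2x-3x²-factors ⟨
    c₁[3x] *ₛ c₁[-x] *ₛ (c₁[3x] *ₛ c₁[-x]) *ₛ (q₁ *ₛ q₂)     ≈⟨ solveₛ 4 (λ w v q₁ q₂ → w ⊗ v ⊗ (w ⊗ v) ⊗ (q₁ ⊗ q₂) ⊜ w ⊗ w ⊗ q₁ ⊗ (v ⊗ v ⊗ q₂)) (λ _ → refl) c₁[3x] c₁[-x] q₁ q₂ ⟩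
    c₁[3x] *ₛ c₁[3x] *ₛ q₁ *ₛ (c₁[-x] *ₛ c₁[-x] *ₛ q₂)       ≈⟨ *-cong (scale-c₁-inverse-square 3ℚ) (scale-c₁-inverse-square -1ℚ) ⟩
    1ₛ *ₛ 1ₛ                             ≈⟨ *-identityˡ 1ₛ ⟩
    1ₛ                                   ∎

-- The series of half edge counts

powersOf3 : Series
powersOf3 n = 3ℚ ^ℚ n

powersOf3-inverse : 1-3x *ₛ powersOf3 ≗ 1ₛ
powersOf3-inverse zero    = refl
powersOf3-inverse (suc n) = trans (poly-linear (+ 1) (- + 3) powersOf3 n)
  (solve 1 (λ b → con 1ℚ :* (con 3ℚ :* b) :+ con (fromℤ (- + 3)) :* b := con 0ℚ) refl (powersOf3 n))

-- The series 1/((1-3x)√(1-2x-3x²)). Unfolding the convolution gives the first sum of the theorem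
-- verbatim.
halfEdges : Series
halfEdges = T *ₛ powersOf3

halfEdges-suc : ∀ n → halfEdges (suc n) ≡ 3ℚ ℚ.* halfEdges n ℚ.+ T (suc n)
halfEdges-suc n = trans (*ₛ-sucʳ T powersOf3 n) (cong₂ ℚ._+_
  (trans (*ₛ-comm T (powersOf3 ∘ suc) n) (trans (*ₛ-scaleˡ 3ℚ powersOf3 T n) (cong (3ℚ ℚ.*_) (*ₛ-comm powersOf3 T n))))
  (ℚ.*-identityʳ (T (suc n))))

-- The left side is updated by u ↦ 3u + 2 T (n+1), and the three-term recurrence says the same of
-- the right side. This links the count `ℓ-GM` with the series.
halfEdges-T : ∀ n → 2ℚ ℚ.* halfEdges n ≡ fromℕℚ (suc n) ℚ.* (T (suc n) ℚ.+ T n)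
halfEdges-T zero    = refl
halfEdges-T (suc n) = begin
  2ℚ ℚ.* halfEdges (suc n)
    ≡⟨ cong (2ℚ ℚ.*_) (halfEdges-suc n) ⟩
  2ℚ ℚ.* (3ℚ ℚ.* halfEdges n ℚ.+ T (suc n))
    ≡⟨ solve 2 (λ h a → con 2ℚ :* (con 3ℚ :* h :+ a) := con 3ℚ :* (con 2ℚ :* h) :+ con 2ℚ :* a) refl (halfEdges n) (T (suc n)) ⟩
  3ℚ ℚ.* (2ℚ ℚ.* halfEdges n) ℚ.+ 2ℚ ℚ.* T (suc n)
    ≡⟨ cong (λ y → 3ℚ ℚ.* y ℚ.+ 2ℚ ℚ.* T (suc n)) (trans (halfEdges-T n) (cong (ℚ._* (T (suc n) ℚ.+ T n)) (fromℕℚ-suc n))) ⟩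
  3ℚ ℚ.* ((1ℚ ℚ.+ x) ℚ.* (T (suc n) ℚ.+ T n)) ℚ.+ 2ℚ ℚ.* T (suc n)
    ≡⟨ solve 3 (λ x a b → con 3ℚ :* ((con 1ℚ :+ x) :* (a :+ b)) :+ con 2ℚ :* a
         := ((con 3ℚ :+ con 2ℚ :* x) :* a :+ (con 3ℚ :* (con 1ℚ :+ x)) :* b) :+ (con 2ℚ :+ x) :* a) refl x (T (suc n)) (T n) ⟩
  _ ≡⟨ cong (ℚ._+ (2ℚ ℚ.+ x) ℚ.* T (suc n)) (ThreeTerm-ℚ {T} T-recurrence n) ⟨
  (2ℚ ℚ.+ x) ℚ.* T (2 + n) ℚ.+ (2ℚ ℚ.+ x) ℚ.* T (suc n)
    ≡⟨ ℚ.*-distribˡ-+ (2ℚ ℚ.+ x) (T (2 + n)) (T (suc n)) ⟨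
  (2ℚ ℚ.+ x) ℚ.* (T (2 + n) ℚ.+ T (suc n))
    ≡⟨ cong (ℚ._* (T (2 + n) ℚ.+ T (suc n))) (fromℕℚ-+ 2 n) ⟨
  fromℕℚ (2 + n) ℚ.* (T (2 + n) ℚ.+ T (suc n)) ∎
  where
  open ≡-Reasoning
  x = fromℕℚ n

ℓ-halfEdges : ∀ n → fromℕℚ (ℓ (GM (2 + n))) ≡ 2ℚ ℚ.* halfEdges n
ℓ-halfEdges n = begin
  fromℕℚ (ℓ (GM (2 + n)))
    ≡⟨ cong fromℕℚ (ℓ-GM n) ⟩
  fromℕℚ (suc n * (walks (suc n) 0ℤ + walks n 0ℤ))
    ≡⟨ trans (fromℕℚ-* (suc n) (walks (suc n) 0ℤ + walks n 0ℤ)) (cong (fromℕℚ (suc n) ℚ.*_) (fromℕℚ-+ (walks (suc n) 0ℤ) (walks n 0ℤ))) ⟩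
  fromℕℚ (suc n) ℚ.* (fromℕℚ (walks (suc n) 0ℤ) ℚ.+ fromℕℚ (walks n 0ℤ))
    ≡⟨ cong₂ (λ a b → fromℕℚ (suc n) ℚ.* (a ℚ.+ b)) (T-walks (suc n)) (T-walks n) ⟨
  fromℕℚ (suc n) ℚ.* (T (suc n) ℚ.+ T n)
    ≡⟨ halfEdges-T n ⟨
  2ℚ ℚ.* halfEdges n ∎
  where open ≡-Reasoning

-- The coefficients of (1-x)^(-3/2).
c₃ : Series
c₃ k = (1ℚ ℚ.+ 2ℚ ℚ.* fromℕℚ k) ℚ.* c₁ k

-- By `c₁-suc`, c₃ n equals (2n+2) c₁ (n+1), which is c₁ (n+1) less than c₃ (n+1).
1-x-c₃ : 1-x *ₛ c₃ ≗ c₁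
1-x-c₃ zero    = refl
1-x-c₃ (suc n) = begin
  (1-x *ₛ c₃) (suc n)
    ≡⟨ poly-linear (+ 1) (- + 1) c₃ n ⟩
  1ℚ ℚ.* ((1ℚ ℚ.+ 2ℚ ℚ.* fromℕℚ (suc n)) ℚ.* c₁ (suc n)) ℚ.+ fromℤ (- + 1) ℚ.* c₃ n
    ≡⟨ cong₂ (λ a b → 1ℚ ℚ.* ((1ℚ ℚ.+ 2ℚ ℚ.* a) ℚ.* c₁ (suc n)) ℚ.+ fromℤ (- + 1) ℚ.* b) (fromℕℚ-suc n) (sym (c₁-suc n)) ⟩
  1ℚ ℚ.* ((1ℚ ℚ.+ 2ℚ ℚ.* (1ℚ ℚ.+ x)) ℚ.* c₁ (suc n)) ℚ.+ fromℤ (- + 1) ℚ.* ((2ℚ ℚ.+ 2ℚ ℚ.* x) ℚ.* c₁ (suc n))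
    ≡⟨ solve 2 (λ x a → con 1ℚ :* ((con 1ℚ :+ con 2ℚ :* (con 1ℚ :+ x)) :* a)
         :+ con (fromℤ (- + 1)) :* ((con 2ℚ :+ con 2ℚ :* x) :* a) := a) refl x (c₁ (suc n)) ⟩
  c₁ (suc n) ∎
  where
  open ≡-Reasoning
  x = fromℕℚ n

-- Inserting (1-3x)·Σ3ⁿxⁿ = 1 raises the exponent of 1-3x from -3/2 to -1/2 and leaves the product
-- of `T-convolution` next to `powersOf3`.
halfEdges-convolution : scale 3ℚ c₃ *ₛ c₁[-x] ≗ halfEdges
halfEdges-convolution = begin
  u *ₛ c₁[-x]                            ≈⟨ *-identityʳ (u *ₛ c₁[-x]) ⟨
  u *ₛ c₁[-x] *ₛ 1ₛ                      ≈⟨ *-congˡ {u *ₛ c₁[-x]} powersOf3-inverse ⟨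
  u *ₛ c₁[-x] *ₛ (1-3x *ₛ powersOf3)      ≈⟨ solveₛ 4 (λ u v q p → u ⊗ v ⊗ (q ⊗ p) ⊜ (q ⊗ u) ⊗ v ⊗ p) (λ _ → refl) u c₁[-x] 1-3x powersOf3 ⟩
  1-3x *ₛ u *ₛ c₁[-x] *ₛ powersOf3        ≈⟨ *-congʳ {powersOf3} (*-congʳ {c₁[-x]} uw) ⟩
  c₁[3x] *ₛ c₁[-x] *ₛ powersOf3                  ≈⟨ *-congʳ {powersOf3} T-convolution ⟩
  T *ₛ powersOf3                       ∎
  where
  open 𝕊
  u = scale 3ℚ c₃
  uw : 1-3x *ₛ u ≗ c₁[3x]
  uw = begin
    1-3x *ₛ u                      ≈⟨ *-congʳ {u} 1-3x-scale ⟨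
    scale 3ℚ 1-x *ₛ u        ≈⟨ scale-* 3ℚ 1-x c₃ ⟨
    scale 3ℚ (1-x *ₛ c₃)      ≈⟨ scale-cong 3ℚ 1-x-c₃ ⟩
    c₁[3x]                                ∎

-- Closed form of the edge generating series

edgeSeries-closed : edgeSeries ≗ poly (+ 0 ∷ + 0 ∷ + 2 ∷ []) ÷ₛ (1-3x *ₛ √ₛ 1-2x-3x²)
edgeSeries-closed n = trans (shifted n) (sym (*ₛ-cong {poly (+ 0 ∷ + 0 ∷ + 2 ∷ [])} (λ _ → refl)
  (1/ₛ-unique (1-3x *ₛ √ₛ 1-2x-3x²) halfEdges inverse) n))
  where
  shifted : edgeSeries ≗ poly (+ 0 ∷ + 0 ∷ + 2 ∷ []) *ₛ halfEdges
  -- GM 0 and GM 1 consist of a single path each, and evaluation finds no edges.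
  shifted zero          = refl
  shifted (suc zero)    = refl
  shifted (suc (suc n)) = trans (ℓ-halfEdges n) (sym (trans (poly-quadratic (+ 0) (+ 0) (+ 2) halfEdges n)
    (trans (cong₂ (λ a b → a ℚ.+ (b ℚ.+ 2ℚ ℚ.* halfEdges n)) (ℚ.*-zeroˡ (halfEdges (2 + n))) (ℚ.*-zeroˡ (halfEdges (suc n))))
      (trans (ℚ.+-identityˡ _) (ℚ.+-identityˡ (2ℚ ℚ.* halfEdges n))))))
  open 𝕊
  R = √ₛ 1-2x-3x²
  TR : T *ₛ R ≗ 1ₛ
  TR = square-root-of-1 (T *ₛ R) square refl
    where
    square : T *ₛ R *ₛ (T *ₛ R) ≗ 1ₛ
    square = begin
      T *ₛ R *ₛ (T *ₛ R)       ≈⟨ solveₛ 2 (λ t r → t ⊗ r ⊗ (t ⊗ r) ⊜ t ⊗ t ⊗ (r ⊗ r)) (λ _ → refl) T R ⟩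
      T *ₛ T *ₛ (R *ₛ R)       ≈⟨ *-congˡ {T *ₛ T} (√ₛ-square 1-2x-3x² refl) ⟩
      T *ₛ T *ₛ 1-2x-3x²   ≈⟨ T-inverse-square ⟩
      1ₛ                       ∎
  inverse : halfEdges *ₛ (1-3x *ₛ R) ≗ 1ₛ
  inverse = begin
    T *ₛ powersOf3 *ₛ (1-3x *ₛ R)     ≈⟨ solveₛ 4 (λ t p q r → t ⊗ p ⊗ (q ⊗ r) ⊜ (q ⊗ p) ⊗ (t ⊗ r)) (λ _ → refl) T powersOf3 1-3x R ⟩
    1-3x *ₛ powersOf3 *ₛ (T *ₛ R)     ≈⟨ *-cong powersOf3-inverse TR ⟩
    1ₛ *ₛ 1ₛ                         ≈⟨ *-identityˡ 1ₛ ⟩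
    1ₛ                               ∎

-- Central binomial coefficients and the convolution formula

ℓ-halfEdges-shifted : ∀ n → fromℕℚ (ℓ (GM (n + 2))) ≡ 2ℚ ℚ.* halfEdges n
ℓ-halfEdges-shifted n = trans (cong (λ k → fromℕℚ (ℓ (GM k))) (ℕ.+-comm n 2)) (ℓ-halfEdges n)

centralBinomial-suc-ℚ : ∀ k → (1ℚ ℚ.+ fromℕℚ k) ℚ.* fromℕℚ (centralBinomial (suc k)) ≡
                        2ℚ ℚ.* ((1ℚ ℚ.+ 2ℚ ℚ.* fromℕℚ k) ℚ.* fromℕℚ (centralBinomial k))
centralBinomial-suc-ℚ k = begin
  (1ℚ ℚ.+ fromℕℚ k) ℚ.* fromℕℚ (centralBinomial (suc k))
    ≡⟨ cong (ℚ._* fromℕℚ (centralBinomial (suc k))) (fromℕℚ-suc k) ⟨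
  fromℕℚ (suc k) ℚ.* fromℕℚ (centralBinomial (suc k))
    ≡⟨ fromℕℚ-* (suc k) (centralBinomial (suc k)) ⟨
  fromℕℚ (suc k * centralBinomial (suc k))
    ≡⟨ cong fromℕℚ (centralBinomial-suc k) ⟩
  fromℕℚ (2 * ((1 + 2 * k) * centralBinomial k))
    ≡⟨ trans (fromℕℚ-* 2 ((1 + 2 * k) * centralBinomial k)) (cong (2ℚ ℚ.*_) (trans (fromℕℚ-* (1 + 2 * k) (centralBinomial k))
         (cong (ℚ._* fromℕℚ (centralBinomial k)) (fromℕℚ-affine 1 2 k)))) ⟩
  2ℚ ℚ.* ((1ℚ ℚ.+ 2ℚ ℚ.* fromℕℚ k) ℚ.* fromℕℚ (centralBinomial k)) ∎
  where open ≡-Reasoning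

-- Both sides start with 1 and have the quotient 2(2k+1)/(k+1) of consecutive terms.
scale-4-c₁ : ∀ k → fromℕℚ (centralBinomial k) ≡ scale 4ℚ c₁ k
scale-4-c₁ zero    = refl
scale-4-c₁ (suc k) = *-cancelˡ-≡ (1ℚ ℚ.+ x) (subst (0ℚ ℚ.<_) (fromℕℚ-suc k) (0<fromℕℚ-suc k)) $ begin
  (1ℚ ℚ.+ x) ℚ.* fromℕℚ (centralBinomial (suc k))
    ≡⟨ centralBinomial-suc-ℚ k ⟩
  2ℚ ℚ.* ((1ℚ ℚ.+ 2ℚ ℚ.* x) ℚ.* fromℕℚ (centralBinomial k))
    ≡⟨ cong (λ y → 2ℚ ℚ.* ((1ℚ ℚ.+ 2ℚ ℚ.* x) ℚ.* y)) (scale-4-c₁ k) ⟩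
  2ℚ ℚ.* ((1ℚ ℚ.+ 2ℚ ℚ.* x) ℚ.* (p ℚ.* c₁ k))
    ≡⟨ solve 3 (λ x p a → con 2ℚ :* ((con 1ℚ :+ con 2ℚ :* x) :* (p :* a))
         := con 2ℚ :* p :* ((con 1ℚ :+ con 2ℚ :* x) :* a)) refl x p (c₁ k) ⟩
  2ℚ ℚ.* p ℚ.* ((1ℚ ℚ.+ 2ℚ ℚ.* x) ℚ.* c₁ k)
    ≡⟨ cong (2ℚ ℚ.* p ℚ.*_) (c₁-suc k) ⟨
  2ℚ ℚ.* p ℚ.* ((2ℚ ℚ.+ 2ℚ ℚ.* x) ℚ.* c₁ (suc k))
    ≡⟨ solve 3 (λ x p a → con 2ℚ :* p :* ((con 2ℚ :+ con 2ℚ :* x) :* a)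
         := (con 1ℚ :+ x) :* (con 4ℚ :* p :* a)) refl x p (c₁ (suc k)) ⟩
  (1ℚ ℚ.+ x) ℚ.* (4ℚ ℚ.* p ℚ.* c₁ (suc k)) ∎
  where
  open ≡-Reasoning
  x = fromℕℚ k
  p = 4ℚ ^ℚ k

ℓ-convolution : ∀ n → fromℕℚ (ℓ (GM (n + 2))) ≡
  (+ 2 / 4 ^ n) {{ℕ.m^n≢0 4 n}} ℚ.*
    (Σ[ k ≤ n ] fromℕℚ ((2 * k) C k) ℚ.* fromℕℚ ((2 * n ∸ 2 * k) C (n ∸ k))
      ℚ.* fromℕℚ (2 * k + 1) ℚ.* 3ℚ ^ℚ k ℚ.* (ℚ.- fromℕℚ 1) ^ℚ (n ∸ k))
ℓ-convolution n = sym $ begin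
  2/4ⁿ ℚ.* Σ≤ n summand
    -- The two central binomials bring 4ᵏ and 4ⁿ⁻ᵏ, together the 4ⁿ that cancels, and the factor 2k
    -- + 1 turns c₁ into c₃.
    ≡⟨ cong (2/4ⁿ ℚ.*_) (Σ≤-cong n summand≡) ⟩
  2/4ⁿ ℚ.* (scale 4ℚ u *ₛ scale 4ℚ c₁[-x]) n
    ≡⟨ cong (2/4ⁿ ℚ.*_) (scale-* 4ℚ u c₁[-x] n) ⟨
  2/4ⁿ ℚ.* (4ℚ ^ℚ n ℚ.* (u *ₛ c₁[-x]) n)
    ≡⟨ cong₂ (λ x y → 2/4ⁿ ℚ.* (x ℚ.* y)) (sym (fromℕℚ-^ 4 n)) (halfEdges-convolution n) ⟩
  2/4ⁿ ℚ.* (fromℕℚ (4 ^ n) ℚ.* halfEdges n)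
    ≡⟨ ℚ.*-assoc 2/4ⁿ (fromℕℚ (4 ^ n)) (halfEdges n) ⟨
  2/4ⁿ ℚ.* fromℕℚ (4 ^ n) ℚ.* halfEdges n
    ≡⟨ cong (ℚ._* halfEdges n) (/-*-cancel 2 (4 ^ n) {{ℕ.m^n≢0 4 n}}) ⟩
  2ℚ ℚ.* halfEdges n
    ≡⟨ ℓ-halfEdges-shifted n ⟨
  fromℕℚ (ℓ (GM (n + 2))) ∎
  where
  open ≡-Reasoning
  2/4ⁿ = (+ 2 / 4 ^ n) {{ℕ.m^n≢0 4 n}}
  u = scale 3ℚ c₃
  summand : ℕ → ℚ
  summand k = fromℕℚ ((2 * k) C k) ℚ.* fromℕℚ ((2 * n ∸ 2 * k) C (n ∸ k))
      ℚ.* fromℕℚ (2 * k + 1) ℚ.* 3ℚ ^ℚ k ℚ.* (ℚ.- fromℕℚ 1) ^ℚ (n ∸ k)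
  summand≡ : ∀ k → summand k ≡ scale 4ℚ u k ℚ.* scale 4ℚ c₁[-x] (n ∸ k)
  summand≡ k = begin
    fromℕℚ ((2 * k) C k) ℚ.* fromℕℚ ((2 * n ∸ 2 * k) C (n ∸ k)) ℚ.* fromℕℚ (2 * k + 1) ℚ.* p ℚ.* s
      ≡⟨ cong₂ (λ x y → x ℚ.* y ℚ.* fromℕℚ (2 * k + 1) ℚ.* p ℚ.* s) (scale-4-c₁ k)
           (trans (cong (λ m → fromℕℚ (m C (n ∸ k))) (sym (ℕ.*-distribˡ-∸ 2 n k))) (scale-4-c₁ (n ∸ k))) ⟩
    q ℚ.* c₁ k ℚ.* (r ℚ.* c₁ (n ∸ k)) ℚ.* fromℕℚ (2 * k + 1) ℚ.* p ℚ.* s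
      ≡⟨ cong (λ x → q ℚ.* c₁ k ℚ.* (r ℚ.* c₁ (n ∸ k)) ℚ.* x ℚ.* p ℚ.* s) (trans (cong fromℕℚ (ℕ.+-comm (2 * k) 1)) (fromℕℚ-affine 1 2 k)) ⟩
    q ℚ.* c₁ k ℚ.* (r ℚ.* c₁ (n ∸ k)) ℚ.* o ℚ.* p ℚ.* s
      ≡⟨ solve 7 (λ q a r b o p s → q :* a :* (r :* b) :* o :* p :* s := q :* (p :* (o :* a)) :* (r :* (s :* b))) refl
           q (c₁ k) r (c₁ (n ∸ k)) o p s ⟩
    q ℚ.* (p ℚ.* (o ℚ.* c₁ k)) ℚ.* (r ℚ.* (s ℚ.* c₁ (n ∸ k))) ∎
    where
    p = 3ℚ ^ℚ k
    q = 4ℚ ^ℚ k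
    r = 4ℚ ^ℚ (n ∸ k)
    s = -1ℚ ^ℚ (n ∸ k)
    o = 1ℚ ℚ.+ 2ℚ ℚ.* fromℕℚ k

-- Binomial transform: Σ C(n,k) f(k) 3^(n-k) and its shift Σ C(n+1,k+1) f(k) 3^(n-k)

binomial : ℕ → Series → ℕ → ℚ
binomial j f n = Σ[ k ≤ n ] fromℕℚ ((j + n) C (j + k)) ℚ.* f k ℚ.* 3ℚ ^ℚ (n ∸ k)

-- The added last term carries C(j+n, j+n+1) = 0, and every other term gains one factor 3.
binomial-grow : ∀ j f n → Σ[ k ≤ suc n ] fromℕℚ ((j + n) C (j + k)) ℚ.* f k ℚ.* 3ℚ ^ℚ (suc n ∸ k) ≡ 3ℚ ℚ.* binomial j f n
binomial-grow j f n = begin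
  Σ≤ n g ℚ.+ fromℕℚ ((j + n) C (j + suc n)) ℚ.* f (suc n) ℚ.* 3ℚ ^ℚ (n ∸ n)
    ≡⟨ cong₂ ℚ._+_ (Σ≤-cong-≤ n λ k k≤n → trans
          (cong (λ m → fromℕℚ ((j + n) C (j + k)) ℚ.* f k ℚ.* 3ℚ ^ℚ m) (ℕ.+-∸-assoc 1 k≤n))
          (solve 4 (λ t a b p → a :* b :* (t :* p) := t :* (a :* b :* p)) refl 3ℚ (fromℕℚ ((j + n) C (j + k))) (f k) (3ℚ ^ℚ (n ∸ k))))
        (cong (λ m → fromℕℚ m ℚ.* f (suc n) ℚ.* 3ℚ ^ℚ (n ∸ n)) (k>n⇒nCk≡0 {j + n} {j + suc n} (ℕ.+-monoʳ-< j (ℕ.n<1+n n)))) ⟩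
  Σ≤ n (λ k → 3ℚ ℚ.* (fromℕℚ ((j + n) C (j + k)) ℚ.* f k ℚ.* 3ℚ ^ℚ (n ∸ k))) ℚ.+ 0ℚ ℚ.* f (suc n) ℚ.* 3ℚ ^ℚ (n ∸ n)
    ≡⟨ cong₂ ℚ._+_ (Σ≤-*ˡ n 3ℚ _) (solve 2 (λ a b → con 0ℚ :* a :* b := con 0ℚ) refl (f (suc n)) (3ℚ ^ℚ (n ∸ n))) ⟩
  3ℚ ℚ.* binomial j f n ℚ.+ 0ℚ
    ≡⟨ ℚ.+-identityʳ _ ⟩
  3ℚ ℚ.* binomial j f n ∎
  where
  open ≡-Reasoning
  g : ℕ → ℚ
  g k = fromℕℚ ((j + n) C (j + k)) ℚ.* f k ℚ.* 3ℚ ^ℚ (suc n ∸ k)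

pascal-ℚ : ∀ n k a b → fromℕℚ (suc n C suc k) ℚ.* a ℚ.* b ≡
           fromℕℚ (n C k) ℚ.* a ℚ.* b ℚ.+ fromℕℚ (n C suc k) ℚ.* a ℚ.* b
pascal-ℚ n k a b = trans
  (cong (λ x → x ℚ.* a ℚ.* b) (trans (cong fromℕℚ (sym (nCk+nC[k+1]≡[n+1]C[k+1] n k))) (fromℕℚ-+ (n C k) (n C suc k))))
  (solve 4 (λ x y a b → (x :+ y) :* a :* b := x :* a :* b :+ y :* a :* b) refl (fromℕℚ (n C k)) (fromℕℚ (n C suc k)) a b)

-- Pascal's rule: a shift of f corresponds to the twisted difference B (n+1) - 3 B n of transforms.
binomial-suc : ∀ f n → binomial 0 f (suc n) ≡ 3ℚ ℚ.* binomial 0 f n ℚ.+ binomial 0 (f ∘ suc) n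
binomial-suc f n = begin
  binomial 0 f (suc n)
    ≡⟨ Σ≤-peel n _ ⟩
  1ℚ ℚ.* f 0 ℚ.* 3^ (suc n) ℚ.+ Σ≤ n (λ k → fromℕℚ (suc n C suc k) ℚ.* f (suc k) ℚ.* 3^ (n ∸ k))
    ≡⟨ cong (1ℚ ℚ.* f 0 ℚ.* 3^ (suc n) ℚ.+_) (trans (Σ≤-cong n (λ k → pascal-ℚ n k (f (suc k)) (3^ (n ∸ k)))) (Σ≤-+ n _ _)) ⟩
  1ℚ ℚ.* f 0 ℚ.* 3^ (suc n) ℚ.+ (binomial 0 (f ∘ suc) n ℚ.+ rest)
    ≡⟨ solve 3 (λ a b c → a :+ (b :+ c) := a :+ c :+ b) refl (1ℚ ℚ.* f 0 ℚ.* 3^ (suc n)) (binomial 0 (f ∘ suc) n) rest ⟩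
  1ℚ ℚ.* f 0 ℚ.* 3^ (suc n) ℚ.+ rest ℚ.+ binomial 0 (f ∘ suc) n
    ≡⟨ cong (ℚ._+ binomial 0 (f ∘ suc) n) (trans (sym (Σ≤-peel n _)) (binomial-grow 0 f n)) ⟩
  3ℚ ℚ.* binomial 0 f n ℚ.+ binomial 0 (f ∘ suc) n ∎
  where
  open ≡-Reasoning
  3^ : ℕ → ℚ
  3^ m = 3ℚ ^ℚ m
  rest = Σ≤ n (λ k → fromℕℚ (n C suc k) ℚ.* f (suc k) ℚ.* 3^ (n ∸ k))

binomial-shift : ∀ f n → binomial 1 f (suc n) ≡ 3ℚ ℚ.* binomial 1 f n ℚ.+ binomial 0 f (suc n)
binomial-shift f n = begin
  binomial 1 f (suc n)
    ≡⟨ trans (Σ≤-cong (suc n) (λ k → pascal-ℚ (suc n) k (f k) (3ℚ ^ℚ (suc n ∸ k)))) (Σ≤-+ (suc n) _ _) ⟩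
  binomial 0 f (suc n) ℚ.+ Σ≤ (suc n) (λ k → fromℕℚ (suc n C suc k) ℚ.* f k ℚ.* 3ℚ ^ℚ (suc n ∸ k))
    ≡⟨ cong (binomial 0 f (suc n) ℚ.+_) (binomial-grow 1 f n) ⟩
  binomial 0 f (suc n) ℚ.+ 3ℚ ℚ.* binomial 1 f n
    ≡⟨ ℚ.+-comm (binomial 0 f (suc n)) _ ⟩
  3ℚ ℚ.* binomial 1 f n ℚ.+ binomial 0 f (suc n) ∎
  where open ≡-Reasoning

-- Absorption trades the factor k of θ for the factor n + 1 and a shift.
binomial-θ : ∀ f n → binomial 0 (θ f) (suc n) ≡ fromℕℚ (suc n) ℚ.* binomial 0 (f ∘ suc) n
binomial-θ f n = begin
  binomial 0 (θ f) (suc n)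
    ≡⟨ Σ≤-peel n _ ⟩
  1ℚ ℚ.* (0ℚ ℚ.* f 0) ℚ.* 3^ (suc n) ℚ.+ Σ≤ n (λ k → fromℕℚ (suc n C suc k) ℚ.* (fromℕℚ (suc k) ℚ.* f (suc k)) ℚ.* 3^ (n ∸ k))
    ≡⟨ cong₂ ℚ._+_ (solve 2 (λ a b → con 1ℚ :* (con 0ℚ :* a) :* b := con 0ℚ) refl (f 0) (3^ (suc n))) (Σ≤-cong n absorb) ⟩
  0ℚ ℚ.+ Σ≤ n (λ k → fromℕℚ (suc n) ℚ.* (fromℕℚ (n C k) ℚ.* f (suc k) ℚ.* 3^ (n ∸ k)))
    ≡⟨ trans (ℚ.+-identityˡ _) (Σ≤-*ˡ n (fromℕℚ (suc n)) _) ⟩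
  fromℕℚ (suc n) ℚ.* binomial 0 (f ∘ suc) n ∎
  where
  open ≡-Reasoning
  3^ : ℕ → ℚ
  3^ m = 3ℚ ^ℚ m
  absorb : ∀ k → fromℕℚ (suc n C suc k) ℚ.* (fromℕℚ (suc k) ℚ.* f (suc k)) ℚ.* 3^ (n ∸ k) ≡
                 fromℕℚ (suc n) ℚ.* (fromℕℚ (n C k) ℚ.* f (suc k) ℚ.* 3^ (n ∸ k))
  absorb k = begin
    fromℕℚ (suc n C suc k) ℚ.* (fromℕℚ (suc k) ℚ.* f (suc k)) ℚ.* 3^ (n ∸ k)
      ≡⟨ solve 4 (λ a b c p → a :* (b :* c) :* p := b :* a :* c :* p) refl (fromℕℚ (suc n C suc k)) (fromℕℚ (suc k)) (f (suc k)) (3^ (n ∸ k)) ⟩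
    fromℕℚ (suc k) ℚ.* fromℕℚ (suc n C suc k) ℚ.* f (suc k) ℚ.* 3^ (n ∸ k)
      ≡⟨ cong (λ x → x ℚ.* f (suc k) ℚ.* 3^ (n ∸ k)) (trans (sym (fromℕℚ-* (suc k) (suc n C suc k))) (trans (cong fromℕℚ (C-absorption n k)) (fromℕℚ-* (suc n) (n C k)))) ⟩
    fromℕℚ (suc n) ℚ.* fromℕℚ (n C k) ℚ.* f (suc k) ℚ.* 3^ (n ∸ k)
      ≡⟨ solve 4 (λ a b c p → a :* b :* c :* p := a :* (b :* c :* p)) refl (fromℕℚ (suc n)) (fromℕℚ (n C k)) (f (suc k)) (3^ (n ∸ k)) ⟩
    fromℕℚ (suc n) ℚ.* (fromℕℚ (n C k) ℚ.* f (suc k) ℚ.* 3^ (n ∸ k)) ∎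

binomial-cong : ∀ j {f g} → f ≗ g → ∀ n → binomial j f n ≡ binomial j g n
binomial-cong j f≗g n = Σ≤-cong n (λ k → cong (λ x → fromℕℚ ((j + n) C (j + k)) ℚ.* x ℚ.* 3ℚ ^ℚ (n ∸ k)) (f≗g k))

binomial-linear : ∀ a b f g n → binomial 0 (λ k → a ℚ.* f k ℚ.+ b ℚ.* g k) n ≡ a ℚ.* binomial 0 f n ℚ.+ b ℚ.* binomial 0 g n
binomial-linear a b f g n = begin
  binomial 0 (λ k → a ℚ.* f k ℚ.+ b ℚ.* g k) n
    ≡⟨ trans (Σ≤-cong n (λ k → solve 6 (λ x a f b g p → x :* (a :* f :+ b :* g) :* p := a :* (x :* f :* p) :+ b :* (x :* g :* p)) refl
          (fromℕℚ (n C k)) a (f k) b (g k) (3ℚ ^ℚ (n ∸ k)))) (Σ≤-+ n _ _) ⟩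
  _ ≡⟨ cong₂ ℚ._+_ (Σ≤-*ˡ n a _) (Σ≤-*ˡ n b _) ⟩
  a ℚ.* binomial 0 f n ℚ.+ b ℚ.* binomial 0 g n ∎
  where
  open ≡-Reasoning

-- The coefficients of e = (1+4x)^(-1/2); `signedCentral-θ` is (1+4x) θ e = -2x e, read
-- coefficientwise.
signedCentral : Series
signedCentral k = fromℕℚ (centralBinomial k) ℚ.* -1ℚ ^ℚ k

signedCentral-θ : ∀ k → θ signedCentral (suc k) ≡ fromℤ (- + 4) ℚ.* θ signedCentral k ℚ.+ fromℤ (- + 2) ℚ.* signedCentral k
signedCentral-θ k = begin
  fromℕℚ (suc k) ℚ.* (fromℕℚ (centralBinomial (suc k)) ℚ.* (-1ℚ ℚ.* s))
    ≡⟨ cong (ℚ._* (fromℕℚ (centralBinomial (suc k)) ℚ.* (-1ℚ ℚ.* s))) (fromℕℚ-suc k) ⟩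
  (1ℚ ℚ.+ x) ℚ.* (fromℕℚ (centralBinomial (suc k)) ℚ.* (-1ℚ ℚ.* s))
    ≡⟨ solve 3 (λ x b s → (con 1ℚ :+ x) :* (b :* (con -1ℚ :* s)) := ((con 1ℚ :+ x) :* b) :* (con -1ℚ :* s)) refl x (fromℕℚ (centralBinomial (suc k))) s ⟩
  ((1ℚ ℚ.+ x) ℚ.* fromℕℚ (centralBinomial (suc k))) ℚ.* (-1ℚ ℚ.* s)
    ≡⟨ cong (ℚ._* (-1ℚ ℚ.* s)) (centralBinomial-suc-ℚ k) ⟩
  2ℚ ℚ.* ((1ℚ ℚ.+ 2ℚ ℚ.* x) ℚ.* b) ℚ.* (-1ℚ ℚ.* s)
    ≡⟨ solve 3 (λ x b s → con 2ℚ :* ((con 1ℚ :+ con 2ℚ :* x) :* b) :* (con -1ℚ :* s)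
         := con (fromℤ (- + 4)) :* (x :* (b :* s)) :+ con (fromℤ (- + 2)) :* (b :* s)) refl x b s ⟩
  fromℤ (- + 4) ℚ.* (x ℚ.* (b ℚ.* s)) ℚ.+ fromℤ (- + 2) ℚ.* (b ℚ.* s) ∎
  where
  open ≡-Reasoning
  x = fromℕℚ k
  b = fromℕℚ (centralBinomial k)
  s = -1ℚ ^ℚ k

-- Transform the differential equation of `signedCentral`: the shift becomes the twisted difference
-- `G≡` and θ the factor n + 1 of `binomial-θ`. The outcome is the recurrence of T, and the first
-- two values agree.
binomial-T : binomial 0 signedCentral ≗ T
binomial-T = ThreeTerm-unique B T recurrence T-recurrence refl refl
  where
  open ≡-Reasoning
  e = signedCentral
  B G : Series
  B = binomial 0 e
  G = binomial 0 (e ∘ suc)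
  G≡ : ∀ n → G n ≡ B (suc n) ℚ.- 3ℚ ℚ.* B n
  G≡ n = trans (solve 2 (λ x g → g := x :+ g :- x) refl (3ℚ ℚ.* B n) (G n)) (cong (ℚ._- 3ℚ ℚ.* B n) (sym (binomial-suc e n)))
  G-recurrence : ∀ n → fromℕℚ (2 + n) ℚ.* G (suc n) ≡
    3ℚ ℚ.* (fromℕℚ (suc n) ℚ.* G n) ℚ.+ (fromℤ (- + 4) ℚ.* (fromℕℚ (suc n) ℚ.* G n) ℚ.+ fromℤ (- + 2) ℚ.* B (suc n))
  G-recurrence n = begin
    fromℕℚ (2 + n) ℚ.* G (suc n)
      ≡⟨ binomial-θ e (suc n) ⟨
    binomial 0 (θ e) (2 + n)
      ≡⟨ binomial-suc (θ e) (suc n) ⟩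
    3ℚ ℚ.* binomial 0 (θ e) (suc n) ℚ.+ binomial 0 (θ e ∘ suc) (suc n)
      ≡⟨ cong (3ℚ ℚ.* binomial 0 (θ e) (suc n) ℚ.+_) (trans (binomial-cong 0 signedCentral-θ (suc n))
           (binomial-linear (fromℤ (- + 4)) (fromℤ (- + 2)) (θ e) e (suc n))) ⟩
    3ℚ ℚ.* binomial 0 (θ e) (suc n) ℚ.+ (fromℤ (- + 4) ℚ.* binomial 0 (θ e) (suc n) ℚ.+ fromℤ (- + 2) ℚ.* B (suc n))
      ≡⟨ cong (λ y → 3ℚ ℚ.* y ℚ.+ (fromℤ (- + 4) ℚ.* y ℚ.+ fromℤ (- + 2) ℚ.* B (suc n))) (binomial-θ e n) ⟩
    3ℚ ℚ.* (fromℕℚ (suc n) ℚ.* G n) ℚ.+ (fromℤ (- + 4) ℚ.* (fromℕℚ (suc n) ℚ.* G n) ℚ.+ fromℤ (- + 2) ℚ.* B (suc n)) ∎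
  recurrence : ThreeTerm B
  recurrence n = begin
    y ℚ.* B (2 + n)
      ≡⟨ solve 3 (λ y b a → y :* b := y :* (b :- con 3ℚ :* a) :+ y :* (con 3ℚ :* a)) refl y (B (2 + n)) (B (suc n)) ⟩
    y ℚ.* (B (2 + n) ℚ.- 3ℚ ℚ.* B (suc n)) ℚ.+ y ℚ.* (3ℚ ℚ.* B (suc n))
      ≡⟨ cong (ℚ._+ y ℚ.* (3ℚ ℚ.* B (suc n))) (trans (cong (y ℚ.*_) (sym (G≡ (suc n)))) (G-recurrence n)) ⟩
    3ℚ ℚ.* (fromℕℚ (suc n) ℚ.* G n) ℚ.+ (fromℤ (- + 4) ℚ.* (fromℕℚ (suc n) ℚ.* G n) ℚ.+ fromℤ (- + 2) ℚ.* B (suc n)) ℚ.+ y ℚ.* (3ℚ ℚ.* B (suc n))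
      ≡⟨ cong₂ (λ z g → 3ℚ ℚ.* (z ℚ.* g) ℚ.+ (fromℤ (- + 4) ℚ.* (z ℚ.* g) ℚ.+ fromℤ (- + 2) ℚ.* B (suc n)) ℚ.+ y ℚ.* (3ℚ ℚ.* B (suc n))) (fromℕℚ-suc n) (G≡ n) ⟩
    _ ≡⟨ cong (λ z → 3ℚ ℚ.* ((1ℚ ℚ.+ x) ℚ.* (B (suc n) ℚ.- 3ℚ ℚ.* B n)) ℚ.+ (fromℤ (- + 4) ℚ.* ((1ℚ ℚ.+ x) ℚ.* (B (suc n) ℚ.- 3ℚ ℚ.* B n)) ℚ.+ fromℤ (- + 2) ℚ.* B (suc n)) ℚ.+ z ℚ.* (3ℚ ℚ.* B (suc n))) (fromℕℚ-+ 2 n) ⟩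
    _ ≡⟨ solve 3 (λ x a b → con 3ℚ :* ((con 1ℚ :+ x) :* (a :- con 3ℚ :* b)) :+ (con (fromℤ (- + 4)) :* ((con 1ℚ :+ x) :* (a :- con 3ℚ :* b)) :+ con (fromℤ (- + 2)) :* a) :+ (con 2ℚ :+ x) :* (con 3ℚ :* a)
          := (con 3ℚ :+ con 2ℚ :* x) :* a :+ (con 3ℚ :* (con 1ℚ :+ x)) :* b) refl x (B (suc n)) (B n) ⟩
    (3ℚ ℚ.+ 2ℚ ℚ.* x) ℚ.* B (suc n) ℚ.+ (3ℚ ℚ.* (1ℚ ℚ.+ x)) ℚ.* B n
      ≡⟨ cong₂ (λ a b → a ℚ.* B (suc n) ℚ.+ b ℚ.* B n) (fromℕℚ-affine 3 2 n) (trans (fromℕℚ-* 3 (suc n)) (cong (3ℚ ℚ.*_) (fromℕℚ-suc n))) ⟨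
    fromℕℚ (3 + 2 * n) ℚ.* B (suc n) ℚ.+ fromℕℚ (3 * suc n) ℚ.* B n ∎
    where
    x = fromℕℚ n
    y = fromℕℚ (2 + n)

-- Both sides follow h (n+1) = 3 h n + T (n+1), by `binomial-shift` and `halfEdges-suc`.
halfEdges-binomial : binomial 1 signedCentral ≗ halfEdges
halfEdges-binomial zero    = refl
halfEdges-binomial (suc n) = trans (binomial-shift signedCentral n)
  (trans (cong₂ (λ a b → 3ℚ ℚ.* a ℚ.+ b) (halfEdges-binomial n) (binomial-T (suc n))) (sym (halfEdges-suc n)))

ℓ-binomial : ∀ n → fromℕℚ (ℓ (GM (n + 2))) ≡
  2ℚ ℚ.*
    (Σ[ k ≤ n ] fromℕℚ ((n + 1) C (k + 1)) ℚ.* fromℕℚ ((2 * k) C k)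
      ℚ.* (ℚ.- fromℕℚ 1) ^ℚ k ℚ.* 3ℚ ^ℚ (n ∸ k))
ℓ-binomial n = trans (ℓ-halfEdges-shifted n) (cong (2ℚ ℚ.*_) (trans (sym (halfEdges-binomial n)) (Σ≤-cong n λ k → cong (ℚ._* 3ℚ ^ℚ (n ∸ k))
  (trans (sym (ℚ.*-assoc (fromℕℚ (suc n C suc k)) (fromℕℚ ((2 * k) C k)) (-1ℚ ^ℚ k)))
    (cong₂ (λ a b → fromℕℚ (a C b) ℚ.* fromℕℚ ((2 * k) C k) ℚ.* -1ℚ ^ℚ k) (ℕ.+-comm 1 n) (ℕ.+-comm 1 k))))))

-- Limits of rational sequences

infix 4 _⇾_

-- A record, so that unification reads the sequence and the limit off the type of a proof. The
-- parameter `c₁[-x/3]` is an arbitrary rational here, unrelated to the series defined later under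
-- that name.
record _⇾_ (f : ℕ → ℚ) (c₁[-x/3] : ℚ) : Set where
  field
    within : ∀ ε → 0ℚ ℚ.< ε → ∃[ N ] ∀ n → N ℕ.≤ n → ℚ.∣ f n ℚ.- c₁[-x/3] ∣ ℚ.< ε

open _⇾_ public

∣-∣-triangle : ∀ a b c → ℚ.∣ a ℚ.- c ∣ ℚ.≤ ℚ.∣ a ℚ.- b ∣ ℚ.+ ℚ.∣ b ℚ.- c ∣
∣-∣-triangle a b c = subst (ℚ._≤ ℚ.∣ a ℚ.- b ∣ ℚ.+ ℚ.∣ b ℚ.- c ∣)
  (cong ℚ.∣_∣ (solve 3 (λ a b c → (a :- b) :+ (b :- c) := a :- c) refl a b c))
  (ℚ.∣p+q∣≤∣p∣+∣q∣ (a ℚ.- b) (b ℚ.- c))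

⇾-cong : ∀ {f g a} → f ≗ g → f ⇾ a → g ⇾ a
⇾-cong {a = a} f≗g f⇾a .within ε 0<ε with N , close ← f⇾a .within ε 0<ε =
  N , λ n n≥ → subst (λ x → ℚ.∣ x ℚ.- a ∣ ℚ.< ε) (f≗g n) (close n n≥)

⇾-resp : ∀ {f a b} → a ≡ b → f ⇾ a → f ⇾ b
⇾-resp refl f⇾a = f⇾a

⇾-const : ∀ a → (λ _ → a) ⇾ a
⇾-const a .within ε 0<ε = 0 , λ n _ → subst (ℚ._< ε) (sym (cong ℚ.∣_∣ (ℚ.+-inverseʳ a))) 0<ε

⇾-+ : ∀ {f g a b} → f ⇾ a → g ⇾ b → (λ n → f n ℚ.+ g n) ⇾ a ℚ.+ b
⇾-+ {f} {g} {a} {b} f⇾a g⇾b .within ε 0<ε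
  with N₁ , F ← f⇾a .within (½ ℚ.* ε) (0<½* 0<ε) | N₂ , G ← g⇾b .within (½ ℚ.* ε) (0<½* 0<ε) =
  N₁ ⊔ N₂ , λ n n≥ → begin-strict
    ℚ.∣ (f n ℚ.+ g n) ℚ.- (a ℚ.+ b) ∣
      ≡⟨ cong ℚ.∣_∣ (solve 4 (λ x y a b → (x :+ y) :- (a :+ b) := (x :- a) :+ (y :- b)) refl (f n) (g n) a b) ⟩
    ℚ.∣ (f n ℚ.- a) ℚ.+ (g n ℚ.- b) ∣
      ≤⟨ ℚ.∣p+q∣≤∣p∣+∣q∣ (f n ℚ.- a) (g n ℚ.- b) ⟩
    ℚ.∣ f n ℚ.- a ∣ ℚ.+ ℚ.∣ g n ℚ.- b ∣
      <⟨ ℚ.+-mono-< (F n (ℕ.m⊔n≤o⇒m≤o N₁ N₂ n≥)) (G n (ℕ.m⊔n≤o⇒n≤o N₁ N₂ n≥)) ⟩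
    ½ ℚ.* ε ℚ.+ ½ ℚ.* ε
      ≡⟨ ½+½ ε ⟩
    ε ∎
  where
  open ℚ.≤-Reasoning

⇾0-bounded : ∀ {f g B} → 0ℚ ℚ.< B → f ⇾ 0ℚ → (∀ n → ℚ.∣ g n ∣ ℚ.≤ B ℚ.* ℚ.∣ f n ∣) → g ⇾ 0ℚ
⇾0-bounded {f} {g} {B} 0<B f⇾0 bound .within ε 0<ε
  with δ , 0<δ , Bδ≡ε ← divide {ε} {B} 0<ε 0<B
  with N , F ← f⇾0 .within δ 0<δ =
  N , λ n n≥ → begin-strict
    ℚ.∣ g n ℚ.- 0ℚ ∣  ≡⟨ cong ℚ.∣_∣ (ℚ.+-identityʳ (g n)) ⟩
    ℚ.∣ g n ∣         ≤⟨ bound n ⟩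
    B ℚ.* ℚ.∣ f n ∣   <⟨ ℚ.*-monoʳ-<-pos B {{ℚ.positive 0<B}} (subst (ℚ._< δ) (cong ℚ.∣_∣ (ℚ.+-identityʳ (f n))) (F n n≥)) ⟩
    B ℚ.* δ           ≡⟨ Bδ≡ε ⟩
    ε                 ∎
  where open ℚ.≤-Reasoning

⇾-shift0 : ∀ {f a} → f ⇾ a → (λ n → f n ℚ.- a) ⇾ 0ℚ
⇾-shift0 {f} {a} f⇾a .within ε 0<ε with N , F ← f⇾a .within ε 0<ε =
  N , λ n n≥ → subst (ℚ._< ε) (cong ℚ.∣_∣ (sym (ℚ.+-identityʳ (f n ℚ.- a)))) (F n n≥)

⇾-unshift0 : ∀ {f a} → (λ n → f n ℚ.- a) ⇾ 0ℚ → f ⇾ a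
⇾-unshift0 {f} {a} f⇾a .within ε 0<ε with N , F ← f⇾a .within ε 0<ε =
  N , λ n n≥ → subst (ℚ._< ε) (cong ℚ.∣_∣ (ℚ.+-identityʳ (f n ℚ.- a))) (F n n≥)

⇾-scale : ∀ {f a} b → f ⇾ a → (λ n → b ℚ.* f n) ⇾ b ℚ.* a
⇾-scale {f} {a} b f⇾a = ⇾-unshift0 $
  ⇾0-bounded {B = ℚ.∣ b ∣ ℚ.+ 1ℚ} (ℚ.+-mono-≤-< (ℚ.0≤∣p∣ b) 0<1) (⇾-shift0 f⇾a) λ n → begin
    ℚ.∣ b ℚ.* f n ℚ.- b ℚ.* a ∣
      ≡⟨ cong ℚ.∣_∣ (solve 3 (λ x a b → b :* x :- b :* a := b :* (x :- a)) refl (f n) a b) ⟩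
    ℚ.∣ b ℚ.* (f n ℚ.- a) ∣
      ≡⟨ ℚ.∣p*q∣≡∣p∣*∣q∣ b (f n ℚ.- a) ⟩
    ℚ.∣ b ∣ ℚ.* ℚ.∣ f n ℚ.- a ∣
      ≤⟨ ℚ.*-monoʳ-≤-nonNeg ℚ.∣ f n ℚ.- a ∣ {{ℚ.nonNegative (ℚ.0≤∣p∣ (f n ℚ.- a))}}
           (subst (ℚ._≤ ℚ.∣ b ∣ ℚ.+ 1ℚ) (ℚ.+-identityʳ ℚ.∣ b ∣) (ℚ.+-monoʳ-≤ ℚ.∣ b ∣ (ℚ.<⇒≤ 0<1))) ⟩
    (ℚ.∣ b ∣ ℚ.+ 1ℚ) ℚ.* ℚ.∣ f n ℚ.- a ∣ ∎
  where
  open ℚ.≤-Reasoning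

⇾0-* : ∀ {f g} → f ⇾ 0ℚ → g ⇾ 0ℚ → (λ n → f n ℚ.* g n) ⇾ 0ℚ
⇾0-* {f} {g} f⇾0 g⇾0 .within ε 0<ε with N₁ , F ← f⇾0 .within 1ℚ 0<1 | N₂ , G ← g⇾0 .within ε 0<ε =
  N₁ ⊔ N₂ , λ n n≥ → begin-strict
    ℚ.∣ f n ℚ.* g n ℚ.- 0ℚ ∣
      ≡⟨ trans (cong ℚ.∣_∣ (ℚ.+-identityʳ (f n ℚ.* g n))) (ℚ.∣p*q∣≡∣p∣*∣q∣ (f n) (g n)) ⟩
    ℚ.∣ f n ∣ ℚ.* ℚ.∣ g n ∣
      ≤⟨ ℚ.*-monoʳ-≤-nonNeg ℚ.∣ g n ∣ {{ℚ.nonNegative (ℚ.0≤∣p∣ (g n))}}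
           (ℚ.<⇒≤ (subst (ℚ._< 1ℚ) (cong ℚ.∣_∣ (ℚ.+-identityʳ (f n))) (F n (ℕ.m⊔n≤o⇒m≤o N₁ N₂ n≥)))) ⟩
    1ℚ ℚ.* ℚ.∣ g n ∣
      ≡⟨ ℚ.*-identityˡ ℚ.∣ g n ∣ ⟩
    ℚ.∣ g n ∣
      <⟨ subst (ℚ._< ε) (cong ℚ.∣_∣ (ℚ.+-identityʳ (g n))) (G n (ℕ.m⊔n≤o⇒n≤o N₁ N₂ n≥)) ⟩
    ε ∎
  where open ℚ.≤-Reasoning

⇾-* : ∀ {f g a b} → f ⇾ a → g ⇾ b → (λ n → f n ℚ.* g n) ⇾ a ℚ.* b
⇾-* {f} {g} {a} {b} f⇾a g⇾b = ⇾-cong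
  (λ n → solve 4 (λ x y a b → (x :- a) :* (y :- b) :+ (a :* y :+ b :* (x :- a)) := x :* y) refl (f n) (g n) a b)
  (⇾-resp (solve 2 (λ a b → con 0ℚ :+ (a :* b :+ b :* con 0ℚ) := a :* b) refl a b)
    (⇾-+ (⇾0-* (⇾-shift0 f⇾a) (⇾-shift0 g⇾b)) (⇾-+ (⇾-scale a g⇾b) (⇾-scale b (⇾-shift0 f⇾a)))))

⇾-+-index : ∀ {f a} k → f ⇾ a → (λ n → f (k + n)) ⇾ a
⇾-+-index k f⇾a .within ε 0<ε with N , F ← f⇾a .within ε 0<ε = N , λ n n≥ → F (k + n) (ℕ.≤-trans n≥ (ℕ.m≤n+m n k))

/suc⇾0 : ∀ c → (λ n → + c / suc n) ⇾ 0ℚ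
/suc⇾0 c .within ε 0<ε with N , small ← /<ε c ε 0<ε =
  N , λ n n≥ → subst (ℚ._< ε) (sym (trans (cong ℚ.∣_∣ (ℚ.+-identityʳ (+ c / suc n))) (ℚ.0≤p⇒∣p∣≡p (0≤/ c (suc n))))) (small n n≥)

-- Alternating sums

alternating-cong : ∀ {a b} → a ≗ b → ∀ n → alternating a n ≡ alternating b n
alternating-cong eq zero    = refl
alternating-cong eq (suc n) = cong₂ ℚ._-_ (eq 0) (alternating-cong (eq ∘ suc) n)

alternating-+ : ∀ a b n → alternating (λ k → a k ℚ.+ b k) n ≡ alternating a n ℚ.+ alternating b n
alternating-+ a b zero    = refl
alternating-+ a b (suc n) = trans
  (cong (λ s → a 0 ℚ.+ b 0 ℚ.- s) (alternating-+ (a ∘ suc) (b ∘ suc) n))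
  (solve 4 (λ a b s t → a :+ b :- (s :+ t) := (a :- s) :+ (b :- t)) refl
    (a 0) (b 0) (alternating (a ∘ suc) n) (alternating (b ∘ suc) n))

alternating-*ˡ : ∀ x a n → alternating (λ k → x ℚ.* a k) n ≡ x ℚ.* alternating a n
alternating-*ˡ x a zero    = sym (ℚ.*-zeroʳ x)
alternating-*ˡ x a (suc n) = trans
  (cong (λ s → x ℚ.* a 0 ℚ.- s) (alternating-*ˡ x (a ∘ suc) n))
  (solve 3 (λ x a s → x :* a :- x :* s := x :* (a :- s)) refl x (a 0) (alternating (a ∘ suc) n))

alternating-telescope : ∀ g n → g n ≡ 0ℚ → alternating (λ k → g k ℚ.+ g (suc k)) n ≡ g 0
alternating-telescope g zero    gₙ = sym gₙ
alternating-telescope g (suc n) gₙ = trans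
  (cong (λ s → g 0 ℚ.+ g 1 ℚ.- s) (alternating-telescope (g ∘ suc) n gₙ))
  (solve 2 (λ a b → a :+ b :- b := a) refl (g 0) (g 1))

alternating-drop : ∀ a n → a n ≡ 0ℚ → alternating a (suc n) ≡ alternating a n
alternating-drop a zero    aₙ = trans (ℚ.+-identityʳ (a 0)) aₙ
alternating-drop a (suc n) aₙ = cong (λ s → a 0 ℚ.- s) (alternating-drop (a ∘ suc) n aₙ)

-- The number m of summands is fixed; for the growing sums in `wallis-leibniz` a bound on the tails
-- comes in addition.
⇾-alternating : ∀ {f : ℕ → ℕ → ℚ} {a} → (∀ k → (λ n → f n k) ⇾ a k) → ∀ m → (λ n → alternating (f n) m) ⇾ alternating a m
⇾-alternating f⇾a zero    = ⇾-const 0ℚ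
⇾-alternating {f} {a} f⇾a (suc m) = ⇾-cong
  (λ n → cong (f n 0 ℚ.+_) (minus (alternating (f n ∘ suc) m)))
  (⇾-resp (cong (a 0 ℚ.+_) (minus (alternating (a ∘ suc) m)))
    (⇾-+ (f⇾a 0) (⇾-scale -1ℚ (⇾-alternating (f⇾a ∘ suc) m))))
  where
  minus : ∀ x → -1ℚ ℚ.* x ≡ ℚ.- x
  minus x = solve 1 (λ x → con -1ℚ :* x := :- x) refl x

-- Wallis' product from Leibniz' series

-- wz N k = N!² / ((N-k)! (N+k+1)!)
wz : ℕ → ℕ → ℚ
wz N zero    = + 1 / suc N
wz N (suc k) = wz N k ℚ.* (+ (N ∸ k) / suc (suc (N + k)))

wz-vanishes : ∀ N k → N ℕ.≤ k → wz N (suc k) ≡ 0ℚ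
wz-vanishes N k N≤k = trans (cong (wz N k ℚ.*_) (trans (cong (λ m → + m / suc (suc (N + k))) (ℕ.m≤n⇒m∸n≡0 N≤k)) 0/))
  (ℚ.*-zeroʳ (wz N k))
  where
  0/ : + 0 / suc (suc (N + k)) ≡ 0ℚ
  0/ = ℚ.≤-antisym (/-mono-≤ 0 (suc (suc (N + k))) 0 1 z≤n) (0≤/ 0 (suc (suc (N + k))))

fromℕℚ-∸ : ∀ {m n} → n ℕ.≤ m → fromℕℚ (m ∸ n) ≡ fromℕℚ m ℚ.- fromℕℚ n
fromℕℚ-∸ {m} {n} n≤m = trans
  (solve 2 (λ a b → b := a :+ b :- a) refl (fromℕℚ n) (fromℕℚ (m ∸ n)))
  (cong (ℚ._- fromℕℚ n) (trans (sym (fromℕℚ-+ n (m ∸ n))) (cong fromℕℚ (ℕ.m+[n∸m]≡n n≤m))))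

fromℕℚ-2+ : ∀ N k → fromℕℚ (suc (suc (N + k))) ≡ fromℕℚ N ℚ.+ fromℕℚ k ℚ.+ 2ℚ
fromℕℚ-2+ N k = trans (cong fromℕℚ (ℕ.+-comm 2 (N + k))) (trans (fromℕℚ-+ (N + k) 2) (cong (ℚ._+ 2ℚ) (fromℕℚ-+ N k)))

-- Valid beyond k = N as well: there the truncated `N ∸ k` is not the rational difference, but
-- `wz N k` is already zero.
wz-suc : ∀ N k → (fromℕℚ N ℚ.+ fromℕℚ k ℚ.+ 2ℚ) ℚ.* wz N (suc k) ≡ (fromℕℚ N ℚ.- fromℕℚ k) ℚ.* wz N k
wz-suc N k = trans (begin
  (fromℕℚ N ℚ.+ fromℕℚ k ℚ.+ 2ℚ) ℚ.* (wz N k ℚ.* r)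
    ≡⟨ cong (ℚ._* (wz N k ℚ.* r)) (fromℕℚ-2+ N k) ⟨
  fromℕℚ (suc (suc (N + k))) ℚ.* (wz N k ℚ.* r)
    ≡⟨ solve 3 (λ a z r → a :* (z :* r) := r :* a :* z) refl (fromℕℚ (suc (suc (N + k)))) (wz N k) r ⟩
  r ℚ.* fromℕℚ (suc (suc (N + k))) ℚ.* wz N k
    ≡⟨ cong (ℚ._* wz N k) (/-*-cancel (N ∸ k) (suc (suc (N + k)))) ⟩
  fromℕℚ (N ∸ k) ℚ.* wz N k ∎) truncated
  where
  open ≡-Reasoning
  r = + (N ∸ k) / suc (suc (N + k))
  truncated : fromℕℚ (N ∸ k) ℚ.* wz N k ≡ (fromℕℚ N ℚ.- fromℕℚ k) ℚ.* wz N k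
  truncated with ℕ.≤-<-connex k N
  ... | inj₁ k≤N = cong (ℚ._* wz N k) (fromℕℚ-∸ k≤N)
  truncated | inj₂ (s≤s {n = j} N≤j) rewrite wz-vanishes N j N≤j =
    trans (ℚ.*-zeroʳ (fromℕℚ (N ∸ suc j))) (sym (ℚ.*-zeroʳ (fromℕℚ N ℚ.- fromℕℚ (suc j))))

0≤wz : ∀ N k → 0ℚ ℚ.≤ wz N k
0≤wz N zero    = 0≤/ 1 (suc N)
0≤wz N (suc k) = 0≤* (0≤wz N k) (0≤/ (N ∸ k) (suc (suc (N + k))))

wz-antitone : ∀ N k → wz N (suc k) ℚ.≤ wz N k
wz-antitone N k = subst (wz N (suc k) ℚ.≤_) (ℚ.*-identityʳ (wz N k))
  (ℚ.*-monoˡ-≤-nonNeg (wz N k) {{ℚ.nonNegative (0≤wz N k)}} (/-mono-≤ (N ∸ k) (suc (suc (N + k))) 1 1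
    (ℕ.≤-trans (ℕ.≤-reflexive (ℕ.*-identityʳ (N ∸ k))) (ℕ.≤-trans (ℕ.m∸n≤m N k)
      (ℕ.≤-trans (ℕ.m≤m+n N k) (ℕ.≤-trans (ℕ.m≤n+m (N + k) 2) (ℕ.m≤m+n _ 0)))))))

-- The factorials give wz (N+1) k / wz N k = (N+1)² / ((N+1-k)(N+2+k)), cross-multiplied because
-- N+1-k vanishes at k = N+1.
wz-suc-N : ∀ N k → let x = fromℕℚ N ; y = fromℕℚ k in
  (1ℚ ℚ.+ x ℚ.- y) ℚ.* (2ℚ ℚ.+ x ℚ.+ y) ℚ.* wz (suc N) k ≡ (1ℚ ℚ.+ x) ℚ.* (1ℚ ℚ.+ x) ℚ.* wz N k
wz-suc-N N zero = begin
  (1ℚ ℚ.+ x ℚ.- 0ℚ) ℚ.* (2ℚ ℚ.+ x ℚ.+ 0ℚ) ℚ.* r′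
    ≡⟨ solve 2 (λ x r → (con 1ℚ :+ x :- con 0ℚ) :* (con 2ℚ :+ x :+ con 0ℚ) :* r := (con 1ℚ :+ x) :* (r :* (con 2ℚ :+ x))) refl x r′ ⟩
  (1ℚ ℚ.+ x) ℚ.* (r′ ℚ.* (2ℚ ℚ.+ x))
    ≡⟨ cong ((1ℚ ℚ.+ x) ℚ.*_) (trans (cong (r′ ℚ.*_) (sym (fromℕℚ-+ 2 N))) (/-*-cancel 1 (suc (suc N)))) ⟩
  (1ℚ ℚ.+ x) ℚ.* 1ℚ
    ≡⟨ cong ((1ℚ ℚ.+ x) ℚ.*_) (trans (cong (r ℚ.*_) (sym (fromℕℚ-suc N))) (/-*-cancel 1 (suc N))) ⟨
  (1ℚ ℚ.+ x) ℚ.* (r ℚ.* (1ℚ ℚ.+ x))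
    ≡⟨ solve 2 (λ x r → (con 1ℚ :+ x) :* (r :* (con 1ℚ :+ x)) := (con 1ℚ :+ x) :* (con 1ℚ :+ x) :* r) refl x r ⟩
  (1ℚ ℚ.+ x) ℚ.* (1ℚ ℚ.+ x) ℚ.* r ∎
  where
  open ≡-Reasoning
  x = fromℕℚ N
  r′ = + 1 / suc (suc N)
  r = + 1 / suc N
wz-suc-N N (suc k) = *-cancelˡ-≡ (x ℚ.+ y ℚ.+ 2ℚ) (subst (0ℚ ℚ.<_) (fromℕℚ-2+ N k) (0<fromℕℚ-suc (suc (N + k)))) $ begin
  s ℚ.* ((1ℚ ℚ.+ x ℚ.- fromℕℚ (suc k)) ℚ.* (2ℚ ℚ.+ x ℚ.+ fromℕℚ (suc k)) ℚ.* Z′)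
    ≡⟨ cong (λ u → s ℚ.* ((1ℚ ℚ.+ x ℚ.- u) ℚ.* (2ℚ ℚ.+ x ℚ.+ u) ℚ.* Z′)) (fromℕℚ-suc k) ⟩
  s ℚ.* ((1ℚ ℚ.+ x ℚ.- (1ℚ ℚ.+ y)) ℚ.* (2ℚ ℚ.+ x ℚ.+ (1ℚ ℚ.+ y)) ℚ.* Z′)
    ≡⟨ solve 3 (λ x y z → (x :+ y :+ con 2ℚ) :* ((con 1ℚ :+ x :- (con 1ℚ :+ y)) :* (con 2ℚ :+ x :+ (con 1ℚ :+ y)) :* z)
         := (x :+ y :+ con 2ℚ) :* (x :- y) :* (((con 1ℚ :+ x) :+ y :+ con 2ℚ) :* z)) refl x y Z′ ⟩
  s ℚ.* (x ℚ.- y) ℚ.* (((1ℚ ℚ.+ x) ℚ.+ y ℚ.+ 2ℚ) ℚ.* Z′)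
    ≡⟨ cong (λ u → s ℚ.* (x ℚ.- y) ℚ.* ((u ℚ.+ y ℚ.+ 2ℚ) ℚ.* Z′)) (fromℕℚ-suc N) ⟨
  s ℚ.* (x ℚ.- y) ℚ.* ((fromℕℚ (suc N) ℚ.+ y ℚ.+ 2ℚ) ℚ.* Z′)
    ≡⟨ cong (s ℚ.* (x ℚ.- y) ℚ.*_) (trans (wz-suc (suc N) k) (cong (λ u → (u ℚ.- y) ℚ.* wz (suc N) k) (fromℕℚ-suc N))) ⟩
  s ℚ.* (x ℚ.- y) ℚ.* ((1ℚ ℚ.+ x ℚ.- y) ℚ.* wz (suc N) k)
    ≡⟨ solve 3 (λ x y z → (x :+ y :+ con 2ℚ) :* (x :- y) :* ((con 1ℚ :+ x :- y) :* z)
         := (x :- y) :* ((con 1ℚ :+ x :- y) :* (con 2ℚ :+ x :+ y) :* z)) refl x y (wz (suc N) k) ⟩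
  (x ℚ.- y) ℚ.* ((1ℚ ℚ.+ x ℚ.- y) ℚ.* (2ℚ ℚ.+ x ℚ.+ y) ℚ.* wz (suc N) k)
    ≡⟨ cong ((x ℚ.- y) ℚ.*_) (wz-suc-N N k) ⟩
  (x ℚ.- y) ℚ.* ((1ℚ ℚ.+ x) ℚ.* (1ℚ ℚ.+ x) ℚ.* wz N k)
    ≡⟨ solve 3 (λ x y z → (x :- y) :* ((con 1ℚ :+ x) :* (con 1ℚ :+ x) :* z) := (con 1ℚ :+ x) :* (con 1ℚ :+ x) :* ((x :- y) :* z)) refl x y (wz N k) ⟩
  (1ℚ ℚ.+ x) ℚ.* (1ℚ ℚ.+ x) ℚ.* ((x ℚ.- y) ℚ.* wz N k)
    ≡⟨ cong ((1ℚ ℚ.+ x) ℚ.* (1ℚ ℚ.+ x) ℚ.*_) (wz-suc N k) ⟨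
  (1ℚ ℚ.+ x) ℚ.* (1ℚ ℚ.+ x) ℚ.* (s ℚ.* wz N (suc k))
    ≡⟨ solve 3 (λ x s z → (con 1ℚ :+ x) :* (con 1ℚ :+ x) :* (s :* z) := s :* ((con 1ℚ :+ x) :* (con 1ℚ :+ x) :* z)) refl x s (wz N (suc k)) ⟩
  s ℚ.* ((1ℚ ℚ.+ x) ℚ.* (1ℚ ℚ.+ x) ℚ.* wz N (suc k)) ∎
  where
  open ≡-Reasoning
  x = fromℕℚ N
  y = fromℕℚ k
  s = x ℚ.+ y ℚ.+ 2ℚ
  Z′ = wz (suc N) (suc k)

odd : ℕ → ℚ
odd k = 1ℚ ℚ.+ 2ℚ ℚ.* fromℕℚ k

1/odd : ℕ → ℚ
1/odd k = + 1 / suc (2 * k)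

1/odd-odd : ∀ k → 1/odd k ℚ.* odd k ≡ 1ℚ
1/odd-odd k = trans (cong (1/odd k ℚ.*_) (sym (fromℕℚ-affine 1 2 k))) (/-*-cancel 1 (suc (2 * k)))

-- A telescoping certificate in the style of Wilf and Zeilberger: N + 1 times the summand is g k + g
-- (k+1), and g vanishes at both ends, at 0 by its factor k and at N + 2 by `wz-vanishes`.
alternating-odd-wz : ∀ N → alternating (λ k → odd k ℚ.* wz (suc N) k) (2 + N) ≡ 0ℚ
alternating-odd-wz N = *-cancelˡ-≡ M (0<fromℕℚ-suc N) $ begin
  M ℚ.* alternating (λ k → odd k ℚ.* wz (suc N) k) (2 + N)
    ≡⟨ alternating-*ˡ M (λ k → odd k ℚ.* wz (suc N) k) (2 + N) ⟨
  alternating (λ k → M ℚ.* (odd k ℚ.* wz (suc N) k)) (2 + N)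
    ≡⟨ alternating-cong step (2 + N) ⟩
  alternating (λ k → g k ℚ.+ g (suc k)) (2 + N)
    ≡⟨ alternating-telescope g (2 + N) (trans (cong ((M ℚ.+ fromℕℚ (2 + N) ℚ.+ 1ℚ) ℚ.* fromℕℚ (2 + N) ℚ.*_) (wz-vanishes (suc N) (suc N) ℕ.≤-refl))
         (ℚ.*-zeroʳ ((M ℚ.+ fromℕℚ (2 + N) ℚ.+ 1ℚ) ℚ.* fromℕℚ (2 + N)))) ⟩
  (M ℚ.+ 0ℚ ℚ.+ 1ℚ) ℚ.* 0ℚ ℚ.* wz (suc N) 0
    ≡⟨ solve 2 (λ m a → (m :+ con 0ℚ :+ con 1ℚ) :* con 0ℚ :* a := m :* con 0ℚ) refl M (wz (suc N) 0) ⟩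
  M ℚ.* 0ℚ ∎
  where
  open ≡-Reasoning
  M = fromℕℚ (suc N)
  g : ℕ → ℚ
  g k = (M ℚ.+ fromℕℚ k ℚ.+ 1ℚ) ℚ.* fromℕℚ k ℚ.* wz (suc N) k
  step : ∀ k → M ℚ.* (odd k ℚ.* wz (suc N) k) ≡ g k ℚ.+ g (suc k)
  step k = sym $ begin
    g k ℚ.+ (M ℚ.+ fromℕℚ (suc k) ℚ.+ 1ℚ) ℚ.* fromℕℚ (suc k) ℚ.* wz (suc N) (suc k)
      ≡⟨ cong (λ u → g k ℚ.+ (M ℚ.+ u ℚ.+ 1ℚ) ℚ.* u ℚ.* wz (suc N) (suc k)) (fromℕℚ-suc k) ⟩
    g k ℚ.+ (M ℚ.+ (1ℚ ℚ.+ y) ℚ.+ 1ℚ) ℚ.* (1ℚ ℚ.+ y) ℚ.* wz (suc N) (suc k)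
      ≡⟨ cong (g k ℚ.+_) (solve 3 (λ m y z → (m :+ (con 1ℚ :+ y) :+ con 1ℚ) :* (con 1ℚ :+ y) :* z
           := (con 1ℚ :+ y) :* ((m :+ y :+ con 2ℚ) :* z)) refl M y (wz (suc N) (suc k))) ⟩
    g k ℚ.+ (1ℚ ℚ.+ y) ℚ.* ((M ℚ.+ y ℚ.+ 2ℚ) ℚ.* wz (suc N) (suc k))
      ≡⟨ cong (λ u → g k ℚ.+ (1ℚ ℚ.+ y) ℚ.* u) (wz-suc (suc N) k) ⟩
    g k ℚ.+ (1ℚ ℚ.+ y) ℚ.* ((M ℚ.- y) ℚ.* wz (suc N) k)
      ≡⟨ solve 3 (λ m y z → (m :+ y :+ con 1ℚ) :* y :* z :+ (con 1ℚ :+ y) :* ((m :- y) :* z)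
           := m :* ((con 1ℚ :+ con 2ℚ :* y) :* z)) refl M y (wz (suc N) k) ⟩
    M ℚ.* (odd k ℚ.* wz (suc N) k) ∎
    where y = fromℕℚ k

-- The reciprocals of `c₃`, as `c₃-1/c₃` confirms; being a product, they are defined without
-- inverting `c₃`.
1/c₃ : ℕ → ℚ
1/c₃ zero    = 1ℚ
1/c₃ (suc N) = 1/c₃ N ℚ.* (+ (2 + 2 * N) / (3 + 2 * N))

1/c₃-suc : ∀ N → (3ℚ ℚ.+ 2ℚ ℚ.* fromℕℚ N) ℚ.* 1/c₃ (suc N) ≡ (2ℚ ℚ.+ 2ℚ ℚ.* fromℕℚ N) ℚ.* 1/c₃ N
1/c₃-suc N = begin
  (3ℚ ℚ.+ 2ℚ ℚ.* fromℕℚ N) ℚ.* (1/c₃ N ℚ.* r)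
    ≡⟨ cong (ℚ._* (1/c₃ N ℚ.* r)) (fromℕℚ-affine 3 2 N) ⟨
  fromℕℚ (3 + 2 * N) ℚ.* (1/c₃ N ℚ.* r)
    ≡⟨ solve 3 (λ a b r → a :* (b :* r) := (r :* a) :* b) refl (fromℕℚ (3 + 2 * N)) (1/c₃ N) r ⟩
  r ℚ.* fromℕℚ (3 + 2 * N) ℚ.* 1/c₃ N
    ≡⟨ cong (ℚ._* 1/c₃ N) (trans (/-*-cancel (2 + 2 * N) (3 + 2 * N)) (fromℕℚ-affine 2 2 N)) ⟩
  (2ℚ ℚ.+ 2ℚ ℚ.* fromℕℚ N) ℚ.* 1/c₃ N ∎
  where
  open ≡-Reasoning
  r = + (2 + 2 * N) / (3 + 2 * N)

wz/odd : ℕ → ℕ → ℚ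
wz/odd N k = wz N k ℚ.* 1/odd k

-- (2N+3)² - (2k+1)² = 4 (N+1-k) (N+2+k)
wz/odd-suc : ∀ N k → let x = fromℕℚ N ; t = 3ℚ ℚ.+ 2ℚ ℚ.* x ; u = 2ℚ ℚ.+ 2ℚ ℚ.* x in
  t ℚ.* t ℚ.* wz/odd (suc N) k ≡ u ℚ.* u ℚ.* wz/odd N k ℚ.+ odd k ℚ.* wz (suc N) k
wz/odd-suc N k = begin
  t ℚ.* t ℚ.* (Z′ ℚ.* r)
    ≡⟨ solve 4 (λ x y z r → let t = con 3ℚ :+ con 2ℚ :* x ; o = con 1ℚ :+ con 2ℚ :* y in
          t :* t :* (z :* r) := con 4ℚ :* ((con 1ℚ :+ x :- y) :* (con 2ℚ :+ x :+ y) :* z) :* r :+ o :* z :* (r :* o)) refl x y Z′ r ⟩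
  4ℚ ℚ.* ((1ℚ ℚ.+ x ℚ.- y) ℚ.* (2ℚ ℚ.+ x ℚ.+ y) ℚ.* Z′) ℚ.* r ℚ.+ odd k ℚ.* Z′ ℚ.* (r ℚ.* odd k)
    ≡⟨ cong₂ (λ a b → 4ℚ ℚ.* a ℚ.* r ℚ.+ odd k ℚ.* Z′ ℚ.* b) (wz-suc-N N k) (1/odd-odd k) ⟩
  4ℚ ℚ.* ((1ℚ ℚ.+ x) ℚ.* (1ℚ ℚ.+ x) ℚ.* wz N k) ℚ.* r ℚ.+ odd k ℚ.* Z′ ℚ.* 1ℚ
    ≡⟨ solve 4 (λ x z r w → let u = con 2ℚ :+ con 2ℚ :* x in
          con 4ℚ :* ((con 1ℚ :+ x) :* (con 1ℚ :+ x) :* z) :* r :+ w :* con 1ℚ := u :* u :* (z :* r) :+ w) refl x (wz N k) r (odd k ℚ.* Z′) ⟩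
  u ℚ.* u ℚ.* (wz N k ℚ.* r) ℚ.+ odd k ℚ.* Z′ ∎
  where
  open ≡-Reasoning
  x = fromℕℚ N
  y = fromℕℚ k
  r = 1/odd k
  Z′ = wz (suc N) k
  t = 3ℚ ℚ.+ 2ℚ ℚ.* x
  u = 2ℚ ℚ.+ 2ℚ ℚ.* x

-- The partial fraction expansion of N!² / (x-N)⋯(x+N) at x = 1/2.
alternating-wz/odd : ∀ N → alternating (wz/odd N) (suc N) ≡ 1/c₃ N ℚ.* 1/c₃ N
alternating-wz/odd zero    = refl
alternating-wz/odd (suc N) = *-cancelˡ-≡ (t ℚ.* t) 0<t² $ begin
  t ℚ.* t ℚ.* alternating (wz/odd (suc N)) (2 + N)
    ≡⟨ alternating-*ˡ (t ℚ.* t) (wz/odd (suc N)) (2 + N) ⟨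
  alternating (λ k → t ℚ.* t ℚ.* wz/odd (suc N) k) (2 + N)
    ≡⟨ alternating-cong (wz/odd-suc N) (2 + N) ⟩
  alternating (λ k → u ℚ.* u ℚ.* wz/odd N k ℚ.+ odd k ℚ.* wz (suc N) k) (2 + N)
    ≡⟨ trans (alternating-+ (λ k → u ℚ.* u ℚ.* wz/odd N k) (λ k → odd k ℚ.* wz (suc N) k) (2 + N))
         (cong (ℚ._+ alternating (λ k → odd k ℚ.* wz (suc N) k) (2 + N)) (alternating-*ˡ (u ℚ.* u) (wz/odd N) (2 + N))) ⟩
  u ℚ.* u ℚ.* alternating (wz/odd N) (2 + N) ℚ.+ alternating (λ k → odd k ℚ.* wz (suc N) k) (2 + N)
    -- The sum for N runs one term too far, but that term is zero, and the second sum vanishes. So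
    -- t² S (N+1) = u² S N, as for the squared product.
    ≡⟨ cong₂ (λ a b → u ℚ.* u ℚ.* a ℚ.+ b)
         (trans (alternating-drop (wz/odd N) (suc N) (trans (cong (ℚ._* 1/odd (suc N)) (wz-vanishes N N ℕ.≤-refl)) (ℚ.*-zeroˡ (1/odd (suc N))))) (alternating-wz/odd N))
         (alternating-odd-wz N) ⟩
  u ℚ.* u ℚ.* (1/c₃ N ℚ.* 1/c₃ N) ℚ.+ 0ℚ
    ≡⟨ solve 2 (λ u h → u :* u :* (h :* h) :+ con 0ℚ := (u :* h) :* (u :* h)) refl u (1/c₃ N) ⟩
  (u ℚ.* 1/c₃ N) ℚ.* (u ℚ.* 1/c₃ N)
    ≡⟨ cong₂ ℚ._*_ (1/c₃-suc N) (1/c₃-suc N) ⟨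
  (t ℚ.* 1/c₃ (suc N)) ℚ.* (t ℚ.* 1/c₃ (suc N))
    ≡⟨ solve 2 (λ u h → (u :* h) :* (u :* h) := u :* u :* (h :* h)) refl t (1/c₃ (suc N)) ⟩
  t ℚ.* t ℚ.* (1/c₃ (suc N) ℚ.* 1/c₃ (suc N)) ∎
  where
  open ≡-Reasoning
  x = fromℕℚ N
  t = 3ℚ ℚ.+ 2ℚ ℚ.* x
  u = 2ℚ ℚ.+ 2ℚ ℚ.* x
  0<t : 0ℚ ℚ.< t
  0<t = subst (0ℚ ℚ.<_) (fromℕℚ-affine 3 2 N) (0<fromℕℚ-suc (2 + 2 * N))
  0<t² : 0ℚ ℚ.< t ℚ.* t
  0<t² = 0<* 0<t 0<t

-- Twice the product of (2j)²/((2j-1)(2j+1)) over 1 ≤ j ≤ N.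
wallis : ℕ → ℚ
wallis N = 2ℚ ℚ.* odd N ℚ.* (1/c₃ N ℚ.* 1/c₃ N)

wallisTerm : ℕ → ℕ → ℚ
wallisTerm N k = 2ℚ ℚ.* odd N ℚ.* wz/odd N k

wallis-alternating : ∀ N → wallis N ≡ alternating (wallisTerm N) (suc N)
wallis-alternating N = begin
  o ℚ.* (1/c₃ N ℚ.* 1/c₃ N)                         ≡⟨ cong (o ℚ.*_) (alternating-wz/odd N) ⟨
  o ℚ.* c₁[-x/3]                                     ≡⟨ alternating-*ˡ o (wz/odd N) (suc N) ⟨
  alternating (wallisTerm N) (suc N)                ∎
  where
  open ≡-Reasoning
  o = 2ℚ ℚ.* odd N
  -- A local abbreviation, not the series of that name defined below.
  c₁[-x/3] = alternating (wz/odd N) (suc N)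

0≤odd : ∀ N → 0ℚ ℚ.≤ odd N
0≤odd N = subst (0ℚ ℚ.≤_) (fromℕℚ-affine 1 2 N) (ℚ.<⇒≤ (0<fromℕℚ-suc (2 * N)))

1/odd-antitone : ∀ k → 1/odd (suc k) ℚ.≤ 1/odd k
1/odd-antitone k = /-mono-≤ 1 (suc (2 * suc k)) 1 (suc (2 * k)) (ℕ.*-monoʳ-≤ 1 (s≤s (ℕ.*-monoʳ-≤ 2 (ℕ.n≤1+n k))))

-- Lets `alternating-tail` bound the tails of every sum by their first terms, uniformly in N.
wallisTerm-antitone : ∀ N → Antitone (wallisTerm N)
wallisTerm-antitone N k = 0≤* 0≤o (0≤* (0≤wz N k) (0≤/ 1 (suc (2 * k)))) ,
  ℚ.*-monoˡ-≤-nonNeg (2ℚ ℚ.* odd N) {{ℚ.nonNegative 0≤o}}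
    (*-mono-≤ (0≤wz N (suc k)) (0≤/ 1 (suc (2 * k))) (wz-antitone N k) (1/odd-antitone k))
  where
  0≤o : 0ℚ ℚ.≤ 2ℚ ℚ.* odd N
  0≤o = 0≤* (0≤/ 2 1) (0≤odd N)

-- (2N+1)/(N+1) tends to 2, and each step in k multiplies by (N-k)/(N+k+2) = 1 - (2k+2)/(N+k+2),
-- which tends to 1.
wz⇾ : ∀ k → (λ N → odd N ℚ.* wz N k) ⇾ 2ℚ
wz⇾ zero    = ⇾-cong eq (⇾-+ (⇾-const 2ℚ) (⇾-scale -1ℚ (/suc⇾0 1)))
  where
  open ≡-Reasoning
  eq : ∀ N → 2ℚ ℚ.+ -1ℚ ℚ.* (+ 1 / suc N) ≡ odd N ℚ.* (+ 1 / suc N)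
  eq N = begin
    2ℚ ℚ.+ -1ℚ ℚ.* r
      ≡⟨ solve 1 (λ r → con 2ℚ :+ con -1ℚ :* r := con 2ℚ :* con 1ℚ :+ con -1ℚ :* r) refl r ⟩
    2ℚ ℚ.* 1ℚ ℚ.+ -1ℚ ℚ.* r
      ≡⟨ cong (λ a → 2ℚ ℚ.* a ℚ.+ -1ℚ ℚ.* r) (trans (cong (r ℚ.*_) (sym (fromℕℚ-suc N))) (/-*-cancel 1 (suc N))) ⟨
    2ℚ ℚ.* (r ℚ.* (1ℚ ℚ.+ fromℕℚ N)) ℚ.+ -1ℚ ℚ.* r
      ≡⟨ solve 2 (λ r x → con 2ℚ :* (r :* (con 1ℚ :+ x)) :+ con -1ℚ :* r := (con 1ℚ :+ con 2ℚ :* x) :* r) refl r (fromℕℚ N) ⟩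
    odd N ℚ.* r ∎
    where r = + 1 / suc N
wz⇾ (suc k) = ⇾-cong eq (⇾-* (wz⇾ k) (⇾-+ (⇾-const 1ℚ) (⇾-scale -1ℚ (⇾-+-index (suc k) (/suc⇾0 (2 + 2 * k))))))
  where
  open ≡-Reasoning
  eq : ∀ N → odd N ℚ.* wz N k ℚ.* (1ℚ ℚ.+ -1ℚ ℚ.* (+ (2 + 2 * k) / suc (suc k + N))) ≡ odd N ℚ.* wz N (suc k)
  eq N = *-cancelˡ-≡ q (subst (0ℚ ℚ.<_) q≡ (0<fromℕℚ-suc (suc k + N))) $ begin
    q ℚ.* (odd N ℚ.* wz N k ℚ.* (1ℚ ℚ.+ -1ℚ ℚ.* r))
      ≡⟨ solve 4 (λ q o z r → q :* (o :* z :* (con 1ℚ :+ con -1ℚ :* r)) := o :* ((q :- r :* q) :* z)) refl q (odd N) (wz N k) r ⟩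
    odd N ℚ.* ((q ℚ.- r ℚ.* q) ℚ.* wz N k)
      ≡⟨ cong (λ a → odd N ℚ.* ((q ℚ.- a) ℚ.* wz N k)) (trans (cong (r ℚ.*_) (sym q≡)) (trans (/-*-cancel (2 + 2 * k) (suc (suc k + N))) (fromℕℚ-affine 2 2 k))) ⟩
    odd N ℚ.* ((q ℚ.- (2ℚ ℚ.+ 2ℚ ℚ.* y)) ℚ.* wz N k)
      ≡⟨ solve 4 (λ x y o z → o :* ((x :+ y :+ con 2ℚ :- (con 2ℚ :+ con 2ℚ :* y)) :* z) := o :* ((x :- y) :* z)) refl x y (odd N) (wz N k) ⟩
    odd N ℚ.* ((x ℚ.- y) ℚ.* wz N k)
      ≡⟨ cong (odd N ℚ.*_) (wz-suc N k) ⟨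
    odd N ℚ.* (q ℚ.* wz N (suc k))
      ≡⟨ solve 3 (λ o q z → o :* (q :* z) := q :* (o :* z)) refl (odd N) q (wz N (suc k)) ⟩
    q ℚ.* (odd N ℚ.* wz N (suc k)) ∎
    where
    x = fromℕℚ N
    y = fromℕℚ k
    q = x ℚ.+ y ℚ.+ 2ℚ
    r = + (2 + 2 * k) / suc (suc k + N)
    q≡ : fromℕℚ (suc (suc k + N)) ≡ q
    q≡ = trans (cong (λ m → fromℕℚ (suc (suc m))) (ℕ.+-comm k N)) (fromℕℚ-2+ N k)

wallisTerm⇾leibniz : ∀ k → (λ N → wallisTerm N k) ⇾ leibniz k
wallisTerm⇾leibniz k = ⇾-cong
  (λ N → solve 3 (λ r o z → con 2ℚ :* r :* (o :* z) := con 2ℚ :* o :* (z :* r)) refl (1/odd k) (odd N) (wz N k))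
  (⇾-resp eq (⇾-scale (2ℚ ℚ.* 1/odd k) (wz⇾ k)))
  where
  open ≡-Reasoning
  eq : 2ℚ ℚ.* 1/odd k ℚ.* 2ℚ ≡ leibniz k
  eq = *-cancelˡ-≡ (fromℕℚ (suc (2 * k))) (0<fromℕℚ-suc (2 * k)) $ begin
    fromℕℚ (suc (2 * k)) ℚ.* (2ℚ ℚ.* 1/odd k ℚ.* 2ℚ)
      ≡⟨ solve 2 (λ n r → n :* (con 2ℚ :* r :* con 2ℚ) := con 4ℚ :* (r :* n)) refl (fromℕℚ (suc (2 * k))) (1/odd k) ⟩
    4ℚ ℚ.* (1/odd k ℚ.* fromℕℚ (suc (2 * k)))
      ≡⟨ cong (4ℚ ℚ.*_) (/-*-cancel 1 (suc (2 * k))) ⟩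
    4ℚ
      ≡⟨ /-*-cancel 4 (suc (2 * k)) ⟨
    leibniz k ℚ.* fromℕℚ (suc (2 * k))
      ≡⟨ ℚ.*-comm (leibniz k) (fromℕℚ (suc (2 * k))) ⟩
    fromℕℚ (suc (2 * k)) ℚ.* leibniz k ∎

alternating-tail-≤ : ∀ {a} → Antitone a → ∀ {m n} → m ℕ.≤ n → ℚ.∣ alternating a n ℚ.- alternating a m ∣ ℚ.≤ a m
alternating-tail-≤ anti {m} m≤n with j , refl ← ℕ.m≤n⇒∃[o]m+o≡n m≤n = alternating-tail anti m j

-- Tannery's argument: cut both alternating sums at a common M. The first M terms converge one by
-- one, and the tails are bounded by `leibniz M` and `wallisTerm N M`, the latter close to the
-- former. As the limit is no rational, approximants of `π` take its place, with an index m of their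
-- own.
wallis-leibniz : ∀ ε → 0ℚ ℚ.< ε → ∃[ K ] ∀ N m → K ℕ.≤ N → K ℕ.≤ m → ℚ.∣ approx π m ℚ.- wallis N ∣ ℚ.< ε
wallis-leibniz ε 0<ε =
  let
    M , small = /<ε 4 q 0<q
    N₁ , P    = ⇾-alternating wallisTerm⇾leibniz M .within q 0<q
    N₂ , Q    = wallisTerm⇾leibniz M .within q 0<q
  in
  M ⊔ (N₁ ⊔ N₂) , λ N m N≥ m≥ →
    let
      N≥M = ℕ.m⊔n≤o⇒m≤o M (N₁ ⊔ N₂) N≥
      N≥₁₂ = ℕ.m⊔n≤o⇒n≤o M (N₁ ⊔ N₂) N≥
      leib<q : leibniz M ℚ.< q
      leib<q = small (2 * M) (ℕ.m≤m+n M (M + 0))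
      Pi = alternating leibniz m
      F = alternating (wallisTerm N)
      -- Local name of a Leibniz partial sum, not the series `edgeSum` below.
      edgeSum = alternating leibniz M
    in begin-strict
    ℚ.∣ Pi ℚ.- wallis N ∣
      ≡⟨ cong (λ x → ℚ.∣ Pi ℚ.- x ∣) (wallis-alternating N) ⟩
    ℚ.∣ Pi ℚ.- F (suc N) ∣
      ≤⟨ ∣-∣-triangle Pi edgeSum (F (suc N)) ⟩
    ℚ.∣ Pi ℚ.- edgeSum ∣ ℚ.+ ℚ.∣ edgeSum ℚ.- F (suc N) ∣
      ≤⟨ ℚ.+-monoʳ-≤ ℚ.∣ Pi ℚ.- edgeSum ∣ (∣-∣-triangle edgeSum (F M) (F (suc N))) ⟩
    ℚ.∣ Pi ℚ.- edgeSum ∣ ℚ.+ (ℚ.∣ edgeSum ℚ.- F M ∣ ℚ.+ ℚ.∣ F M ℚ.- F (suc N) ∣)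
      -- The Leibniz tail and the first M terms cost q each; the other tail costs `wallisTerm N M` <
      -- `leibniz M` + q < 2q.
      <⟨ ℚ.+-mono-≤-< (ℚ.<⇒≤ (ℚ.≤-<-trans (alternating-tail-≤ {leibniz} leibniz-antitone (ℕ.m⊔n≤o⇒m≤o M (N₁ ⊔ N₂) m≥)) leib<q))
           (ℚ.+-mono-< (subst (ℚ._< q) (∣∣-sym (F M) edgeSum) (P N (ℕ.m⊔n≤o⇒m≤o N₁ N₂ N≥₁₂)))
             (ℚ.≤-<-trans (subst (ℚ._≤ wallisTerm N M) (∣∣-sym (F (suc N)) (F M)) (alternating-tail-≤ {wallisTerm N} (wallisTerm-antitone N) (ℕ.m≤n⇒m≤1+n N≥M)))
               (ℚ.<-trans (-<⇒<+ (wallisTerm N M) (leibniz M) (ℚ.≤-<-trans (p≤∣p∣ (wallisTerm N M ℚ.- leibniz M)) (Q N (ℕ.m⊔n≤o⇒n≤o N₁ N₂ N≥₁₂))))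
                 (ℚ.+-monoˡ-< q leib<q)))) ⟩
    q ℚ.+ (q ℚ.+ (q ℚ.+ q))
      ≡⟨ solve 1 (λ e → con ¼ :* e :+ (con ¼ :* e :+ (con ¼ :* e :+ con ¼ :* e)) := e) refl ε ⟩
    ε ∎
  where
  open ℚ.≤-Reasoning
  q = ¼ ℚ.* ε
  0<q : 0ℚ ℚ.< q
  0<q = 0<* (/-mono-< 0 1 1 4 (s≤s z≤n)) 0<ε

-- Order lemmas for rationals

*-cancelˡ-≤ : ∀ {a b} c → 0ℚ ℚ.< c → c ℚ.* a ℚ.≤ c ℚ.* b → a ℚ.≤ b
*-cancelˡ-≤ c 0<c le = ℚ.*-cancelˡ-≤-pos c {{ℚ.positive 0<c}} le

*-monoˡ-≤ : ∀ {a b} c → 0ℚ ℚ.≤ c → a ℚ.≤ b → c ℚ.* a ℚ.≤ c ℚ.* b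
*-monoˡ-≤ c 0≤c₁ le = ℚ.*-monoˡ-≤-nonNeg c {{ℚ.nonNegative 0≤c₁}} le

*-monoʳ-≤ : ∀ {a b} c → 0ℚ ℚ.≤ c → a ℚ.≤ b → a ℚ.* c ℚ.≤ b ℚ.* c
*-monoʳ-≤ c 0≤c₁ le = ℚ.*-monoʳ-≤-nonNeg c {{ℚ.nonNegative 0≤c₁}} le

≤⇒0≤- : ∀ {a b} → a ℚ.≤ b → 0ℚ ℚ.≤ b ℚ.- a
≤⇒0≤- {a} {b} a≤b = subst (ℚ._≤ b ℚ.- a) (ℚ.+-inverseʳ a) (ℚ.+-monoˡ-≤ (ℚ.- a) a≤b)

0≤-⇒≤ : ∀ {a b} → 0ℚ ℚ.≤ b ℚ.- a → a ℚ.≤ b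
0≤-⇒≤ {a} {b} le = subst₂ ℚ._≤_ (ℚ.+-identityˡ a) (solve 2 (λ a b → b :- a :+ a := b) refl a b) (ℚ.+-monoˡ-≤ a le)

∣-∣≡ : ∀ {a b} → a ℚ.≤ b → ℚ.∣ a ℚ.- b ∣ ≡ b ℚ.- a
∣-∣≡ {a} {b} a≤b = trans (∣∣-sym a b) (ℚ.0≤p⇒∣p∣≡p (≤⇒0≤- a≤b))

Σ≤-∣∣ : ∀ n {f g : ℕ → ℚ} → (∀ k → k ℕ.≤ n → ℚ.∣ f k ∣ ℚ.≤ g k) → ℚ.∣ Σ≤ n f ∣ ℚ.≤ Σ≤ n g
Σ≤-∣∣ zero    bound = bound 0 z≤n
Σ≤-∣∣ (suc n) {f} {g} bound = ℚ.≤-trans (ℚ.∣p+q∣≤∣p∣+∣q∣ (Σ≤ n f) (f (suc n)))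
  (ℚ.+-mono-≤ (Σ≤-∣∣ n (λ k k≤n → bound k (ℕ.m≤n⇒m≤1+n k≤n))) (bound (suc n) ℕ.≤-refl))

⇾0-squeeze : ∀ {f} c → (∀ n → ℚ.∣ f n ∣ ℚ.≤ + c / suc n) → f ⇾ 0ℚ
⇾0-squeeze {f} c bound = ⇾0-bounded {λ n → + c / suc n} {f} {1ℚ} 0<1 (/suc⇾0 c) λ n →
  ℚ.≤-trans (bound n) (ℚ.≤-reflexive (sym (trans (ℚ.*-identityˡ _) (ℚ.0≤p⇒∣p∣≡p (0≤/ c (suc n))))))

≤/suc : ∀ {x} c n → fromℕℚ (suc n) ℚ.* x ℚ.≤ fromℕℚ c → x ℚ.≤ + c / suc n
≤/suc {x} c n le = *-cancelˡ-≤ (fromℕℚ (suc n)) (0<fromℕℚ-suc n)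
  (ℚ.≤-trans le (ℚ.≤-reflexive (sym (trans (ℚ.*-comm (fromℕℚ (suc n)) (+ c / suc n)) (/-*-cancel c (suc n))))))

-- The value of 1/√(1-x) at x = -1/3

⅓ -⅓ : ℚ
⅓ = + 1 / 3
-⅓ = ℚ.- ⅓

0≤⅓^ : ∀ n → 0ℚ ℚ.≤ ⅓ ^ℚ n
0≤⅓^ zero    = ℚ.<⇒≤ 0<1
0≤⅓^ (suc n) = 0≤* (0≤/ 1 3) (0≤⅓^ n)

∣-⅓^∣ : ∀ n → ℚ.∣ -⅓ ^ℚ n ∣ ≡ ⅓ ^ℚ n
∣-⅓^∣ zero    = refl
∣-⅓^∣ (suc n) = trans (ℚ.∣p*q∣≡∣p∣*∣q∣ -⅓ (-⅓ ^ℚ n)) (cong (⅓ ℚ.*_) (∣-⅓^∣ n))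

⅓^-+ : ∀ m n → ⅓ ^ℚ (m + n) ≡ ⅓ ^ℚ m ℚ.* ⅓ ^ℚ n
⅓^-+ zero    n = sym (ℚ.*-identityˡ (⅓ ^ℚ n))
⅓^-+ (suc m) n = trans (cong (⅓ ℚ.*_) (⅓^-+ m n)) (sym (ℚ.*-assoc ⅓ (⅓ ^ℚ m) (⅓ ^ℚ n)))

n⅓^n-bound : ∀ n → fromℕℚ (suc n) ℚ.* ⅓ ^ℚ n ℚ.≤ + 2 / suc n
n⅓^n-bound n = ≤/suc {fromℕℚ (suc n) ℚ.* ⅓ ^ℚ n} 2 n $ begin
  x ℚ.* (x ℚ.* p)                          ≡⟨ ℚ.*-assoc x x p ⟨
  x ℚ.* x ℚ.* p                            ≡⟨ cong (ℚ._* p) (fromℕℚ-* (suc n) (suc n)) ⟨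
  fromℕℚ (suc n * suc n) ℚ.* p             ≤⟨ *-monoʳ-≤ p (0≤⅓^ n) (fromℕℚ-mono-≤ {suc n * suc n} {2 * 3 ^ n} ([1+n]²≤2*3^n n)) ⟩
  fromℕℚ (2 * 3 ^ n) ℚ.* p                 ≡⟨ cong (ℚ._* p) (trans (fromℕℚ-* 2 (3 ^ n)) (cong (2ℚ ℚ.*_) (fromℕℚ-^ 3 n))) ⟩
  2ℚ ℚ.* 3ℚ ^ℚ n ℚ.* p         ≡⟨ ℚ.*-assoc 2ℚ (3ℚ ^ℚ n) p ⟩
  2ℚ ℚ.* (3ℚ ^ℚ n ℚ.* p)       ≡⟨ cong (2ℚ ℚ.*_) (inverse n) ⟩
  2ℚ                                 ∎
  where
  open ℚ.≤-Reasoning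
  x = fromℕℚ (suc n)
  p = ⅓ ^ℚ n
  inverse : ∀ n → 3ℚ ^ℚ n ℚ.* ⅓ ^ℚ n ≡ 1ℚ
  inverse zero    = refl
  inverse (suc n) = trans (solve 2 (λ a b → con 3ℚ :* a :* (con ⅓ :* b) := a :* b) refl (3ℚ ^ℚ n) (⅓ ^ℚ n)) (inverse n)

0≤c₁ : ∀ k → 0ℚ ℚ.≤ c₁ k
0≤c₁ zero    = ℚ.<⇒≤ 0<1
0≤c₁ (suc k) = 0≤* (0≤c₁ k) (0≤/ (1 + 2 * k) (2 + 2 * k))

c₁≤1 : ∀ k → c₁ k ℚ.≤ 1ℚ
c₁≤1 zero    = ℚ.≤-refl
c₁≤1 (suc k) = *-mono-≤ (0≤c₁ k) (ℚ.<⇒≤ 0<1) (c₁≤1 k)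
  (/-mono-≤ (1 + 2 * k) (2 + 2 * k) 1 1 (subst₂ ℕ._≤_ (sym (ℕ.*-identityʳ (1 + 2 * k))) (sym (ℕ.*-identityˡ (2 + 2 * k))) (ℕ.n≤1+n (1 + 2 * k))))

c₁[-x/3] : Series
c₁[-x/3] = scale -⅓ c₁

∣c₁[-x/3]∣≤ : ∀ k → ℚ.∣ c₁[-x/3] k ∣ ℚ.≤ ⅓ ^ℚ k
∣c₁[-x/3]∣≤ k = begin
  ℚ.∣ -⅓ ^ℚ k ℚ.* c₁ k ∣            ≡⟨ ℚ.∣p*q∣≡∣p∣*∣q∣ (-⅓ ^ℚ k) (c₁ k) ⟩
  ℚ.∣ -⅓ ^ℚ k ∣ ℚ.* ℚ.∣ c₁ k ∣      ≡⟨ cong₂ ℚ._*_ (∣-⅓^∣ k) (ℚ.0≤p⇒∣p∣≡p (0≤c₁ k)) ⟩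
  ⅓ ^ℚ k ℚ.* c₁ k                   ≤⟨ *-monoˡ-≤ (⅓ ^ℚ k) (0≤⅓^ k) (c₁≤1 k) ⟩
  ⅓ ^ℚ k ℚ.* 1ℚ                    ≡⟨ ℚ.*-identityʳ (⅓ ^ℚ k) ⟩
  ⅓ ^ℚ k                           ∎
  where open ℚ.≤-Reasoning

ones : Series
ones _ = 1ℚ

ones-inverse : ones *ₛ 1-x ≗ 1ₛ
ones-inverse n = trans (*ₛ-comm ones 1-x n) (inverse n)
  where
  inverse : 1-x *ₛ ones ≗ 1ₛ
  inverse zero    = refl
  inverse (suc n) = poly-linear (+ 1) (- + 1) ones n

ones-suc : ∀ f n → (f *ₛ ones) (suc n) ≡ (f *ₛ ones) n ℚ.+ f (suc n)
ones-suc f n = trans (*ₛ-sucʳ f ones n) (cong ((f *ₛ ones) n ℚ.+_) (ℚ.*-identityʳ (f (suc n))))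

c₁[-x/3]² : c₁[-x/3] *ₛ c₁[-x/3] ≗ scale -⅓ ones
c₁[-x/3]² = begin
  c₁[-x/3] *ₛ c₁[-x/3]                              ≈⟨ *-identityʳ (c₁[-x/3] *ₛ c₁[-x/3]) ⟨
  c₁[-x/3] *ₛ c₁[-x/3] *ₛ 1ₛ                        ≈⟨ *-congˡ {c₁[-x/3] *ₛ c₁[-x/3]} g-inverse ⟨
  c₁[-x/3] *ₛ c₁[-x/3] *ₛ (g *ₛ q)                  ≈⟨ solveₛ 3 (λ a g q → a ⊗ a ⊗ (g ⊗ q) ⊜ g ⊗ (a ⊗ a ⊗ q)) (λ _ → refl) c₁[-x/3] g q ⟩
  g *ₛ (c₁[-x/3] *ₛ c₁[-x/3] *ₛ q)                  ≈⟨ *-congˡ {g} (scale-c₁-inverse-square -⅓) ⟩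
  g *ₛ 1ₛ                             ≈⟨ *-identityʳ g ⟩
  g                                   ∎
  where
  open 𝕊
  g = scale -⅓ ones
  q = scale -⅓ 1-x
  g-inverse : g *ₛ q ≗ 1ₛ
  g-inverse = begin
    g *ₛ q                     ≈⟨ scale-* -⅓ ones 1-x ⟨
    scale -⅓ (ones *ₛ 1-x)     ≈⟨ scale-cong -⅓ ones-inverse ⟩
    scale -⅓ 1ₛ                ≈⟨ scale-1 -⅓ ⟩
    1ₛ                         ∎

-- Multiplication by `ones` = 1/(1-x) forms partial sums. Those of (1+x/3)^(-1/2) approach √3/2,
-- those of its square 1/(1+1/3) = 3/4, a limit inside ℚ.
Σc₁[-x/3] Σc₁[-x/3]² : Series
Σc₁[-x/3] = c₁[-x/3] *ₛ ones
Σc₁[-x/3]² = c₁[-x/3] *ₛ c₁[-x/3] *ₛ ones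

Σc₁[-x/3]²-closed : ∀ n → Σc₁[-x/3]² n ≡ + 3 / 4 ℚ.+ ¼ ℚ.* -⅓ ^ℚ n
Σc₁[-x/3]²-closed zero    = refl
Σc₁[-x/3]²-closed (suc n) = trans (ones-suc (c₁[-x/3] *ₛ c₁[-x/3]) n) (trans (cong₂ ℚ._+_ (Σc₁[-x/3]²-closed n) (c₁[-x/3]² (suc n)))
  (solve 1 (λ p → con (+ 3 / 4) :+ con ¼ :* p :+ con -⅓ :* p :* con 1ℚ := con (+ 3 / 4) :+ con ¼ :* (con -⅓ :* p)) refl (-⅓ ^ℚ n)))

⅓^≤ : ∀ n → ⅓ ^ℚ n ℚ.≤ + 2 / suc n
⅓^≤ n = ℚ.≤-trans (ℚ.≤-trans (ℚ.≤-reflexive (sym (ℚ.*-identityˡ (⅓ ^ℚ n))))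
  (*-monoʳ-≤ (⅓ ^ℚ n) (0≤⅓^ n) (fromℕℚ-mono-≤ {1} {suc n} (s≤s z≤n)))) (n⅓^n-bound n)

Σc₁[-x/3]²⇾ : Σc₁[-x/3]² ⇾ + 3 / 4
Σc₁[-x/3]²⇾ = ⇾-cong (λ n → sym (Σc₁[-x/3]²-closed n)) (⇾-+ (⇾-const (+ 3 / 4)) (⇾-scale ¼
  (⇾0-squeeze {λ n → -⅓ ^ℚ n} 2 (λ n → ℚ.≤-trans (ℚ.≤-reflexive (∣-⅓^∣ n)) (⅓^≤ n)))))

-- The bound is the exact value of the geometric sum of 3⁻ᵏ over m < k ≤ m + j.
Σc₁-tail : ∀ m j → ℚ.∣ Σc₁[-x/3] (m + j) ℚ.- Σc₁[-x/3] m ∣ ℚ.≤ ½ ℚ.* (⅓ ^ℚ m ℚ.- ⅓ ^ℚ (m + j))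
Σc₁-tail m zero    = ℚ.≤-reflexive (trans (cong (λ k → ℚ.∣ Σc₁[-x/3] k ℚ.- Σc₁[-x/3] m ∣) (ℕ.+-identityʳ m))
  (trans (cong ℚ.∣_∣ (ℚ.+-inverseʳ (Σc₁[-x/3] m))) (sym (trans (cong (λ k → ½ ℚ.* (⅓ ^ℚ m ℚ.- ⅓ ^ℚ k)) (ℕ.+-identityʳ m))
    (trans (cong (½ ℚ.*_) (ℚ.+-inverseʳ (⅓ ^ℚ m))) (ℚ.*-zeroʳ ½))))))
Σc₁-tail m (suc j) = subst (λ k → ℚ.∣ Σc₁[-x/3] k ℚ.- Σc₁[-x/3] m ∣ ℚ.≤ ½ ℚ.* (⅓ ^ℚ m ℚ.- ⅓ ^ℚ k)) (sym (ℕ.+-suc m j)) $ begin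
  ℚ.∣ Σc₁[-x/3] (suc n) ℚ.- Σc₁[-x/3] m ∣
    ≤⟨ ∣-∣-triangle (Σc₁[-x/3] (suc n)) (Σc₁[-x/3] n) (Σc₁[-x/3] m) ⟩
  ℚ.∣ Σc₁[-x/3] (suc n) ℚ.- Σc₁[-x/3] n ∣ ℚ.+ ℚ.∣ Σc₁[-x/3] n ℚ.- Σc₁[-x/3] m ∣
    ≡⟨ cong (λ x → ℚ.∣ x ∣ ℚ.+ ℚ.∣ Σc₁[-x/3] n ℚ.- Σc₁[-x/3] m ∣) (trans (cong (ℚ._- Σc₁[-x/3] n) (ones-suc c₁[-x/3] n)) (solve 2 (λ x y → x :+ y :- x := y) refl (Σc₁[-x/3] n) (c₁[-x/3] (suc n)))) ⟩
  ℚ.∣ c₁[-x/3] (suc n) ∣ ℚ.+ ℚ.∣ Σc₁[-x/3] n ℚ.- Σc₁[-x/3] m ∣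
    ≤⟨ ℚ.+-mono-≤ (∣c₁[-x/3]∣≤ (suc n)) (Σc₁-tail m j) ⟩
  ⅓ ℚ.* ⅓ ^ℚ n ℚ.+ ½ ℚ.* (⅓ ^ℚ m ℚ.- ⅓ ^ℚ n)
    ≡⟨ solve 2 (λ p q → con ⅓ :* q :+ con ½ :* (p :- q) := con ½ :* (p :- con ⅓ :* q)) refl (⅓ ^ℚ m) (⅓ ^ℚ n) ⟩
  ½ ℚ.* (⅓ ^ℚ m ℚ.- ⅓ ^ℚ suc n) ∎
  where
  open ℚ.≤-Reasoning
  n = m + j

Σc₁-tail-≤ : ∀ m j → ℚ.∣ Σc₁[-x/3] (m + j) ℚ.- Σc₁[-x/3] m ∣ ℚ.≤ ⅓ ^ℚ m
Σc₁-tail-≤ m j = ℚ.≤-trans (Σc₁-tail m j) (0≤-⇒≤ (subst (0ℚ ℚ.≤_)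
  (solve 2 (λ p q → con ½ :* p :+ con ½ :* q := p :- con ½ :* (p :- q)) refl (⅓ ^ℚ m) (⅓ ^ℚ (m + j)))
  (ℚ.+-mono-≤ (0≤* (0≤/ 1 2) (0≤⅓^ m)) (0≤* (0≤/ 1 2) (0≤⅓^ (m + j))))))

∣Σc₁∣≤2 : ∀ n → ℚ.∣ Σc₁[-x/3] n ∣ ℚ.≤ 2ℚ
∣Σc₁∣≤2 n = begin
  ℚ.∣ Σc₁[-x/3] n ∣                          ≡⟨ cong ℚ.∣_∣ (solve 2 (λ x y → x := (x :- y) :+ y) refl (Σc₁[-x/3] n) (Σc₁[-x/3] 0)) ⟩
  ℚ.∣ (Σc₁[-x/3] n ℚ.- Σc₁[-x/3] 0) ℚ.+ Σc₁[-x/3] 0 ∣        ≤⟨ ℚ.∣p+q∣≤∣p∣+∣q∣ (Σc₁[-x/3] n ℚ.- Σc₁[-x/3] 0) (Σc₁[-x/3] 0) ⟩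
  ℚ.∣ Σc₁[-x/3] n ℚ.- Σc₁[-x/3] 0 ∣ ℚ.+ 1ℚ           ≤⟨ ℚ.+-monoˡ-≤ 1ℚ (Σc₁-tail-≤ 0 n) ⟩
  2ℚ                           ∎
  where
  open ℚ.≤-Reasoning

-- The squared partial sum also contains the products with index sum above n; for a first index k
-- their second indices run from n - k + 1 to n.
Σc₁²-difference : ∀ n → Σc₁[-x/3] n ℚ.* Σc₁[-x/3] n ℚ.- Σc₁[-x/3]² n ≡ Σ[ k ≤ n ] c₁[-x/3] k ℚ.* (Σc₁[-x/3] n ℚ.- Σc₁[-x/3] (n ∸ k))
Σc₁²-difference n = sym $ begin
  Σ≤ n (λ k → c₁[-x/3] k ℚ.* (Σc₁[-x/3] n ℚ.- Σc₁[-x/3] (n ∸ k)))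
    ≡⟨ Σ≤-cong n (λ k → solve 3 (λ x y z → x :* (y :- z) := y :* (x :* con 1ℚ) :+ con -1ℚ :* (x :* z)) refl (c₁[-x/3] k) (Σc₁[-x/3] n) (Σc₁[-x/3] (n ∸ k))) ⟩
  Σ≤ n (λ k → Σc₁[-x/3] n ℚ.* (c₁[-x/3] k ℚ.* 1ℚ) ℚ.+ -1ℚ ℚ.* (c₁[-x/3] k ℚ.* Σc₁[-x/3] (n ∸ k)))
    ≡⟨ trans (Σ≤-+ n _ _) (cong₂ ℚ._+_ (Σ≤-*ˡ n (Σc₁[-x/3] n) _) (Σ≤-*ˡ n -1ℚ _)) ⟩
  Σc₁[-x/3] n ℚ.* Σc₁[-x/3] n ℚ.+ -1ℚ ℚ.* (c₁[-x/3] *ₛ Σc₁[-x/3]) n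
    ≡⟨ cong (λ x → Σc₁[-x/3] n ℚ.* Σc₁[-x/3] n ℚ.+ -1ℚ ℚ.* x) (*ₛ-assoc c₁[-x/3] c₁[-x/3] ones n) ⟨
  Σc₁[-x/3] n ℚ.* Σc₁[-x/3] n ℚ.+ -1ℚ ℚ.* Σc₁[-x/3]² n
    ≡⟨ solve 2 (λ x y → x :+ con -1ℚ :* y := x :- y) refl (Σc₁[-x/3] n ℚ.* Σc₁[-x/3] n) (Σc₁[-x/3]² n) ⟩
  Σc₁[-x/3] n ℚ.* Σc₁[-x/3] n ℚ.- Σc₁[-x/3]² n ∎
  where
  open ≡-Reasoning

Σ≤-const : ∀ n x → Σ≤ n (λ _ → x) ≡ fromℕℚ (suc n) ℚ.* x
Σ≤-const zero    x = sym (ℚ.*-identityˡ x)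
Σ≤-const (suc n) x = trans (cong (ℚ._+ x) (Σ≤-const n x)) (trans
  (solve 2 (λ n x → n :* x :+ x := (con 1ℚ :+ n) :* x) refl (fromℕℚ (suc n)) x) (cong (ℚ._* x) (sym (fromℕℚ-suc (suc n)))))

-- Each of the n + 1 surplus terms is at most 3⁻ᵏ · 3ᵏ⁻ⁿ = 3⁻ⁿ, and (n+1)/3ⁿ tends to 0.
Σc₁²⇾ : (λ n → Σc₁[-x/3] n ℚ.* Σc₁[-x/3] n) ⇾ + 3 / 4
Σc₁²⇾ = ⇾-cong (λ n → solve 2 (λ x y → y :+ (x :- y) := x) refl (Σc₁[-x/3] n ℚ.* Σc₁[-x/3] n) (Σc₁[-x/3]² n))
  (⇾-resp (ℚ.+-identityʳ (+ 3 / 4)) (⇾-+ Σc₁[-x/3]²⇾ (⇾0-squeeze {λ n → Σc₁[-x/3] n ℚ.* Σc₁[-x/3] n ℚ.- Σc₁[-x/3]² n} 2 bound)))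
  where
  bound : ∀ n → ℚ.∣ Σc₁[-x/3] n ℚ.* Σc₁[-x/3] n ℚ.- Σc₁[-x/3]² n ∣ ℚ.≤ + 2 / suc n
  bound n = begin
    ℚ.∣ Σc₁[-x/3] n ℚ.* Σc₁[-x/3] n ℚ.- Σc₁[-x/3]² n ∣
      ≡⟨ cong ℚ.∣_∣ (Σc₁²-difference n) ⟩
    ℚ.∣ Σ≤ n (λ k → c₁[-x/3] k ℚ.* (Σc₁[-x/3] n ℚ.- Σc₁[-x/3] (n ∸ k))) ∣
      ≤⟨ Σ≤-∣∣ n summand ⟩
    Σ≤ n (λ _ → ⅓ ^ℚ n)
      ≡⟨ Σ≤-const n (⅓ ^ℚ n) ⟩
    fromℕℚ (suc n) ℚ.* ⅓ ^ℚ n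
      ≤⟨ n⅓^n-bound n ⟩
    + 2 / suc n ∎
    where
    open ℚ.≤-Reasoning
    summand : ∀ k → k ℕ.≤ n → ℚ.∣ c₁[-x/3] k ℚ.* (Σc₁[-x/3] n ℚ.- Σc₁[-x/3] (n ∸ k)) ∣ ℚ.≤ ⅓ ^ℚ n
    summand k k≤n = begin
      ℚ.∣ c₁[-x/3] k ℚ.* (Σc₁[-x/3] n ℚ.- Σc₁[-x/3] (n ∸ k)) ∣
        ≡⟨ ℚ.∣p*q∣≡∣p∣*∣q∣ (c₁[-x/3] k) (Σc₁[-x/3] n ℚ.- Σc₁[-x/3] (n ∸ k)) ⟩
      ℚ.∣ c₁[-x/3] k ∣ ℚ.* ℚ.∣ Σc₁[-x/3] n ℚ.- Σc₁[-x/3] (n ∸ k) ∣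
        ≤⟨ *-mono-≤ (ℚ.0≤∣p∣ (c₁[-x/3] k)) (0≤⅓^ (n ∸ k)) (∣c₁[-x/3]∣≤ k)
             (subst (λ m → ℚ.∣ Σc₁[-x/3] m ℚ.- Σc₁[-x/3] (n ∸ k) ∣ ℚ.≤ ⅓ ^ℚ (n ∸ k)) (ℕ.m∸n+n≡m k≤n) (Σc₁-tail-≤ (n ∸ k) k)) ⟩
      ⅓ ^ℚ k ℚ.* ⅓ ^ℚ (n ∸ k)
        ≡⟨ ⅓^-+ k (n ∸ k) ⟨
      ⅓ ^ℚ (k + (n ∸ k))
        ≡⟨ cong (⅓ ^ℚ_) (ℕ.m+[n∸m]≡n k≤n) ⟩
      ⅓ ^ℚ n ∎

-- Growth of half the number of edges

c₃-suc : ∀ n → (2ℚ ℚ.+ 2ℚ ℚ.* fromℕℚ n) ℚ.* c₃ (suc n) ≡ (3ℚ ℚ.+ 2ℚ ℚ.* fromℕℚ n) ℚ.* c₃ n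
c₃-suc n = begin
  e ℚ.* ((1ℚ ℚ.+ 2ℚ ℚ.* fromℕℚ (suc n)) ℚ.* c₁ (suc n))
    ≡⟨ cong (λ y → e ℚ.* ((1ℚ ℚ.+ 2ℚ ℚ.* y) ℚ.* c₁ (suc n))) (fromℕℚ-suc n) ⟩
  e ℚ.* ((1ℚ ℚ.+ 2ℚ ℚ.* (1ℚ ℚ.+ x)) ℚ.* c₁ (suc n))
    ≡⟨ solve 3 (λ e x c → e :* ((con 1ℚ :+ con 2ℚ :* (con 1ℚ :+ x)) :* c) := (con 3ℚ :+ con 2ℚ :* x) :* (e :* c)) refl e x (c₁ (suc n)) ⟩
  (3ℚ ℚ.+ 2ℚ ℚ.* x) ℚ.* (e ℚ.* c₁ (suc n))
    ≡⟨ cong ((3ℚ ℚ.+ 2ℚ ℚ.* x) ℚ.*_) (c₁-suc n) ⟩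
  (3ℚ ℚ.+ 2ℚ ℚ.* x) ℚ.* c₃ n ∎
  where
  open ≡-Reasoning
  x = fromℕℚ n
  e = 2ℚ ℚ.+ 2ℚ ℚ.* x

0≤fromℕℚ : ∀ n → 0ℚ ℚ.≤ fromℕℚ n
0≤fromℕℚ n = 0≤/ n 1

0≤c₃ : ∀ n → 0ℚ ℚ.≤ c₃ n
0≤c₃ n = 0≤* (0≤odd n) (0≤c₁ n)

0<2+2n : ∀ n → 0ℚ ℚ.< 2ℚ ℚ.+ 2ℚ ℚ.* fromℕℚ n
0<2+2n n = subst (0ℚ ℚ.<_) (fromℕℚ-affine 2 2 n) (0<fromℕℚ-suc (1 + 2 * n))

c₃-mono-suc : ∀ n → c₃ n ℚ.≤ c₃ (suc n)
c₃-mono-suc n = *-cancelˡ-≤ e (0<2+2n n) (ℚ.≤-trans (0≤-⇒≤ (subst (0ℚ ℚ.≤_)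
  (solve 2 (λ x d → d := (con 3ℚ :+ con 2ℚ :* x) :* d :- (con 2ℚ :+ con 2ℚ :* x) :* d) refl (fromℕℚ n) (c₃ n))
  (0≤c₃ n))) (ℚ.≤-reflexive (sym (c₃-suc n))))
  where
  e = 2ℚ ℚ.+ 2ℚ ℚ.* fromℕℚ n

c₃-mono : ∀ m j → c₃ m ℚ.≤ c₃ (m + j)
c₃-mono m zero    = ℚ.≤-reflexive (cong c₃ (sym (ℕ.+-identityʳ m)))
c₃-mono m (suc j) = ℚ.≤-trans (c₃-mono m j) (subst (c₃ (m + j) ℚ.≤_) (cong c₃ (sym (ℕ.+-suc m j))) (c₃-mono-suc (m + j)))

-- c₃ grows like √n, so c₃ n / n decreases; this crude bound is enough for `c₃-ratio`.
c₃-growth-suc : ∀ n → fromℕℚ n ℚ.* c₃ (suc n) ℚ.≤ fromℕℚ (suc n) ℚ.* c₃ n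
c₃-growth-suc n = *-cancelˡ-≤ e (0<2+2n n) $ begin
  e ℚ.* (x ℚ.* c₃ (suc n))
    ≡⟨ solve 3 (λ e x d → e :* (x :* d) := x :* (e :* d)) refl e x (c₃ (suc n)) ⟩
  x ℚ.* (e ℚ.* c₃ (suc n))
    ≡⟨ cong (x ℚ.*_) (c₃-suc n) ⟩
  x ℚ.* ((3ℚ ℚ.+ 2ℚ ℚ.* x) ℚ.* c₃ n)
    ≤⟨ 0≤-⇒≤ (subst (0ℚ ℚ.≤_)
         (solve 2 (λ x d → (con 2ℚ :+ x) :* d := (con 2ℚ :+ con 2ℚ :* x) :* ((con 1ℚ :+ x) :* d) :- x :* ((con 3ℚ :+ con 2ℚ :* x) :* d)) refl x (c₃ n))
         (0≤* (ℚ.+-mono-≤ (0≤fromℕℚ 2) (0≤fromℕℚ n)) (0≤c₃ n))) ⟩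
  e ℚ.* ((1ℚ ℚ.+ x) ℚ.* c₃ n)
    ≡⟨ cong (λ y → e ℚ.* (y ℚ.* c₃ n)) (fromℕℚ-suc n) ⟨
  e ℚ.* (fromℕℚ (suc n) ℚ.* c₃ n) ∎
  where
  open ℚ.≤-Reasoning
  x = fromℕℚ n
  e = 2ℚ ℚ.+ 2ℚ ℚ.* x

c₃-growth : ∀ m j → fromℕℚ m ℚ.* c₃ (m + j) ℚ.≤ fromℕℚ (m + j) ℚ.* c₃ m
c₃-growth m zero    = ℚ.≤-reflexive (cong₂ (λ x y → fromℕℚ x ℚ.* c₃ y) (sym (ℕ.+-identityʳ m)) (ℕ.+-identityʳ m))
c₃-growth m (suc j) = *-cancelˡ-≤ (fromℕℚ (suc m)) (0<fromℕℚ-suc m) $ begin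
  fromℕℚ (suc m) ℚ.* (fromℕℚ m ℚ.* c₃ (m + suc j))
    ≡⟨ cong (λ k → fromℕℚ (suc m) ℚ.* (fromℕℚ m ℚ.* c₃ k)) (ℕ.+-suc m j) ⟩
  fromℕℚ (suc m) ℚ.* (fromℕℚ m ℚ.* c₃ (suc m + j))
    ≡⟨ solve 3 (λ x y z → x :* (y :* z) := y :* (x :* z)) refl (fromℕℚ (suc m)) (fromℕℚ m) (c₃ (suc m + j)) ⟩
  fromℕℚ m ℚ.* (fromℕℚ (suc m) ℚ.* c₃ (suc m + j))
    ≤⟨ *-monoˡ-≤ (fromℕℚ m) (0≤fromℕℚ m) (c₃-growth (suc m) j) ⟩
  fromℕℚ m ℚ.* (fromℕℚ (suc m + j) ℚ.* c₃ (suc m))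
    ≡⟨ solve 3 (λ x y z → x :* (y :* z) := y :* (x :* z)) refl (fromℕℚ m) (fromℕℚ (suc m + j)) (c₃ (suc m)) ⟩
  fromℕℚ (suc m + j) ℚ.* (fromℕℚ m ℚ.* c₃ (suc m))
    ≤⟨ *-monoˡ-≤ (fromℕℚ (suc m + j)) (0≤fromℕℚ (suc m + j)) (c₃-growth-suc m) ⟩
  fromℕℚ (suc m + j) ℚ.* (fromℕℚ (suc m) ℚ.* c₃ m)
    ≡⟨ solve 3 (λ x y z → x :* (y :* z) := y :* (x :* z)) refl (fromℕℚ (suc m + j)) (fromℕℚ (suc m)) (c₃ m) ⟩
  fromℕℚ (suc m) ℚ.* (fromℕℚ (suc m + j) ℚ.* c₃ m)
    ≡⟨ cong (λ k → fromℕℚ (suc m) ℚ.* (fromℕℚ k ℚ.* c₃ m)) (ℕ.+-suc m j) ⟨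
  fromℕℚ (suc m) ℚ.* (fromℕℚ (m + suc j) ℚ.* c₃ m) ∎
  where
  open ℚ.≤-Reasoning

0≤1/c₃ : ∀ n → 0ℚ ℚ.≤ 1/c₃ n
0≤1/c₃ zero    = ℚ.<⇒≤ 0<1
0≤1/c₃ (suc n) = 0≤* (0≤1/c₃ n) (0≤/ (2 + 2 * n) (3 + 2 * n))

c₃-1/c₃ : ∀ n → c₃ n ℚ.* 1/c₃ n ≡ 1ℚ
c₃-1/c₃ zero    = refl
c₃-1/c₃ (suc n) = *-cancelˡ-≡ (e ℚ.* f) (0<* (0<2+2n n) (subst (0ℚ ℚ.<_) (fromℕℚ-affine 3 2 n) (0<fromℕℚ-suc (2 + 2 * n)))) $ begin
  e ℚ.* f ℚ.* (c₃ (suc n) ℚ.* 1/c₃ (suc n))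
    ≡⟨ solve 4 (λ e f x y → e :* f :* (x :* y) := (e :* x) :* (f :* y)) refl e f (c₃ (suc n)) (1/c₃ (suc n)) ⟩
  (e ℚ.* c₃ (suc n)) ℚ.* (f ℚ.* 1/c₃ (suc n))
    ≡⟨ cong₂ ℚ._*_ (c₃-suc n) (1/c₃-suc n) ⟩
  (f ℚ.* c₃ n) ℚ.* (e ℚ.* 1/c₃ n)
    ≡⟨ solve 4 (λ e f x y → (f :* x) :* (e :* y) := e :* f :* (x :* y)) refl e f (c₃ n) (1/c₃ n) ⟩
  e ℚ.* f ℚ.* (c₃ n ℚ.* 1/c₃ n)
    ≡⟨ cong (e ℚ.* f ℚ.*_) (c₃-1/c₃ n) ⟩
  e ℚ.* f ℚ.* 1ℚ ∎
  where
  open ≡-Reasoning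
  e = 2ℚ ℚ.+ 2ℚ ℚ.* fromℕℚ n
  f = 3ℚ ℚ.+ 2ℚ ℚ.* fromℕℚ n

-- Monotonicity and at most linear growth enclose c₃ m / c₃ n between m/n and 1, an error of at most
-- j/n. Using n + 1 and j + 1 instead covers n = 0.
c₃-ratio : ∀ m j → let n = m + j in fromℕℚ (suc n) ℚ.* ℚ.∣ c₃ m ℚ.* 1/c₃ n ℚ.- 1ℚ ∣ ℚ.≤ fromℕℚ (suc j)
c₃-ratio m j = begin
  fromℕℚ (suc n) ℚ.* ℚ.∣ u ℚ.- 1ℚ ∣
    ≡⟨ cong₂ ℚ._*_ (fromℕℚ-suc n) (∣-∣≡ u≤1) ⟩
  (1ℚ ℚ.+ fromℕℚ n) ℚ.* (1ℚ ℚ.- u)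
    ≤⟨ 0≤-⇒≤ (subst (0ℚ ℚ.≤_)
         (solve 4 (λ n m j u → (n :* u :- m) :+ u := (con 1ℚ :+ (j :+ (n :- m :- j))) :- (con 1ℚ :+ n) :* (con 1ℚ :- u)) refl (fromℕℚ n) (fromℕℚ m) (fromℕℚ j) u)
         (ℚ.+-mono-≤ (≤⇒0≤- m≤nu) (0≤* (0≤c₃ m) (0≤1/c₃ n)))) ⟩
  1ℚ ℚ.+ (fromℕℚ j ℚ.+ (fromℕℚ n ℚ.- fromℕℚ m ℚ.- fromℕℚ j))
    ≡⟨ cong (λ y → 1ℚ ℚ.+ (fromℕℚ j ℚ.+ (y ℚ.- fromℕℚ m ℚ.- fromℕℚ j))) (fromℕℚ-+ m j) ⟩
  1ℚ ℚ.+ (fromℕℚ j ℚ.+ (fromℕℚ m ℚ.+ fromℕℚ j ℚ.- fromℕℚ m ℚ.- fromℕℚ j))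
    ≡⟨ solve 2 (λ m j → con 1ℚ :+ (j :+ (m :+ j :- m :- j)) := con 1ℚ :+ j) refl (fromℕℚ m) (fromℕℚ j) ⟩
  1ℚ ℚ.+ fromℕℚ j
    ≡⟨ fromℕℚ-suc j ⟨
  fromℕℚ (suc j) ∎
  where
  open ℚ.≤-Reasoning
  n = m + j
  u = c₃ m ℚ.* 1/c₃ n
  u≤1 : u ℚ.≤ 1ℚ
  u≤1 = subst (u ℚ.≤_) (c₃-1/c₃ n) (*-monoʳ-≤ (1/c₃ n) (0≤1/c₃ n) (c₃-mono m j))
  m≤nu : fromℕℚ m ℚ.≤ fromℕℚ n ℚ.* u
  m≤nu = subst₂ ℚ._≤_
    (trans (ℚ.*-assoc (fromℕℚ m) (c₃ n) (1/c₃ n)) (trans (cong (fromℕℚ m ℚ.*_) (c₃-1/c₃ n)) (ℚ.*-identityʳ (fromℕℚ m))))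
    (ℚ.*-assoc (fromℕℚ n) (c₃ m) (1/c₃ n))
    (*-monoʳ-≤ (1/c₃ n) (0≤1/c₃ n) (c₃-growth m j))

weighted-sum : ∀ n → Σ≤ n (λ k → ⅓ ^ℚ k ℚ.* fromℕℚ (suc k)) ℚ.≤ 3ℚ
weighted-sum n = ℚ.≤-trans (0≤-⇒≤ (subst (0ℚ ℚ.≤_) (trans (solve 2 (λ s r → r := s :+ r :- s) refl (S n) (R n)) (cong (ℚ._- S n) (closed-form n)))
    (0≤* (ℚ.+-mono-≤ (0≤* (0≤/ 1 2) (0≤fromℕℚ n)) (0≤/ 5 4)) (0≤⅓^ n))))
  (/-mono-≤ 9 4 3 1 (ℕ.m≤m+n 9 3))
  where
  S R : ℕ → ℚ
  S n = Σ≤ n (λ k → ⅓ ^ℚ k ℚ.* fromℕℚ (suc k))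
  R n = (½ ℚ.* fromℕℚ n ℚ.+ + 5 / 4) ℚ.* ⅓ ^ℚ n
  -- The infinite sum is 1/(1-1/3)² = 9/4, and R n is its tail after k = n.
  closed-form : ∀ n → S n ℚ.+ R n ≡ + 9 / 4
  closed-form zero    = refl
  closed-form (suc n) = begin
    S n ℚ.+ ⅓ ℚ.* p ℚ.* fromℕℚ (2 + n) ℚ.+ (½ ℚ.* fromℕℚ (suc n) ℚ.+ + 5 / 4) ℚ.* (⅓ ℚ.* p)
      ≡⟨ cong₂ (λ x y → S n ℚ.+ ⅓ ℚ.* p ℚ.* x ℚ.+ (½ ℚ.* y ℚ.+ + 5 / 4) ℚ.* (⅓ ℚ.* p)) (fromℕℚ-+ 2 n) (fromℕℚ-suc n) ⟩
    S n ℚ.+ ⅓ ℚ.* p ℚ.* (2ℚ ℚ.+ fromℕℚ n) ℚ.+ (½ ℚ.* (1ℚ ℚ.+ fromℕℚ n) ℚ.+ + 5 / 4) ℚ.* (⅓ ℚ.* p)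
      ≡⟨ solve 3 (λ s p x → s :+ con ⅓ :* p :* (con 2ℚ :+ x) :+ (con ½ :* (con 1ℚ :+ x) :+ con (+ 5 / 4)) :* (con ⅓ :* p)
           := s :+ (con ½ :* x :+ con (+ 5 / 4)) :* p) refl (S n) p (fromℕℚ n) ⟩
    S n ℚ.+ R n
      ≡⟨ closed-form n ⟩
    + 9 / 4 ∎
    where
    open ≡-Reasoning
    p = ⅓ ^ℚ n

-- The coefficients of (1+x/3)^(-1/2) (1-x)^(-3/2), which is `halfEdges` at x/3, with its dominant
-- singularity moved to 1.
edgeSum : Series
edgeSum = c₁[-x/3] *ₛ c₃

halfEdges-edgeSum : ∀ n → halfEdges n ≡ 3ℚ ^ℚ n ℚ.* edgeSum n
halfEdges-edgeSum n = begin
  halfEdges n                               ≡⟨ halfEdges-convolution n ⟨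
  (scale 3ℚ c₃ *ₛ c₁[-x]) n               ≡⟨ *ₛ-cong {scale 3ℚ c₃} (λ _ → refl) rescale n ⟩
  (scale 3ℚ c₃ *ₛ scale 3ℚ c₁[-x/3]) n  ≡⟨ scale-* 3ℚ c₃ c₁[-x/3] n ⟨
  3ℚ ^ℚ n ℚ.* (c₃ *ₛ c₁[-x/3]) n              ≡⟨ cong (3ℚ ^ℚ n ℚ.*_) (*ₛ-comm c₃ c₁[-x/3] n) ⟩
  3ℚ ^ℚ n ℚ.* edgeSum n                     ∎
  where
  open ≡-Reasoning
  power : ∀ k → -1ℚ ^ℚ k ≡ 3ℚ ^ℚ k ℚ.* -⅓ ^ℚ k
  power zero    = refl
  power (suc k) = trans (cong (-1ℚ ℚ.*_) (power k))
    (solve 2 (λ x y → con -1ℚ :* (x :* y) := con 3ℚ :* x :* (con -⅓ :* y)) refl (3ℚ ^ℚ k) (-⅓ ^ℚ k))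
  rescale : c₁[-x] ≗ scale 3ℚ c₁[-x/3]
  rescale k = trans (cong (ℚ._* c₁ k) (power k)) (ℚ.*-assoc (3ℚ ^ℚ k) (-⅓ ^ℚ k) (c₁ k))

edgeRatio : ℕ → ℚ
edgeRatio n = edgeSum n ℚ.* 1/c₃ n

edgeRatio-Σc₁ : ∀ n → edgeRatio n ℚ.- Σc₁[-x/3] n ≡ Σ[ k ≤ n ] c₁[-x/3] k ℚ.* (c₃ (n ∸ k) ℚ.* 1/c₃ n ℚ.- 1ℚ)
edgeRatio-Σc₁ n = sym $ begin
  Σ≤ n (λ k → c₁[-x/3] k ℚ.* (c₃ (n ∸ k) ℚ.* 1/c₃ n ℚ.- 1ℚ))
    ≡⟨ Σ≤-cong n (λ k → solve 3 (λ x y z → x :* (y :* z :- con 1ℚ) := z :* (x :* y) :+ con -1ℚ :* (x :* con 1ℚ)) refl (c₁[-x/3] k) (c₃ (n ∸ k)) (1/c₃ n)) ⟩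
  Σ≤ n (λ k → 1/c₃ n ℚ.* (c₁[-x/3] k ℚ.* c₃ (n ∸ k)) ℚ.+ -1ℚ ℚ.* (c₁[-x/3] k ℚ.* 1ℚ))
    ≡⟨ trans (Σ≤-+ n _ _) (cong₂ ℚ._+_ (Σ≤-*ˡ n (1/c₃ n) _) (Σ≤-*ˡ n -1ℚ _)) ⟩
  1/c₃ n ℚ.* edgeSum n ℚ.+ -1ℚ ℚ.* Σc₁[-x/3] n
    ≡⟨ solve 3 (λ h l a → h :* l :+ con -1ℚ :* a := l :* h :- a) refl (1/c₃ n) (edgeSum n) (Σc₁[-x/3] n) ⟩
  edgeRatio n ℚ.- Σc₁[-x/3] n ∎
  where
  open ≡-Reasoning

-- Replacing c₃ (n-k) / c₃ n by 1 costs at most (k+1)/(n+1) with weight at most 3⁻ᵏ, and the sum of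
-- (k+1) 3⁻ᵏ is bounded by 3.
edgeRatio-Σc₁⇾0 : (λ n → edgeRatio n ℚ.- Σc₁[-x/3] n) ⇾ 0ℚ
edgeRatio-Σc₁⇾0 = ⇾0-squeeze {λ n → edgeRatio n ℚ.- Σc₁[-x/3] n} 3 λ n → ≤/suc {ℚ.∣ edgeRatio n ℚ.- Σc₁[-x/3] n ∣} 3 n (bound n)
  where
  bound : ∀ n → fromℕℚ (suc n) ℚ.* ℚ.∣ edgeRatio n ℚ.- Σc₁[-x/3] n ∣ ℚ.≤ 3ℚ
  bound n = begin
    x ℚ.* ℚ.∣ edgeRatio n ℚ.- Σc₁[-x/3] n ∣
      ≡⟨ cong₂ ℚ._*_ (sym (ℚ.0≤p⇒∣p∣≡p (0≤fromℕℚ (suc n)))) (cong ℚ.∣_∣ (edgeRatio-Σc₁ n)) ⟩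
    ℚ.∣ x ∣ ℚ.* ℚ.∣ Σ≤ n f ∣
      ≡⟨ trans (sym (ℚ.∣p*q∣≡∣p∣*∣q∣ x (Σ≤ n f))) (cong ℚ.∣_∣ (sym (Σ≤-*ˡ n x f))) ⟩
    ℚ.∣ Σ≤ n (λ k → x ℚ.* f k) ∣
      ≤⟨ Σ≤-∣∣ n summand ⟩
    Σ≤ n (λ k → ⅓ ^ℚ k ℚ.* fromℕℚ (suc k))
      ≤⟨ weighted-sum n ⟩
    3ℚ ∎
    where
    open ℚ.≤-Reasoning
    x = fromℕℚ (suc n)
    f : ℕ → ℚ
    f k = c₁[-x/3] k ℚ.* (c₃ (n ∸ k) ℚ.* 1/c₃ n ℚ.- 1ℚ)
    summand : ∀ k → k ℕ.≤ n → ℚ.∣ x ℚ.* f k ∣ ℚ.≤ ⅓ ^ℚ k ℚ.* fromℕℚ (suc k)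
    summand k k≤n = begin
      ℚ.∣ x ℚ.* (c₁[-x/3] k ℚ.* r) ∣
        ≡⟨ cong ℚ.∣_∣ (solve 3 (λ x a r → x :* (a :* r) := a :* (x :* r)) refl x (c₁[-x/3] k) r) ⟩
      ℚ.∣ c₁[-x/3] k ℚ.* (x ℚ.* r) ∣
        ≡⟨ trans (ℚ.∣p*q∣≡∣p∣*∣q∣ (c₁[-x/3] k) (x ℚ.* r)) (cong (ℚ.∣ c₁[-x/3] k ∣ ℚ.*_)
             (trans (ℚ.∣p*q∣≡∣p∣*∣q∣ x r) (cong (ℚ._* ℚ.∣ r ∣) (ℚ.0≤p⇒∣p∣≡p (0≤fromℕℚ (suc n)))))) ⟩
      ℚ.∣ c₁[-x/3] k ∣ ℚ.* (x ℚ.* ℚ.∣ r ∣)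
        ≤⟨ *-mono-≤ (ℚ.0≤∣p∣ (c₁[-x/3] k)) (0≤fromℕℚ (suc k)) (∣c₁[-x/3]∣≤ k)
             (subst (λ m → fromℕℚ (suc m) ℚ.* ℚ.∣ c₃ (n ∸ k) ℚ.* 1/c₃ m ℚ.- 1ℚ ∣ ℚ.≤ fromℕℚ (suc k)) (ℕ.m∸n+n≡m k≤n) (c₃-ratio (n ∸ k) k)) ⟩
      ⅓ ^ℚ k ℚ.* fromℕℚ (suc k) ∎
      where r = c₃ (n ∸ k) ℚ.* 1/c₃ n ℚ.- 1ℚ

edgeRatio²⇾ : (λ n → edgeRatio n ℚ.* edgeRatio n) ⇾ + 3 / 4
edgeRatio²⇾ = ⇾-cong (λ n → solve 2 (λ l a → a :* a :+ ((l :- a) :* (l :- a) :+ (con 2ℚ :* a) :* (l :- a)) := l :* l) refl (edgeRatio n) (Σc₁[-x/3] n))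
  (⇾-resp (ℚ.+-identityʳ (+ 3 / 4)) (⇾-+ Σc₁²⇾ (⇾-+ (⇾0-* edgeRatio-Σc₁⇾0 edgeRatio-Σc₁⇾0) cross)))
  where
  cross : (λ n → (2ℚ ℚ.* Σc₁[-x/3] n) ℚ.* (edgeRatio n ℚ.- Σc₁[-x/3] n)) ⇾ 0ℚ
  cross = ⇾0-bounded {λ n → edgeRatio n ℚ.- Σc₁[-x/3] n} {B = 4ℚ} (0<fromℕℚ-suc 3) edgeRatio-Σc₁⇾0 λ n → ℚ.≤-trans
    (ℚ.≤-reflexive (ℚ.∣p*q∣≡∣p∣*∣q∣ (2ℚ ℚ.* Σc₁[-x/3] n) (edgeRatio n ℚ.- Σc₁[-x/3] n)))
    (*-monoʳ-≤ ℚ.∣ edgeRatio n ℚ.- Σc₁[-x/3] n ∣ (ℚ.0≤∣p∣ (edgeRatio n ℚ.- Σc₁[-x/3] n))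
      (ℚ.≤-trans (ℚ.≤-reflexive (ℚ.∣p*q∣≡∣p∣*∣q∣ 2ℚ (Σc₁[-x/3] n))) (*-monoˡ-≤ 2ℚ (0≤fromℕℚ 2) (∣Σc₁∣≤2 n))))

-- Quotients of consecutive central trinomial coefficients

0≤T : ∀ n → 0ℚ ℚ.≤ T n
0≤T n = subst (0ℚ ℚ.≤_) (sym (T-walks n)) (0≤fromℕℚ (walks n 0ℤ))

-- Places T (n+1) / T n between 3 - 2/(n+1) and 3. The bounds are proved jointly: through the
-- recurrence, the lower one at n yields the upper one at n + 1, and the upper one at n yields the
-- lower one.
T-bounds : ∀ n → T (suc n) ℚ.≤ 3ℚ ℚ.* T n ×
           (1ℚ ℚ.+ 3ℚ ℚ.* fromℕℚ n) ℚ.* T n ℚ.≤ (1ℚ ℚ.+ fromℕℚ n) ℚ.* T (suc n)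
T-bounds zero    = /-mono-≤ 1 1 3 1 (s≤s z≤n) , ℚ.≤-refl
T-bounds (suc n) with upper , lower ← T-bounds n = upper′ , lower′
  where
  open ℚ.≤-Reasoning
  x = fromℕℚ n
  0≤x = 0≤fromℕℚ n
  0≤1+x : 0ℚ ℚ.≤ 1ℚ ℚ.+ x
  0≤1+x = ℚ.+-mono-≤ (0≤fromℕℚ 1) 0≤x
  0<1+x : 0ℚ ℚ.< 1ℚ ℚ.+ x
  0<1+x = ℚ.+-mono-<-≤ 0<1 0≤x
  t = T n ; t′ = T (suc n) ; t″ = T (2 + n)
  step : (2ℚ ℚ.+ x) ℚ.* t″ ≡ (3ℚ ℚ.+ 2ℚ ℚ.* x) ℚ.* t′ ℚ.+ (3ℚ ℚ.* (1ℚ ℚ.+ x)) ℚ.* t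
  step = ThreeTerm-ℚ {T} T-recurrence n
  3t≤ : (3ℚ ℚ.* (1ℚ ℚ.+ x)) ℚ.* t ℚ.≤ (3ℚ ℚ.+ x) ℚ.* t′
  3t≤ = *-cancelˡ-≤ (1ℚ ℚ.+ x) 0<1+x $ begin
    (1ℚ ℚ.+ x) ℚ.* ((3ℚ ℚ.* (1ℚ ℚ.+ x)) ℚ.* t)
      ≤⟨ 0≤-⇒≤ (subst (0ℚ ℚ.≤_)
           (solve 2 (λ x t → con 4ℚ :* x :* t := (con 3ℚ :+ x) :* ((con 1ℚ :+ con 3ℚ :* x) :* t) :- (con 1ℚ :+ x) :* ((con 3ℚ :* (con 1ℚ :+ x)) :* t)) refl x t)
           (0≤* (0≤* (0≤fromℕℚ 4) 0≤x) (0≤T n))) ⟩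
    (3ℚ ℚ.+ x) ℚ.* ((1ℚ ℚ.+ 3ℚ ℚ.* x) ℚ.* t)
      ≤⟨ *-monoˡ-≤ (3ℚ ℚ.+ x) (ℚ.+-mono-≤ (0≤fromℕℚ 3) 0≤x) lower ⟩
    (3ℚ ℚ.+ x) ℚ.* ((1ℚ ℚ.+ x) ℚ.* t′)
      ≡⟨ solve 2 (λ x t → (con 3ℚ :+ x) :* ((con 1ℚ :+ x) :* t) := (con 1ℚ :+ x) :* ((con 3ℚ :+ x) :* t)) refl x t′ ⟩
    (1ℚ ℚ.+ x) ℚ.* ((3ℚ ℚ.+ x) ℚ.* t′) ∎
  upper′ : t″ ℚ.≤ 3ℚ ℚ.* t′
  upper′ = *-cancelˡ-≤ (2ℚ ℚ.+ x) (ℚ.+-mono-<-≤ (0<fromℕℚ-suc 1) 0≤x) $ begin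
    (2ℚ ℚ.+ x) ℚ.* t″
      ≡⟨ step ⟩
    (3ℚ ℚ.+ 2ℚ ℚ.* x) ℚ.* t′ ℚ.+ (3ℚ ℚ.* (1ℚ ℚ.+ x)) ℚ.* t
      ≤⟨ ℚ.+-monoʳ-≤ ((3ℚ ℚ.+ 2ℚ ℚ.* x) ℚ.* t′) 3t≤ ⟩
    (3ℚ ℚ.+ 2ℚ ℚ.* x) ℚ.* t′ ℚ.+ (3ℚ ℚ.+ x) ℚ.* t′
      ≡⟨ solve 2 (λ x t → (con 3ℚ :+ con 2ℚ :* x) :* t :+ (con 3ℚ :+ x) :* t := (con 2ℚ :+ x) :* (con 3ℚ :* t)) refl x t′ ⟩
    (2ℚ ℚ.+ x) ℚ.* (3ℚ ℚ.* t′) ∎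
  lower′ : (1ℚ ℚ.+ 3ℚ ℚ.* fromℕℚ (suc n)) ℚ.* t′ ℚ.≤ (1ℚ ℚ.+ fromℕℚ (suc n)) ℚ.* t″
  lower′ = begin
    (1ℚ ℚ.+ 3ℚ ℚ.* fromℕℚ (suc n)) ℚ.* t′
      ≡⟨ cong (λ y → (1ℚ ℚ.+ 3ℚ ℚ.* y) ℚ.* t′) (fromℕℚ-suc n) ⟩
    (1ℚ ℚ.+ 3ℚ ℚ.* (1ℚ ℚ.+ x)) ℚ.* t′
      ≡⟨ solve 2 (λ x t → (con 1ℚ :+ con 3ℚ :* (con 1ℚ :+ x)) :* t := (con 3ℚ :+ con 2ℚ :* x) :* t :+ (con 1ℚ :+ x) :* t) refl x t′ ⟩
    (3ℚ ℚ.+ 2ℚ ℚ.* x) ℚ.* t′ ℚ.+ (1ℚ ℚ.+ x) ℚ.* t′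
      ≤⟨ ℚ.+-monoʳ-≤ ((3ℚ ℚ.+ 2ℚ ℚ.* x) ℚ.* t′) (*-monoˡ-≤ (1ℚ ℚ.+ x) 0≤1+x upper) ⟩
    (3ℚ ℚ.+ 2ℚ ℚ.* x) ℚ.* t′ ℚ.+ (1ℚ ℚ.+ x) ℚ.* (3ℚ ℚ.* t)
      ≡⟨ cong ((3ℚ ℚ.+ 2ℚ ℚ.* x) ℚ.* t′ ℚ.+_) (solve 2 (λ x t → (con 1ℚ :+ x) :* (con 3ℚ :* t) := (con 3ℚ :* (con 1ℚ :+ x)) :* t) refl x t) ⟩
    (3ℚ ℚ.+ 2ℚ ℚ.* x) ℚ.* t′ ℚ.+ (3ℚ ℚ.* (1ℚ ℚ.+ x)) ℚ.* t
      ≡⟨ step ⟨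
    (2ℚ ℚ.+ x) ℚ.* t″
      ≡⟨ cong (ℚ._* t″) (trans (solve 1 (λ x → con 2ℚ :+ x := con 1ℚ :+ (con 1ℚ :+ x)) refl x) (cong (1ℚ ℚ.+_) (sym (fromℕℚ-suc n)))) ⟩
    (1ℚ ℚ.+ fromℕℚ (suc n)) ℚ.* t″ ∎

T-mono : ∀ n → T n ℚ.≤ T (suc n)
T-mono n = *-cancelˡ-≤ (1ℚ ℚ.+ x) (ℚ.+-mono-<-≤ 0<1 (0≤fromℕℚ n)) (ℚ.≤-trans
  (0≤-⇒≤ (subst (0ℚ ℚ.≤_) (solve 2 (λ x t → con 2ℚ :* x :* t := (con 1ℚ :+ con 3ℚ :* x) :* t :- (con 1ℚ :+ x) :* t) refl x (T n))
    (0≤* (0≤* (0≤fromℕℚ 2) (0≤fromℕℚ n)) (0≤T n))))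
  (proj₂ (T-bounds n)))
  where x = fromℕℚ n

0<T : ∀ n → 0ℚ ℚ.< T n
0<T zero    = 0<1
0<T (suc n) = ℚ.<-≤-trans (0<T n) (T-mono n)

inv-inverse : ∀ {q} → 0ℚ ℚ.< q → inv q ℚ.* q ≡ 1ℚ
inv-inverse {q} 0<q = trans (ℚ.*-comm (inv q) q)
  (inv-inverseʳ q (subst (0ℚ ℚ.<_) (sym (ℚ.0≤p⇒∣p∣≡p (ℚ.<⇒≤ 0<q))) 0<q))

*-inv-cancel : ∀ p {q} → 0ℚ ℚ.< q → p ℚ.* inv q ℚ.* q ≡ p
*-inv-cancel p {q} 0<q = trans (ℚ.*-assoc p (inv q) q) (trans (cong (p ℚ.*_) (inv-inverse 0<q)) (ℚ.*-identityʳ p))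

T-ratio : ℕ → ℚ
T-ratio n = T n ℚ.* inv (T (suc n))

T-ratio-T : ∀ n → T-ratio n ℚ.* T (suc n) ≡ T n
T-ratio-T n = *-inv-cancel (T n) (0<T (suc n))

T-ratio⇾⅓ : T-ratio ⇾ ⅓
T-ratio⇾⅓ = ⇾-unshift0 (⇾0-squeeze {λ n → T-ratio n ℚ.- ⅓} 1 λ n → ≤/suc {ℚ.∣ T-ratio n ℚ.- ⅓ ∣} 1 n (bound n))
  where
  bound : ∀ n → fromℕℚ (suc n) ℚ.* ℚ.∣ T-ratio n ℚ.- ⅓ ∣ ℚ.≤ 1ℚ
  bound n = *-cancelˡ-≤ (3ℚ ℚ.* t′) (0<* (0<fromℕℚ-suc 2) (0<T (suc n))) $ begin
    3ℚ ℚ.* t′ ℚ.* (fromℕℚ (suc n) ℚ.* ℚ.∣ T-ratio n ℚ.- ⅓ ∣)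
      ≡⟨ cong₂ (λ y z → 3ℚ ℚ.* t′ ℚ.* (y ℚ.* z)) (fromℕℚ-suc n) (ℚ.0≤p⇒∣p∣≡p (≤⇒0≤- ⅓≤ρ)) ⟩
    3ℚ ℚ.* t′ ℚ.* ((1ℚ ℚ.+ x) ℚ.* (T-ratio n ℚ.- ⅓))
      ≡⟨ solve 3 (λ t′ x r → con 3ℚ :* t′ :* ((con 1ℚ :+ x) :* (r :- con ⅓)) := (con 1ℚ :+ x) :* (con 3ℚ :* (r :* t′)) :- (con 1ℚ :+ x) :* t′) refl t′ x (T-ratio n) ⟩
    (1ℚ ℚ.+ x) ℚ.* (3ℚ ℚ.* (T-ratio n ℚ.* t′)) ℚ.- (1ℚ ℚ.+ x) ℚ.* t′
      ≡⟨ cong (λ y → (1ℚ ℚ.+ x) ℚ.* (3ℚ ℚ.* y) ℚ.- (1ℚ ℚ.+ x) ℚ.* t′) (T-ratio-T n) ⟩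
    (1ℚ ℚ.+ x) ℚ.* (3ℚ ℚ.* t) ℚ.- (1ℚ ℚ.+ x) ℚ.* t′
      ≤⟨ ℚ.+-monoʳ-≤ ((1ℚ ℚ.+ x) ℚ.* (3ℚ ℚ.* t)) (ℚ.neg-antimono-≤ (proj₂ (T-bounds n))) ⟩
    (1ℚ ℚ.+ x) ℚ.* (3ℚ ℚ.* t) ℚ.- (1ℚ ℚ.+ 3ℚ ℚ.* x) ℚ.* t
      ≡⟨ solve 2 (λ x t → (con 1ℚ :+ x) :* (con 3ℚ :* t) :- (con 1ℚ :+ con 3ℚ :* x) :* t := con 2ℚ :* t) refl x t ⟩
    2ℚ ℚ.* t
      ≤⟨ *-mono-≤ (0≤fromℕℚ 2) (0≤T (suc n)) (fromℕℚ-mono-≤ {2} {3} (s≤s (s≤s z≤n))) (T-mono n) ⟩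
    3ℚ ℚ.* t′
      ≡⟨ ℚ.*-identityʳ (3ℚ ℚ.* t′) ⟨
    3ℚ ℚ.* t′ ℚ.* 1ℚ ∎
    where
    open ℚ.≤-Reasoning
    x = fromℕℚ n
    t = T n
    t′ = T (suc n)
    ⅓≤ρ : ⅓ ℚ.≤ T-ratio n
    ⅓≤ρ = *-cancelˡ-≤ (3ℚ ℚ.* t′) (0<* (0<fromℕℚ-suc 2) (0<T (suc n))) $ begin
      3ℚ ℚ.* t′ ℚ.* ⅓        ≡⟨ solve 1 (λ t → con 3ℚ :* t :* con ⅓ := t) refl t′ ⟩
      t′                           ≤⟨ proj₁ (T-bounds n) ⟩
      3ℚ ℚ.* t               ≡⟨ cong (3ℚ ℚ.*_) (T-ratio-T n) ⟨
      3ℚ ℚ.* (T-ratio n ℚ.* t′)    ≡⟨ solve 2 (λ r t → con 3ℚ :* (r :* t) := con 3ℚ :* t :* r) refl (T-ratio n) t′ ⟩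
      3ℚ ℚ.* t′ ℚ.* T-ratio n      ∎

-- Asymptotics of the index

hasseIndex : ℕ → ℚ
hasseIndex n = i (GM n) {{GM-nonEmpty n}}

hasseIndex-T : ∀ n → hasseIndex (2 + n) ℚ.* T (2 + n) ≡ fromℕℚ (suc n) ℚ.* (T (suc n) ℚ.+ T n)
hasseIndex-T n = begin
  hasseIndex (2 + n) ℚ.* T (2 + n)
    ≡⟨ cong (hasseIndex (2 + n) ℚ.*_) (trans (T-walks (2 + n)) (cong fromℕℚ (sym (size-GM (2 + n))))) ⟩
  hasseIndex (2 + n) ℚ.* fromℕℚ (FinitePoset.size (GM (2 + n)))
    ≡⟨ /-*-cancel (ℓ (GM (2 + n))) (FinitePoset.size (GM (2 + n))) {{GM-nonEmpty (2 + n)}} ⟩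
  fromℕℚ (ℓ (GM (2 + n)))
    ≡⟨ ℓ-halfEdges n ⟩
  2ℚ ℚ.* halfEdges n
    ≡⟨ halfEdges-T n ⟩
  fromℕℚ (suc n) ℚ.* (T (suc n) ℚ.+ T n) ∎
  where open ≡-Reasoning

suc/suc⇾1 : (λ n → + suc n / suc (suc n)) ⇾ 1ℚ
suc/suc⇾1 = ⇾-cong eq (⇾-+ (⇾-const 1ℚ) (⇾-scale -1ℚ (⇾-+-index 1 (/suc⇾0 1))))
  where
  eq : ∀ n → 1ℚ ℚ.+ -1ℚ ℚ.* (+ 1 / suc (suc n)) ≡ + suc n / suc (suc n)
  eq n = *-cancelˡ-≡ N (0<fromℕℚ-suc (suc n)) $ begin
    N ℚ.* (1ℚ ℚ.+ -1ℚ ℚ.* r)     ≡⟨ solve 2 (λ n r → n :* (con 1ℚ :+ con -1ℚ :* r) := n :- r :* n) refl N r ⟩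
    N ℚ.- r ℚ.* N                ≡⟨ cong₂ ℚ._-_ (fromℕℚ-suc (suc n)) (/-*-cancel 1 (suc (suc n))) ⟩
    1ℚ ℚ.+ fromℕℚ (suc n) ℚ.- 1ℚ ≡⟨ solve 1 (λ x → con 1ℚ :+ x :- con 1ℚ := x) refl (fromℕℚ (suc n)) ⟩
    fromℕℚ (suc n)               ≡⟨ /-*-cancel (suc n) (suc (suc n)) ⟨
    (+ suc n / suc (suc n)) ℚ.* N  ≡⟨ ℚ.*-comm (+ suc n / suc (suc n)) N ⟩
    N ℚ.* (+ suc n / suc (suc n))  ∎
    where
    open ≡-Reasoning
    N = fromℕℚ (suc (suc n))
    r = + 1 / suc (suc n)

hasseRatio : ℕ → ℚ
hasseRatio n = hasseIndex (2 + n) ℚ.* inv ((+ 4 / 9) ℚ.* fromℕℚ (2 + n))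

0<4n/9 : ∀ n → 0ℚ ℚ.< (+ 4 / 9) ℚ.* fromℕℚ (2 + n)
0<4n/9 n = 0<* (/-mono-< 0 1 4 9 (s≤s z≤n)) (0<fromℕℚ-suc (suc n))

hasseRatio-T-ratio : ∀ n → (+ 9 / 4) ℚ.* (+ suc n / suc (suc n)) ℚ.* (T-ratio (suc n) ℚ.+ T-ratio (suc n) ℚ.* T-ratio n) ≡ hasseRatio n
hasseRatio-T-ratio n = *-cancelˡ-≡ (b ℚ.* t″) (0<* (0<4n/9 n) (0<T (2 + n))) $ begin
  b ℚ.* t″ ℚ.* ((+ 9 / 4) ℚ.* r ℚ.* (ρ′ ℚ.+ ρ′ ℚ.* T-ratio n))
    ≡⟨ solve 5 (λ N t r p q → con (+ 4 / 9) :* N :* t :* (con (+ 9 / 4) :* r :* (p :+ p :* q)) := (r :* N) :* (p :* t :+ q :* (p :* t))) refl N t″ r ρ′ (T-ratio n) ⟩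
  (r ℚ.* N) ℚ.* (ρ′ ℚ.* t″ ℚ.+ T-ratio n ℚ.* (ρ′ ℚ.* t″))
    ≡⟨ cong₂ (λ a b → a ℚ.* (b ℚ.+ T-ratio n ℚ.* b)) (/-*-cancel (suc n) (suc (suc n))) (T-ratio-T (suc n)) ⟩
  fromℕℚ (suc n) ℚ.* (T (suc n) ℚ.+ T-ratio n ℚ.* T (suc n))
    ≡⟨ cong (λ a → fromℕℚ (suc n) ℚ.* (T (suc n) ℚ.+ a)) (T-ratio-T n) ⟩
  fromℕℚ (suc n) ℚ.* (T (suc n) ℚ.+ T n)
    ≡⟨ hasseIndex-T n ⟨
  hasseIndex (2 + n) ℚ.* t″
    ≡⟨ cong (ℚ._* t″) (*-inv-cancel (hasseIndex (2 + n)) (0<4n/9 n)) ⟨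
  hasseRatio n ℚ.* b ℚ.* t″
    ≡⟨ solve 3 (λ i b t → i :* b :* t := b :* t :* i) refl (hasseRatio n) b t″ ⟩
  b ℚ.* t″ ℚ.* hasseRatio n ∎
  where
  open ≡-Reasoning
  N = fromℕℚ (2 + n)
  b = (+ 4 / 9) ℚ.* N
  t″ = T (2 + n)
  r = + suc n / suc (suc n)
  ρ′ = T-ratio (suc n)

hasseRatio⇾1 : hasseRatio ⇾ 1ℚ
-- The limit 9/4 · 1 · (1/3 + 1/3 · 1/3) evaluates to 1.
hasseRatio⇾1 = ⇾-cong hasseRatio-T-ratio (⇾-* (⇾-scale (+ 9 / 4) suc/suc⇾1) (⇾-+ ρ′⇾⅓ (⇾-* ρ′⇾⅓ T-ratio⇾⅓)))
  where
  ρ′⇾⅓ : (λ n → T-ratio (suc n)) ⇾ ⅓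
  ρ′⇾⅓ = ⇾-+-index 1 T-ratio⇾⅓

#0-intro : ∀ {x} δ → 0ℚ ℚ.< δ → ∀ N → (∀ n → N ℕ.≤ n → δ ℚ.≤ approx x n) → x #0
#0-intro {x} δ 0<δ N bound = δ , 0<δ , N , λ n n≥ →
  ℚ.≤-trans (ℚ.≤-reflexive (ℚ.+-identityˡ δ)) (ℚ.≤-trans (bound n n≥) (p≤∣p∣ (approx x n)))

-- Spells the limit out on approximants; `_<ᵣ_` asks for a rational margin δ, here chosen once for
-- all large n.
∼-intro : (x y : ℕ → ℝ) (y#0 : ∀ n → y n #0) →
          (∀ ε → 0ℚ ℚ.< ε → ∃[ δ ] 0ℚ ℚ.< δ × ∃[ N ] ∀ n → N ℕ.≤ n → ∃[ M ] ∀ m → M ℕ.≤ m →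
            ℚ.∣ approx (x n) m ℚ.* inv (approx (y n) m) ℚ.- 1ℚ ∣ ℚ.+ δ ℚ.≤ ε) →
          (λ n → x n ÷ᵣ y n ⟨ y#0 n ⟩) ⟶ fromℚ 1ℚ
∼-intro x y y#0 close ε 0<ε with δ , 0<δ , N , close′ ← close ε 0<ε =
  N , λ n n≥ → δ , 0<δ , close′ n n≥

hasseIndex∼ : (λ n → fromℚ (hasseIndex n)) ∼ (λ n → fromℚ ((+ 4 / 9) ℚ.* fromℕℚ n))
hasseIndex∼ = 2 , (λ n → #0-intro {fromℚ ((+ 4 / 9) ℚ.* fromℕℚ (2 + n))} ((+ 4 / 9) ℚ.* fromℕℚ (2 + n)) (0<4n/9 n) 0 (λ _ _ → ℚ.≤-refl)) , λ ε 0<ε →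
  let N , close = hasseRatio⇾1 .within ε 0<ε in
  -- The approximants are constant, so the remaining distance to ε itself serves as the margin.
  N , λ n n≥ → ε ℚ.- ℚ.∣ hasseRatio n ℚ.- 1ℚ ∣ ,
    subst (ℚ._< ε ℚ.- ℚ.∣ hasseRatio n ℚ.- 1ℚ ∣) (ℚ.+-inverseʳ ℚ.∣ hasseRatio n ℚ.- 1ℚ ∣) (ℚ.+-monoˡ-< (ℚ.- ℚ.∣ hasseRatio n ℚ.- 1ℚ ∣) (close n n≥)) ,
    0 , λ _ _ → ℚ.≤-reflexive (solve 2 (λ x e → x :+ (e :- x) := e) refl ℚ.∣ hasseRatio n ℚ.- 1ℚ ∣ ε)

-- Asymptotics of the number of edges

-- The square of ℓ(GM (n+2)) / (2·3ⁿ √(3(n+2)/π)) with `wallis n` in place of π, as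
-- `edgeSum²-wallis` shows.
squaredRatio : ℕ → ℚ
squaredRatio n = 2ℚ ℚ.* odd n ℚ.* (+ 1 / (3 * (2 + n))) ℚ.* (edgeRatio n ℚ.* edgeRatio n)

-- 2(2n+1)/(3(n+2)) = 4/3 - 2/(n+2) tends to 4/3, and the square of `edgeRatio` to 3/4.
squaredRatio⇾1 : squaredRatio ⇾ 1ℚ
squaredRatio⇾1 = ⇾-* (⇾-cong eq (⇾-+ (⇾-const (+ 4 / 3)) (⇾-scale -1ℚ (⇾-+-index 1 (/suc⇾0 2))))) edgeRatio²⇾
  where
  eq : ∀ n → + 4 / 3 ℚ.+ -1ℚ ℚ.* (+ 2 / suc (suc n)) ≡ 2ℚ ℚ.* odd n ℚ.* (+ 1 / (3 * (2 + n)))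
  eq n = *-cancelˡ-≡ N (0<fromℕℚ-suc (suc n + 2 * suc (suc n))) $ begin
    N ℚ.* (+ 4 / 3 ℚ.+ -1ℚ ℚ.* r)
      ≡⟨ cong (ℚ._* (+ 4 / 3 ℚ.+ -1ℚ ℚ.* r)) (fromℕℚ-* 3 (2 + n)) ⟩
    3ℚ ℚ.* M ℚ.* (+ 4 / 3 ℚ.+ -1ℚ ℚ.* r)
      ≡⟨ solve 2 (λ m r → con 3ℚ :* m :* (con (+ 4 / 3) :+ con -1ℚ :* r) := con 4ℚ :* m :- con 3ℚ :* (r :* m)) refl M r ⟩
    4ℚ ℚ.* M ℚ.- 3ℚ ℚ.* (r ℚ.* M)
      ≡⟨ cong₂ (λ a b → 4ℚ ℚ.* a ℚ.- 3ℚ ℚ.* b) (fromℕℚ-+ 2 n) (/-*-cancel 2 (suc (suc n))) ⟩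
    4ℚ ℚ.* (2ℚ ℚ.+ x) ℚ.- 3ℚ ℚ.* 2ℚ
      ≡⟨ solve 1 (λ x → con 4ℚ :* (con 2ℚ :+ x) :- con 3ℚ :* con 2ℚ := con 2ℚ :* (con 1ℚ :+ con 2ℚ :* x) :* con 1ℚ) refl x ⟩
    2ℚ ℚ.* odd n ℚ.* 1ℚ
      ≡⟨ cong (2ℚ ℚ.* odd n ℚ.*_) (/-*-cancel 1 (3 * (2 + n))) ⟨
    2ℚ ℚ.* odd n ℚ.* (s ℚ.* N)
      ≡⟨ solve 3 (λ o s n → o :* (s :* n) := n :* (o :* s)) refl (2ℚ ℚ.* odd n) s N ⟩
    N ℚ.* (2ℚ ℚ.* odd n ℚ.* s) ∎
    where
    open ≡-Reasoning
    x = fromℕℚ n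
    M = fromℕℚ (2 + n)
    N = fromℕℚ (3 * (2 + n))
    r = + 2 / suc (suc n)
    s = + 1 / (3 * (2 + n))

0≤square : ∀ x → 0ℚ ℚ.≤ x ℚ.* x
0≤square x with ℚ.≤-total 0ℚ x
... | inj₁ 0≤x = 0≤* 0≤x 0≤x
... | inj₂ x≤0 = subst (0ℚ ℚ.≤_) (solve 1 (λ x → (:- x) :* (:- x) := x :* x) refl x) (0≤* (ℚ.neg-antimono-≤ x≤0) (ℚ.neg-antimono-≤ x≤0))

0≤squaredRatio : ∀ n → 0ℚ ℚ.≤ squaredRatio n
0≤squaredRatio n = 0≤* (0≤* (0≤* (0≤fromℕℚ 2) (0≤odd n)) (0≤/ 1 (3 * (2 + n)))) (0≤square (edgeRatio n))

edgeSum²-wallis : ∀ n → edgeSum n ℚ.* edgeSum n ℚ.* wallis n ≡ fromℕℚ (3 * (2 + n)) ℚ.* squaredRatio n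
edgeSum²-wallis n = begin
  edgeSum n ℚ.* edgeSum n ℚ.* (o ℚ.* (1/c₃ n ℚ.* 1/c₃ n))
    ≡⟨ solve 3 (λ l o h → l :* l :* (o :* (h :* h)) := con 1ℚ :* (o :* ((l :* h) :* (l :* h)))) refl (edgeSum n) o (1/c₃ n) ⟩
  1ℚ ℚ.* (o ℚ.* (edgeRatio n ℚ.* edgeRatio n))
    ≡⟨ cong (ℚ._* (o ℚ.* (edgeRatio n ℚ.* edgeRatio n))) (/-*-cancel 1 (3 * (2 + n))) ⟨
  r ℚ.* F ℚ.* (o ℚ.* (edgeRatio n ℚ.* edgeRatio n))
    ≡⟨ solve 4 (λ r f o l → r :* f :* (o :* l) := f :* (o :* r :* l)) refl r F o (edgeRatio n ℚ.* edgeRatio n) ⟩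
  F ℚ.* squaredRatio n ∎
  where
  open ≡-Reasoning
  o = 2ℚ ℚ.* odd n
  r = + 1 / (3 * (2 + n))
  F = fromℕℚ (3 * (2 + n))

-- The factor y + 1 is at least 1. This is the passage from the squared quotient back to the
-- quotient.
∣y-1∣≤∣y²-1∣ : ∀ {y} → 0ℚ ℚ.≤ y → ℚ.∣ y ℚ.- 1ℚ ∣ ℚ.≤ ℚ.∣ y ℚ.* y ℚ.- 1ℚ ∣
∣y-1∣≤∣y²-1∣ {y} 0≤y = begin
  ℚ.∣ y ℚ.- 1ℚ ∣                         ≡⟨ ℚ.*-identityʳ ℚ.∣ y ℚ.- 1ℚ ∣ ⟨
  ℚ.∣ y ℚ.- 1ℚ ∣ ℚ.* 1ℚ                  ≤⟨ *-monoˡ-≤ ℚ.∣ y ℚ.- 1ℚ ∣ (ℚ.0≤∣p∣ (y ℚ.- 1ℚ)) (ℚ.+-monoˡ-≤ 1ℚ 0≤y) ⟩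
  ℚ.∣ y ℚ.- 1ℚ ∣ ℚ.* (y ℚ.+ 1ℚ)          ≡⟨ cong (ℚ.∣ y ℚ.- 1ℚ ∣ ℚ.*_) (ℚ.0≤p⇒∣p∣≡p (ℚ.+-mono-≤ 0≤y (0≤fromℕℚ 1))) ⟨
  ℚ.∣ y ℚ.- 1ℚ ∣ ℚ.* ℚ.∣ y ℚ.+ 1ℚ ∣      ≡⟨ ℚ.∣p*q∣≡∣p∣*∣q∣ (y ℚ.- 1ℚ) (y ℚ.+ 1ℚ) ⟨
  ℚ.∣ (y ℚ.- 1ℚ) ℚ.* (y ℚ.+ 1ℚ) ∣        ≡⟨ cong ℚ.∣_∣ (solve 1 (λ y → (y :- con 1ℚ) :* (y :+ con 1ℚ) := y :* y :- con 1ℚ) refl y) ⟩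
  ℚ.∣ y ℚ.* y ℚ.- 1ℚ ∣                   ∎
  where open ℚ.≤-Reasoning

½≤sqrt : ∀ {s η q} → η ℚ.≤ ½ → 0ℚ ℚ.≤ s ℚ.+ η → 1ℚ ℚ.≤ q → q ℚ.< (s ℚ.+ η) ℚ.* (s ℚ.+ η) → ½ ℚ.≤ s
½≤sqrt {s} {η} {q} η≤½ 0≤u 1≤q q<u² with 1ℚ ℚ.≤? s ℚ.+ η
... | yes 1≤u = 0≤-⇒≤ (subst (0ℚ ℚ.≤_) (solve 2 (λ s e → (s :+ e :- con 1ℚ) :+ (con ½ :- e) := s :- con ½) refl s η)
  (ℚ.+-mono-≤ (≤⇒0≤- 1≤u) (≤⇒0≤- η≤½)))
... | no 1≰u = contradiction
  (ℚ.<-≤-trans (ℚ.≤-<-trans 1≤q q<u²) (*-mono-≤ 0≤u (0≤fromℕℚ 1) (ℚ.<⇒≤ (ℚ.≰⇒> 1≰u)) (ℚ.<⇒≤ (ℚ.≰⇒> 1≰u)))) (ℚ.<-irrefl refl)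

-- Here y is the quotient at one approximation index, p the approximant of π, s that of √q with
-- error η, w the `squaredRatio` and V the `wallis` value. By (ys)²V = qpw, the defect s²V(y²-1)
-- splits into the rounding error q - s², the distance of w from 1 and that of p from V.
ratio-bound : ∀ {y s η q p w V} → 0ℚ ℚ.≤ y → ½ ℚ.≤ s → 0ℚ ℚ.≤ η → η ℚ.≤ ½ →
  s ℚ.* s ℚ.≤ q → q ℚ.≤ (s ℚ.+ η) ℚ.* (s ℚ.+ η) → 1ℚ ℚ.≤ V → 0ℚ ℚ.≤ p → p ℚ.≤ 4ℚ → 0ℚ ℚ.≤ w → w ℚ.≤ 2ℚ →
  (y ℚ.* s) ℚ.* (y ℚ.* s) ℚ.* V ≡ q ℚ.* p ℚ.* w →
  ℚ.∣ y ℚ.- 1ℚ ∣ ℚ.≤ fromℕℚ 48 ℚ.* η ℚ.+ (4ℚ ℚ.* ℚ.∣ w ℚ.- 1ℚ ∣ ℚ.+ ℚ.∣ p ℚ.- V ∣)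
ratio-bound {y} {s} {η} {q} {p} {w} {V} 0≤y ½≤s 0≤η η≤½ s²≤q q≤u² 1≤V 0≤p p≤4 0≤w w≤2 eq =
  ℚ.≤-trans (∣y-1∣≤∣y²-1∣ 0≤y) (*-cancelˡ-≤ (s ℚ.* s) (0<* 0<s 0<s) (begin
    s ℚ.* s ℚ.* Y
      ≡⟨ ℚ.*-identityʳ (s ℚ.* s ℚ.* Y) ⟨
    s ℚ.* s ℚ.* Y ℚ.* 1ℚ
      ≤⟨ *-monoˡ-≤ (s ℚ.* s ℚ.* Y) (0≤* 0≤s² (ℚ.0≤∣p∣ (y ℚ.* y ℚ.- 1ℚ))) 1≤V ⟩
    s ℚ.* s ℚ.* Y ℚ.* V
      ≡⟨ solve 3 (λ s y v → s :* s :* y :* v := (s :* s :* v) :* y) refl s Y V ⟩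
    s ℚ.* s ℚ.* V ℚ.* Y
      ≡⟨ trans (cong (ℚ._* Y) (sym (ℚ.0≤p⇒∣p∣≡p (0≤* 0≤s² 0≤V)))) (sym (ℚ.∣p*q∣≡∣p∣*∣q∣ (s ℚ.* s ℚ.* V) (y ℚ.* y ℚ.- 1ℚ))) ⟩
    ℚ.∣ s ℚ.* s ℚ.* V ℚ.* (y ℚ.* y ℚ.- 1ℚ) ∣
      ≡⟨ cong ℚ.∣_∣ (solve 3 (λ s v y → s :* s :* v :* (y :* y :- con 1ℚ) := (y :* s) :* (y :* s) :* v :- s :* s :* v) refl s V y) ⟩
    ℚ.∣ (y ℚ.* s) ℚ.* (y ℚ.* s) ℚ.* V ℚ.- s ℚ.* s ℚ.* V ∣
      ≡⟨ cong (λ z → ℚ.∣ z ℚ.- s ℚ.* s ℚ.* V ∣) eq ⟩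
    ℚ.∣ q ℚ.* p ℚ.* w ℚ.- s ℚ.* s ℚ.* V ∣
      ≡⟨ cong ℚ.∣_∣ (solve 5 (λ q p w s v → q :* p :* w :- s :* s :* v := (q :- s :* s) :* (p :* w) :+ s :* s :* (p :* (w :- con 1ℚ) :+ (p :- v))) refl q p w s V) ⟩
    ℚ.∣ (q ℚ.- s ℚ.* s) ℚ.* (p ℚ.* w) ℚ.+ s ℚ.* s ℚ.* (p ℚ.* (w ℚ.- 1ℚ) ℚ.+ (p ℚ.- V)) ∣
      ≤⟨ ℚ.∣p+q∣≤∣p∣+∣q∣ ((q ℚ.- s ℚ.* s) ℚ.* (p ℚ.* w)) _ ⟩
    ℚ.∣ (q ℚ.- s ℚ.* s) ℚ.* (p ℚ.* w) ∣ ℚ.+ ℚ.∣ s ℚ.* s ℚ.* (p ℚ.* (w ℚ.- 1ℚ) ℚ.+ (p ℚ.- V)) ∣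
      ≤⟨ ℚ.+-mono-≤ first second ⟩
    s ℚ.* s ℚ.* (fromℕℚ 48 ℚ.* η) ℚ.+ s ℚ.* s ℚ.* (4ℚ ℚ.* ℚ.∣ w ℚ.- 1ℚ ∣ ℚ.+ ℚ.∣ p ℚ.- V ∣)
      ≡⟨ ℚ.*-distribˡ-+ (s ℚ.* s) (fromℕℚ 48 ℚ.* η) (4ℚ ℚ.* ℚ.∣ w ℚ.- 1ℚ ∣ ℚ.+ ℚ.∣ p ℚ.- V ∣) ⟨
    s ℚ.* s ℚ.* (fromℕℚ 48 ℚ.* η ℚ.+ (4ℚ ℚ.* ℚ.∣ w ℚ.- 1ℚ ∣ ℚ.+ ℚ.∣ p ℚ.- V ∣)) ∎))
  where
  open ℚ.≤-Reasoning
  Y = ℚ.∣ y ℚ.* y ℚ.- 1ℚ ∣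
  0<s : 0ℚ ℚ.< s
  0<s = ℚ.<-≤-trans (/-mono-< 0 1 1 2 (s≤s z≤n)) ½≤s
  0≤s = ℚ.<⇒≤ 0<s
  0≤s² = 0≤* 0≤s 0≤s
  0≤V : 0ℚ ℚ.≤ V
  0≤V = ℚ.≤-trans (0≤fromℕℚ 1) 1≤V
  -- 2sη + η² ≤ 6s²η because s ≥ 1/2 and η ≤ 1/2; with pw ≤ 8 this makes the constant 48.
  gap : q ℚ.- s ℚ.* s ℚ.≤ s ℚ.* s ℚ.* (6ℚ ℚ.* η)
  gap = begin
    q ℚ.- s ℚ.* s
      ≤⟨ ℚ.+-monoˡ-≤ (ℚ.- (s ℚ.* s)) q≤u² ⟩
    (s ℚ.+ η) ℚ.* (s ℚ.+ η) ℚ.- s ℚ.* s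
      ≤⟨ 0≤-⇒≤ (subst (0ℚ ℚ.≤_)
           (solve 2 (λ s e → e :* (con 6ℚ :* ((s :- con ½) :* (s :- con ½)) :+ con 4ℚ :* (s :- con ½) :+ (con ½ :- e))
              := s :* s :* (con 6ℚ :* e) :- ((s :+ e) :* (s :+ e) :- s :* s)) refl s η)
           (0≤* 0≤η (ℚ.+-mono-≤ (ℚ.+-mono-≤ (0≤* (0≤fromℕℚ 6) (0≤square (s ℚ.- ½))) (0≤* (0≤fromℕℚ 4) (≤⇒0≤- ½≤s))) (≤⇒0≤- η≤½)))) ⟩
    s ℚ.* s ℚ.* (6ℚ ℚ.* η) ∎
  first : ℚ.∣ (q ℚ.- s ℚ.* s) ℚ.* (p ℚ.* w) ∣ ℚ.≤ s ℚ.* s ℚ.* (fromℕℚ 48 ℚ.* η)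
  first = begin
    ℚ.∣ (q ℚ.- s ℚ.* s) ℚ.* (p ℚ.* w) ∣
      ≡⟨ ℚ.0≤p⇒∣p∣≡p (0≤* (≤⇒0≤- s²≤q) (0≤* 0≤p 0≤w)) ⟩
    (q ℚ.- s ℚ.* s) ℚ.* (p ℚ.* w)
      ≤⟨ *-mono-≤ (≤⇒0≤- s²≤q) (0≤fromℕℚ 8) gap (*-mono-≤ 0≤p (0≤fromℕℚ 2) p≤4 w≤2) ⟩
    s ℚ.* s ℚ.* (6ℚ ℚ.* η) ℚ.* 8ℚ
      ≡⟨ solve 2 (λ s e → s :* s :* (con 6ℚ :* e) :* con 8ℚ := s :* s :* (con (fromℕℚ 48) :* e)) refl s η ⟩
    s ℚ.* s ℚ.* (fromℕℚ 48 ℚ.* η) ∎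
  second : ℚ.∣ s ℚ.* s ℚ.* (p ℚ.* (w ℚ.- 1ℚ) ℚ.+ (p ℚ.- V)) ∣ ℚ.≤ s ℚ.* s ℚ.* (4ℚ ℚ.* ℚ.∣ w ℚ.- 1ℚ ∣ ℚ.+ ℚ.∣ p ℚ.- V ∣)
  second = begin
    ℚ.∣ s ℚ.* s ℚ.* (p ℚ.* (w ℚ.- 1ℚ) ℚ.+ (p ℚ.- V)) ∣
      ≡⟨ trans (ℚ.∣p*q∣≡∣p∣*∣q∣ (s ℚ.* s) (p ℚ.* (w ℚ.- 1ℚ) ℚ.+ (p ℚ.- V))) (cong (ℚ._* ℚ.∣ p ℚ.* (w ℚ.- 1ℚ) ℚ.+ (p ℚ.- V) ∣) (ℚ.0≤p⇒∣p∣≡p 0≤s²)) ⟩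
    s ℚ.* s ℚ.* ℚ.∣ p ℚ.* (w ℚ.- 1ℚ) ℚ.+ (p ℚ.- V) ∣
      ≤⟨ *-monoˡ-≤ (s ℚ.* s) 0≤s² (ℚ.≤-trans (ℚ.∣p+q∣≤∣p∣+∣q∣ (p ℚ.* (w ℚ.- 1ℚ)) (p ℚ.- V)) (ℚ.+-monoˡ-≤ ℚ.∣ p ℚ.- V ∣
           (ℚ.≤-trans (ℚ.≤-reflexive (trans (ℚ.∣p*q∣≡∣p∣*∣q∣ p (w ℚ.- 1ℚ)) (cong (ℚ._* ℚ.∣ w ℚ.- 1ℚ ∣) (ℚ.0≤p⇒∣p∣≡p 0≤p))))
             (*-monoʳ-≤ ℚ.∣ w ℚ.- 1ℚ ∣ (ℚ.0≤∣p∣ (w ℚ.- 1ℚ)) p≤4)))) ⟩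
    s ℚ.* s ℚ.* (4ℚ ℚ.* ℚ.∣ w ℚ.- 1ℚ ∣ ℚ.+ ℚ.∣ p ℚ.- V ∣) ∎

π-bounds : ∀ m → 2ℚ ℚ.≤ approx π (suc m) × approx π (suc m) ℚ.≤ 4ℚ
π-bounds m =
  ℚ.≤-trans (toWitness {a? = 2ℚ ℚ.≤? leibniz 0 ℚ.- leibniz 1} _)
    (ℚ.+-monoʳ-≤ (leibniz 0) (ℚ.neg-antimono-≤ (proj₂ (alternating-bounds {leibniz ∘ suc} (leibniz-antitone ∘ suc) m)))) ,
  proj₂ (alternating-bounds {leibniz} leibniz-antitone (suc m))

-- The quotient at n + 2 and approximation index m + 1. At index 0 the empty Leibniz sum would make
-- the approximant of π zero; from index 1 on it lies in [2, 4]. There `sqrt` works with the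
-- denominator m + 2, whence η.
module Quotient (n m : ℕ) where

  p η q s κ : ℚ
  p = approx π (suc m)
  η = + 1 / suc (suc m)
  q = fromℕℚ (3 * (2 + n)) ℚ.* inv p
  s = sqrt q (suc m)
  κ = + (2 * 3 ^ (2 + n)) / 3 ^ 2

  2≤p : 2ℚ ℚ.≤ p
  2≤p = proj₁ (π-bounds m)

  p≤4 : p ℚ.≤ 4ℚ
  p≤4 = proj₂ (π-bounds m)

  0<p : 0ℚ ℚ.< p
  0<p = ℚ.<-≤-trans (0<fromℕℚ-suc 1) 2≤p

  q-p : q ℚ.* p ≡ fromℕℚ (3 * (2 + n))
  q-p = *-inv-cancel (fromℕℚ (3 * (2 + n))) 0<p

  1≤q : 1ℚ ℚ.≤ q
  1≤q = *-cancelˡ-≤ p 0<p (begin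
    p ℚ.* 1ℚ                     ≡⟨ ℚ.*-identityʳ p ⟩
    p                            ≤⟨ p≤4 ⟩
    4ℚ                     ≤⟨ fromℕℚ-mono-≤ {4} {3 * (2 + n)} (ℕ.≤-trans {4} {6} (ℕ.m≤m+n 4 2) (ℕ.*-monoʳ-≤ 3 (ℕ.m≤m+n 2 n))) ⟩
    fromℕℚ (3 * (2 + n))         ≡⟨ q-p ⟨
    q ℚ.* p                      ≡⟨ ℚ.*-comm q p ⟩
    p ℚ.* q                      ∎)
    where open ℚ.≤-Reasoning

  ∣q∣≡q : ℚ.∣ q ∣ ≡ q
  ∣q∣≡q = ℚ.0≤p⇒∣p∣≡p (ℚ.≤-trans (0≤fromℕℚ 1) 1≤q)

  0≤η : 0ℚ ℚ.≤ η
  0≤η = 0≤/ 1 (suc (suc m))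

  η≤½ : η ℚ.≤ ½
  η≤½ = /-mono-≤ 1 (suc (suc m)) 1 2 (s≤s (s≤s z≤n))

  s²≤q : s ℚ.* s ℚ.≤ q
  s²≤q = subst (s ℚ.* s ℚ.≤_) ∣q∣≡q (sqrt-lower q (suc m))

  q<u² : q ℚ.< (s ℚ.+ η) ℚ.* (s ℚ.+ η)
  q<u² = subst (ℚ._< (s ℚ.+ η) ℚ.* (s ℚ.+ η)) ∣q∣≡q (sqrt-upper q (suc m))

  ½≤s : ½ ℚ.≤ s
  ½≤s = ½≤sqrt {s} {η} {q} η≤½ (ℚ.+-mono-≤ (0≤sqrt q (suc m)) 0≤η) 1≤q q<u²

  κ≡ : κ ≡ 2ℚ ℚ.* 3ℚ ^ℚ n
  κ≡ = *-cancelˡ-≡ 9ℚ (0<fromℕℚ-suc 8) (begin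
    9ℚ ℚ.* κ                               ≡⟨ ℚ.*-comm 9ℚ κ ⟩
    κ ℚ.* 9ℚ                               ≡⟨ /-*-cancel (2 * 3 ^ (2 + n)) 9 ⟩
    fromℕℚ (2 * 3 ^ (2 + n))                     ≡⟨ trans (fromℕℚ-* 2 (3 ^ (2 + n))) (cong (2ℚ ℚ.*_) (fromℕℚ-^ 3 (2 + n))) ⟩
    2ℚ ℚ.* (3ℚ ℚ.* (3ℚ ℚ.* t)) ≡⟨ solve 1 (λ t → con 2ℚ :* (con 3ℚ :* (con 3ℚ :* t)) := con 9ℚ :* (con 2ℚ :* t)) refl t ⟩
    9ℚ ℚ.* (2ℚ ℚ.* t)                ∎)
    where
    open ≡-Reasoning
    t = 3ℚ ^ℚ n

  1≤κ : 1ℚ ℚ.≤ κ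
  1≤κ = subst (1ℚ ℚ.≤_) (trans (fromℕℚ-* 2 (3 ^ n)) (trans (cong (2ℚ ℚ.*_) (fromℕℚ-^ 3 n)) (sym κ≡)))
    (fromℕℚ-mono-≤ {1} {2 * 3 ^ n} (ℕ.≤-trans (ℕ.m≤m+n 1 1) (ℕ.*-monoʳ-≤ 2 {1} (ℕ.m^n>0 3 n))))

  ½≤κs : ½ ℚ.≤ κ ℚ.* s
  ½≤κs = ℚ.≤-trans ½≤s (subst (ℚ._≤ κ ℚ.* s) (ℚ.*-identityˡ s) (*-monoʳ-≤ s (0≤sqrt q (suc m)) 1≤κ))

  0<κs : 0ℚ ℚ.< κ ℚ.* s
  0<κs = ℚ.<-≤-trans (/-mono-< 0 1 1 2 (s≤s z≤n)) ½≤κs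

  y : ℚ
  y = fromℕℚ (ℓ (GM (2 + n))) ℚ.* inv (κ ℚ.* s)

  y-s : y ℚ.* s ≡ edgeSum n
  y-s = *-cancelˡ-≡ κ (ℚ.<-≤-trans 0<1 1≤κ) (begin
    κ ℚ.* (y ℚ.* s)                          ≡⟨ solve 3 (λ k y s → k :* (y :* s) := y :* (k :* s)) refl κ y s ⟩
    y ℚ.* (κ ℚ.* s)                          ≡⟨ *-inv-cancel (fromℕℚ (ℓ (GM (2 + n)))) 0<κs ⟩
    fromℕℚ (ℓ (GM (2 + n)))                  ≡⟨ trans (ℓ-halfEdges n) (cong (2ℚ ℚ.*_) (halfEdges-edgeSum n)) ⟩
    2ℚ ℚ.* (3ℚ ^ℚ n ℚ.* edgeSum n)     ≡⟨ ℚ.*-assoc 2ℚ (3ℚ ^ℚ n) (edgeSum n) ⟨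
    2ℚ ℚ.* 3ℚ ^ℚ n ℚ.* edgeSum n       ≡⟨ cong (ℚ._* edgeSum n) κ≡ ⟨
    κ ℚ.* edgeSum n                                ∎)
    where open ≡-Reasoning

  0≤y : 0ℚ ℚ.≤ y
  0≤y = *-cancelˡ-≤ (κ ℚ.* s) 0<κs (begin
    κ ℚ.* s ℚ.* 0ℚ             ≡⟨ ℚ.*-zeroʳ (κ ℚ.* s) ⟩
    0ℚ                         ≤⟨ 0≤fromℕℚ (ℓ (GM (2 + n))) ⟩
    fromℕℚ (ℓ (GM (2 + n)))    ≡⟨ *-inv-cancel (fromℕℚ (ℓ (GM (2 + n)))) 0<κs ⟨
    y ℚ.* (κ ℚ.* s)            ≡⟨ ℚ.*-comm y (κ ℚ.* s) ⟩
    κ ℚ.* s ℚ.* y              ∎)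
    where open ℚ.≤-Reasoning

  y-bound : 1ℚ ℚ.≤ wallis n → squaredRatio n ℚ.≤ 2ℚ →
            ℚ.∣ y ℚ.- 1ℚ ∣ ℚ.≤ fromℕℚ 48 ℚ.* η ℚ.+ (4ℚ ℚ.* ℚ.∣ squaredRatio n ℚ.- 1ℚ ∣ ℚ.+ ℚ.∣ p ℚ.- wallis n ∣)
  y-bound 1≤V ω≤2 = ratio-bound {y} {s} {η} {q} {p} {squaredRatio n} {wallis n}
    0≤y ½≤s 0≤η η≤½ s²≤q (ℚ.<⇒≤ q<u²) 1≤V (ℚ.<⇒≤ 0<p) p≤4 (0≤squaredRatio n) ω≤2
    (trans (cong (λ l → l ℚ.* l ℚ.* wallis n) y-s) (trans (edgeSum²-wallis n) (cong (ℚ._* squaredRatio n) (sym q-p))))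

  -- ε is shared equally by 48η, 4|w-1|, |p-V| and the margin, so w has to be within ε/16 of 1. The
  -- two bounds by 1 provide `wallis n` ≥ 2 - 1 and `squaredRatio n` ≤ 2.
  y-close : ∀ ε z → z ≡ κ ℚ.* s → ℚ.∣ p ℚ.- wallis n ∣ ℚ.< 1ℚ → ℚ.∣ p ℚ.- wallis n ∣ ℚ.< ¼ ℚ.* ε →
            ℚ.∣ squaredRatio n ℚ.- 1ℚ ∣ ℚ.< 1ℚ → ℚ.∣ squaredRatio n ℚ.- 1ℚ ∣ ℚ.< (+ 1 / 16) ℚ.* ε → + 48 / suc (suc m) ℚ.< ¼ ℚ.* ε →
            ℚ.∣ fromℕℚ (ℓ (GM (2 + n))) ℚ.* inv z ℚ.- 1ℚ ∣ ℚ.+ ¼ ℚ.* ε ℚ.≤ ε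
  y-close ε _ refl V≈p V≈p′ ω≈1 ω≈1′ η≈0 = ℚ.<⇒≤ (begin-strict
    ℚ.∣ y ℚ.- 1ℚ ∣ ℚ.+ e
      ≤⟨ ℚ.+-monoˡ-≤ e (y-bound 1≤V ω≤2) ⟩
    fromℕℚ 48 ℚ.* η ℚ.+ (4ℚ ℚ.* ℚ.∣ squaredRatio n ℚ.- 1ℚ ∣ ℚ.+ ℚ.∣ p ℚ.- wallis n ∣) ℚ.+ e
      <⟨ ℚ.+-monoˡ-< e (ℚ.+-mono-< (subst (ℚ._< e) 48η η≈0)
           (ℚ.+-mono-< (ℚ.*-monoʳ-<-pos 4ℚ {{ℚ.positive (0<fromℕℚ-suc 3)}} ω≈1′) V≈p′)) ⟩
    e ℚ.+ (4ℚ ℚ.* ((+ 1 / 16) ℚ.* ε) ℚ.+ e) ℚ.+ e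
      ≡⟨ solve 1 (λ e → con ¼ :* e :+ (con 4ℚ :* (con (+ 1 / 16) :* e) :+ con ¼ :* e) :+ con ¼ :* e := e) refl ε ⟩
    ε ∎)
    where
    open ℚ.≤-Reasoning
    e = ¼ ℚ.* ε
    1≤V : 1ℚ ℚ.≤ wallis n
    1≤V = 0≤-⇒≤ (subst (0ℚ ℚ.≤_) (solve 2 (λ p v → (p :- con 2ℚ) :+ (con 1ℚ :- (p :- v)) := v :- con 1ℚ) refl p (wallis n))
      (ℚ.+-mono-≤ (≤⇒0≤- 2≤p) (≤⇒0≤- (ℚ.<⇒≤ (ℚ.≤-<-trans (p≤∣p∣ (p ℚ.- wallis n)) V≈p)))))
    ω≤2 : squaredRatio n ℚ.≤ 2ℚ
    ω≤2 = ℚ.<⇒≤ (-<⇒<+ (squaredRatio n) 1ℚ (ℚ.≤-<-trans (p≤∣p∣ (squaredRatio n ℚ.- 1ℚ)) ω≈1))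
    48η : + 48 / suc (suc m) ≡ fromℕℚ 48 ℚ.* η
    48η = *-cancelˡ-≡ N (0<fromℕℚ-suc (suc m)) (begin-equality
      N ℚ.* (+ 48 / suc (suc m))    ≡⟨ trans (ℚ.*-comm N (+ 48 / suc (suc m))) (/-*-cancel 48 (suc (suc m))) ⟩
      fromℕℚ 48 ℚ.* 1ℚ              ≡⟨ cong (fromℕℚ 48 ℚ.*_) (/-*-cancel 1 (suc (suc m))) ⟨
      fromℕℚ 48 ℚ.* (η ℚ.* N)       ≡⟨ solve 2 (λ r n → con (fromℕℚ 48) :* (r :* n) := n :* (con (fromℕℚ 48) :* r)) refl η N ⟩
      N ℚ.* (fromℕℚ 48 ℚ.* η)       ∎)
      where N = fromℕℚ (suc (suc m))

ℓ∼ : (λ n → fromℚ (fromℕℚ (ℓ (GM n)))) ∼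
         (λ n → fromℚ (+ (2 * 3 ^ n) / 3 ^ 2) *ᵣ √ᵣ (fromℚ (fromℕℚ (3 * n)) ÷ᵣ π ⟨ π#0 ⟩))
ℓ∼ = 2 , apart , ∼-intro x y apart λ ε 0<ε → limit ε 0<ε
  (wallis-leibniz 1ℚ 0<1) (wallis-leibniz (¼ ℚ.* ε) (0<ε/4 0<ε))
  (squaredRatio⇾1 .within 1ℚ 0<1) (squaredRatio⇾1 .within ((+ 1 / 16) ℚ.* ε) (0<* (/-mono-< 0 1 1 16 (s≤s z≤n)) 0<ε))
  (/<ε 48 (¼ ℚ.* ε) (0<ε/4 0<ε))
  where
  x y : ℕ → ℝ
  x n = fromℚ (fromℕℚ (ℓ (GM (2 + n))))
  y n = fromℚ (+ (2 * 3 ^ (2 + n)) / 3 ^ 2) *ᵣ √ᵣ (fromℚ (fromℕℚ (3 * (2 + n))) ÷ᵣ π ⟨ π#0 ⟩)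
  apart : ∀ n → y n #0
  -- The denominator is at least 1/2 from approximation index 1 on; at index 0 it is 0, as `inv`
  -- sends 0 to 0.
  apart n = #0-intro {y n} ½ (/-mono-< 0 1 1 2 (s≤s z≤n)) 1 λ { (suc m) _ → Quotient.½≤κs n m }
  0<ε/4 : ∀ {ε} → 0ℚ ℚ.< ε → 0ℚ ℚ.< ¼ ℚ.* ε
  0<ε/4 0<ε = 0<* (/-mono-< 0 1 1 4 (s≤s z≤n)) 0<ε
  -- As arguments the moduli stay neutral; the closed numeral proj₁ (wallis-leibniz 1ℚ 0<1)
  -- would be evaluated.
  limit : ∀ ε → 0ℚ ℚ.< ε →
    ∃[ K ] (∀ n m → K ℕ.≤ n → K ℕ.≤ m → ℚ.∣ approx π m ℚ.- wallis n ∣ ℚ.< 1ℚ) →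
    ∃[ K ] (∀ n m → K ℕ.≤ n → K ℕ.≤ m → ℚ.∣ approx π m ℚ.- wallis n ∣ ℚ.< ¼ ℚ.* ε) →
    ∃[ N ] (∀ n → N ℕ.≤ n → ℚ.∣ squaredRatio n ℚ.- 1ℚ ∣ ℚ.< 1ℚ) →
    ∃[ N ] (∀ n → N ℕ.≤ n → ℚ.∣ squaredRatio n ℚ.- 1ℚ ∣ ℚ.< (+ 1 / 16) ℚ.* ε) →
    ∃[ M ] (∀ m → M ℕ.≤ m → + 48 / suc m ℚ.< ¼ ℚ.* ε) →
    ∃[ δ ] 0ℚ ℚ.< δ × ∃[ N ] ∀ n → N ℕ.≤ n → ∃[ M ] ∀ m → M ℕ.≤ m →
      ℚ.∣ approx (x n) m ℚ.* inv (approx (y n) m) ℚ.- 1ℚ ∣ ℚ.+ δ ℚ.≤ ε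
  limit ε 0<ε (K₁ , V≈p) (K₂ , V≈p′) (N₁ , ω≈1) (N₂ , ω≈1′) (M , small) =
    ¼ ℚ.* ε , 0<ε/4 0<ε , (K₁ ⊔ K₂) ⊔ (N₁ ⊔ N₂) , λ n n≥ → suc ((K₁ ⊔ K₂) ⊔ M) , λ
      { (suc m) (s≤s m≥) →
        let
          n≥K = ℕ.m⊔n≤o⇒m≤o (K₁ ⊔ K₂) (N₁ ⊔ N₂) n≥
          n≥N = ℕ.m⊔n≤o⇒n≤o (K₁ ⊔ K₂) (N₁ ⊔ N₂) n≥
          m≥K = ℕ.m≤n⇒m≤1+n (ℕ.m⊔n≤o⇒m≤o (K₁ ⊔ K₂) M m≥)
          m≥M = ℕ.m≤n⇒m≤1+n (ℕ.m⊔n≤o⇒n≤o (K₁ ⊔ K₂) M m≥)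
        in Quotient.y-close n m ε (approx (y n) (suc m)) refl
          (V≈p n (suc m) (ℕ.m⊔n≤o⇒m≤o K₁ K₂ n≥K) (ℕ.m⊔n≤o⇒m≤o K₁ K₂ m≥K))
          (V≈p′ n (suc m) (ℕ.m⊔n≤o⇒n≤o K₁ K₂ n≥K) (ℕ.m⊔n≤o⇒n≤o K₁ K₂ m≥K))
          (ω≈1 n (ℕ.m⊔n≤o⇒m≤o N₁ N₂ n≥N))
          (ω≈1′ n (ℕ.m⊔n≤o⇒n≤o N₁ N₂ n≥N))
          (small (suc m) m≥M) }

mainTheorem10 : (edgeSeries ≗
    poly (+ 0 ∷ + 0 ∷ + 2 ∷ []) ÷ₛ
    (poly (+ 1 ∷ - + 3 ∷ []) *ₛ √ₛ poly (+ 1 ∷ - + 2 ∷ - + 3 ∷ [])))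
    × (∀ n →
    (fromℕℚ (ℓ (GM (n + 2))) ≡
    fromℕℚ 2 ℚ.* (Σ[ k ≤ n ] T k ℚ.* fromℕℚ 3 ^ℚ (n ∸ k)))
    × (fromℕℚ (ℓ (GM (n + 2))) ≡
    (+ 2 / 4 ^ n) {{m^n≢0 4 n}} ℚ.*
    (Σ[ k ≤ n ] fromℕℚ ((2 * k) C k) ℚ.* fromℕℚ ((2 * n ∸ 2 * k) C (n ∸ k))
    ℚ.* fromℕℚ (2 * k + 1) ℚ.* fromℕℚ 3 ^ℚ k ℚ.* (ℚ.- fromℕℚ 1) ^ℚ (n ∸ k)))
    × (fromℕℚ (ℓ (GM (n + 2))) ≡
    fromℕℚ 2 ℚ.*
    (Σ[ k ≤ n ] fromℕℚ ((n + 1) C (k + 1)) ℚ.* fromℕℚ ((2 * k) C k)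
    ℚ.* (ℚ.- fromℕℚ 1) ^ℚ k ℚ.* fromℕℚ 3 ^ℚ (n ∸ k))))
    × ((λ n → fromℚ (fromℕℚ (ℓ (GM n)))) ∼
    (λ n → fromℚ (+ (2 * 3 ^ n) / 3 ^ 2) *ᵣ √ᵣ (fromℚ (fromℕℚ (3 * n)) ÷ᵣ π ⟨ π#0 ⟩)))
    × ((λ n → fromℚ (i (GM n) {{GM-nonEmpty n}})) ∼ (λ n → fromℚ ((+ 4 / 9) ℚ.* fromℕℚ n)))
mainTheorem10 =
  edgeSeries-closed ,
  -- The first formula needs no rewriting: its sum is `halfEdges n` by definition.
  (λ n → ℓ-halfEdges-shifted n , ℓ-convolution n , ℓ-binomial n) ,
  ℓ∼ ,
  hasseIndex∼
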